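{- Let $n$ be a positive integer, and let $0<\lambda_1<\cdots<\lambda_n$ and $0<\mu_1<\cdots<\mu_n$ be real numbers such that $\mu_{i+1}-\mu_i$ is a positive integer for all $1\le i\le n-1$. Then, for every positive integer $m$, the $n\times n$ matrices $$\left[(\Gamma(\lambda_i+\mu_j))^m\right]_{i,j=1}^n\quad\text{and}\quad\left[\frac{1}{\beta(\lambda_i,\mu_j)^m}\right]_{i,j=1}^n$$ are totally positive.
   Context: $\Gamma$ is the gamma function and, for $x,y>0$, $\beta(x,y)=\frac{\Gamma(x)\Gamma(y)}{\Gamma(x+y)}$ is the beta function. The powers are entrywise. A matrix is called totally positive if all its minors (determinants of all square submatrices, of every size) are positive. -}

module Defs where

open import Data.Fin.Base as Fin using (Fin; toℕ; punchIn)
open import Data.Integer.Base as ℤ using (+_; +≤+)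
import Data.Integer.Properties as ℤ
open import Data.Nat.Base as ℕ using (ℕ; zero; suc)
import Data.Nat.Properties as ℕ
open import Data.Product using (Σ; ∃; _×_; _,_; proj₁; proj₂; Σ-syntax; ∃-syntax)
open import Data.Rational.Base as ℚ using (ℚ; 0ℚ; 1ℚ; ½; Positive; mkℚ; *≤*)
import Data.Rational.Properties as ℚ
open import Data.Rational.Solver using (module +-*-Solver)
open import Data.Rational.Unnormalised.Base as ℚᵘ using (mkℚᵘ; *≡*)
import Data.Rational.Unnormalised.Properties as ℚᵘ
open import Data.Sum.Base using (inj₁; inj₂)
import Data.Vec.Functional as Vector
open import Relation.Binary.PropositionalEquality
  using (_≡_; refl; sym; trans; cong; cong₂; subst; subst₂; module ≡-Reasoning)

module Q where
  open import Data.Rational.Base using (_+_; _*_; _-_; -_; ∣_∣; _≤_; _<_)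
  open +-*-Solver

  third : ℚ
  third = + 1 ℚ./ 3

  halves : ∀ ε → ε * ½ + ε * ½ ≡ ε
  halves = solve 1 (λ e → e :* con ½ :+ e :* con ½ := e) refl

  thirds : ∀ ε → (ε * third + ε * third) + ε * third ≡ ε
  thirds = solve 1 (λ e → (e :* con third :+ e :* con third) :+ e :* con third := e) refl

  dist-sym : ∀ p q → ∣ p - q ∣ ≡ ∣ q - p ∣
  dist-sym p q = trans (sym (ℚ.∣-p∣≡∣p∣ (p - q))) (cong ∣_∣ (lem p q))
    where
    lem : ∀ p q → - (p - q) ≡ q - p
    lem = solve 2 (λ p q → :- (p :- q) := q :- p) refl

  triangle : ∀ p q r {ε δ} → ∣ p - q ∣ ≤ ε → ∣ q - r ∣ ≤ δ → ∣ p - r ∣ ≤ ε + δ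
  triangle p q r h k = ℚ.≤-trans
    (subst (λ z → ∣ z ∣ ≤ ∣ p - q ∣ + ∣ q - r ∣) (lem p q r) (ℚ.∣p+q∣≤∣p∣+∣q∣ (p - q) (q - r)))
    (ℚ.+-mono-≤ h k)
    where
    lem : ∀ p q r → (p - q) + (q - r) ≡ p - r
    lem = solve 3 (λ p q r → (p :- q) :+ (q :- r) := p :- r) refl

  triangle₃ : ∀ p q r t ε → ∣ p - q ∣ ≤ ε * third → ∣ q - r ∣ ≤ ε * third →
              ∣ t - r ∣ ≤ ε * third → ∣ p - t ∣ ≤ ε
  triangle₃ p q r t ε h k l = subst (∣ p - t ∣ ≤_) (thirds ε)
    (triangle p r t (triangle p q r h k) (subst (_≤ ε * third) (dist-sym t r) l))

  abs-sub : ∀ p q → ∣ p ∣ - ∣ q ∣ ≤ ∣ p - q ∣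
  abs-sub p q = subst (∣ p ∣ - ∣ q ∣ ≤_) (lem₂ ∣ p - q ∣ ∣ q ∣)
    (ℚ.+-monoˡ-≤ (- ∣ q ∣)
      (subst (λ z → ∣ z ∣ ≤ ∣ p - q ∣ + ∣ q ∣) (lem₁ p q) (ℚ.∣p+q∣≤∣p∣+∣q∣ (p - q) q)))
    where
    lem₁ : ∀ p q → (p - q) + q ≡ p
    lem₁ = solve 2 (λ p q → (p :- q) :+ q := p) refl
    lem₂ : ∀ p q → (p + q) - q ≡ p
    lem₂ = solve 2 (λ p q → (p :+ q) :- q := p) refl

  reverse-triangle : ∀ p q → ∣ ∣ p ∣ - ∣ q ∣ ∣ ≤ ∣ p - q ∣
  reverse-triangle p q with ℚ.∣p∣≡p∨∣p∣≡-p (∣ p ∣ - ∣ q ∣)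
  ... | inj₁ e = subst (_≤ ∣ p - q ∣) (sym e) (abs-sub p q)
  ... | inj₂ e = subst₂ _≤_ (trans (lem ∣ p ∣ ∣ q ∣) (sym e)) (dist-sym q p) (abs-sub q p)
    where
    lem : ∀ p q → q - p ≡ - (p - q)
    lem = solve 2 (λ p q → q :- p := :- (p :- q)) refl

  bound⇒close : ∀ p q {B} → ∣ p - q ∣ ≤ B → ∣ p ∣ ≤ ∣ q ∣ + B
  bound⇒close p q h = subst (_≤ ∣ q ∣ + _) (lem ∣ q ∣ ∣ p ∣)
    (ℚ.+-monoʳ-≤ ∣ q ∣ (ℚ.≤-trans (abs-sub p q) h))
    where
    lem : ∀ a b → a + (b - a) ≡ b
    lem = solve 2 (λ a b → a :+ (b :- a) := b) refl

  p≤∣p∣ : ∀ p → p ≤ ∣ p ∣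
  p≤∣p∣ p with ℚ.≤-total 0ℚ p
  ... | inj₁ h = ℚ.≤-reflexive (sym (ℚ.0≤p⇒∣p∣≡p h))
  ... | inj₂ h = ℚ.≤-trans h (ℚ.0≤∣p∣ p)

  *-mono-≤ : ∀ {p q r s} → 0ℚ ≤ p → 0ℚ ≤ s → p ≤ q → r ≤ s → p * r ≤ q * s
  *-mono-≤ {p} {q} {r} {s} 0≤p 0≤s p≤q r≤s = ℚ.≤-trans
    (ℚ.*-monoˡ-≤-nonNeg p {{ℚ.nonNegative 0≤p}} r≤s)
    (ℚ.*-monoʳ-≤-nonNeg s {{ℚ.nonNegative 0≤s}} p≤q)

  inv : ∀ p → .(Positive p) → ℚ
  inv p h = (ℚ.1/ p) {{ℚ.pos⇒nonZero p {{h}}}}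

  inv-pos : ∀ p .(h : Positive p) → Positive (inv p h)
  inv-pos p h = ℚ.1/pos⇒pos p {{h}}

  inv-*ˡ : ∀ p .(h : Positive p) → inv p h * p ≡ 1ℚ
  inv-*ˡ p h = ℚ.*-inverseˡ p {{ℚ.pos⇒nonZero p {{h}}}}

  0≤pos : ∀ p .{{_ : Positive p}} → 0ℚ ≤ p
  0≤pos p = ℚ.<⇒≤ (ℚ.positive⁻¹ p)

  pos-≤ : ∀ {p q} .{{_ : Positive p}} → p ≤ q → Positive q
  pos-≤ {p} h = ℚ.positive (ℚ.<-≤-trans (ℚ.positive⁻¹ p) h)

  inv-anti : ∀ p q .(hp : Positive p) .(hq : Positive q) → p ≤ q → inv q hq ≤ inv p hp
  inv-anti p q hp hq p≤q = subst₂ _≤_ e₁ e₂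
    (*-mono-≤ {iq * p} {iq * q} {ip} {ip}
      (0≤pos (iq * p) {{ℚ.pos*pos⇒pos iq {{inv-pos q hq}} p {{hp}}}})
      (0≤pos ip {{inv-pos p hp}})
      (ℚ.*-monoˡ-≤-nonNeg iq {{ℚ.pos⇒nonNeg iq {{inv-pos q hq}}}} p≤q) ℚ.≤-refl)
    where
    ip iq : ℚ
    ip = inv p hp
    iq = inv q hq
    e₁ : (iq * p) * ip ≡ iq
    e₁ = trans (solve 3 (λ a b c → (a :* b) :* c := a :* (c :* b)) refl iq p ip)
           (trans (cong (iq *_) (inv-*ˡ p hp)) (ℚ.*-identityʳ iq))
    e₂ : (iq * q) * ip ≡ ip
    e₂ = trans (cong (_* ip) (inv-*ˡ q hq)) (ℚ.*-identityˡ ip)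

  inv-dist : ∀ c p q .(hc : Positive c) .(hp : Positive p) .(hq : Positive q) →
             c ≤ p → c ≤ q →
             ∣ inv p hp - inv q hq ∣ ≤ ∣ p - q ∣ * (inv c hc * inv c hc)
  inv-dist c p q hc hp hq c≤p c≤q = subst (_≤ ∣ p - q ∣ * (ic * ic)) (sym e)
    (ℚ.*-monoˡ-≤-nonNeg ∣ p - q ∣ {{ℚ.∣-∣-nonNeg (p - q)}}
      (*-mono-≤ (0≤pos ip {{inv-pos p hp}}) (0≤pos ic {{inv-pos c hc}})
        (inv-anti c p hc hp c≤p) (inv-anti c q hc hq c≤q)))
    where
    ic ip iq : ℚ
    ic = inv c hc
    ip = inv p hp
    iq = inv q hq
    id₁ : ip - iq ≡ (q - p) * (ip * iq)
    id₁ = begin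
      ip - iq                           ≡⟨ cong₂ _-_ (sym (ℚ.*-identityʳ ip)) (sym (ℚ.*-identityʳ iq)) ⟩
      ip * 1ℚ - iq * 1ℚ                 ≡⟨ cong₂ (λ a b → ip * a - iq * b) (sym (inv-*ˡ q hq)) (sym (inv-*ˡ p hp)) ⟩
      ip * (iq * q) - iq * (ip * p)     ≡⟨ solve 4 (λ a b p q → a :* (b :* q) :- b :* (a :* p) := (q :- p) :* (a :* b)) refl ip iq p q ⟩
      (q - p) * (ip * iq)               ∎
      where open ≡-Reasoning
    0≤ii : 0ℚ ≤ ip * iq
    0≤ii = 0≤pos (ip * iq) {{ℚ.pos*pos⇒pos ip {{inv-pos p hp}} iq {{inv-pos q hq}}}}
    e : ∣ ip - iq ∣ ≡ ∣ p - q ∣ * (ip * iq)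
    e = trans (cong ∣_∣ id₁) (trans (ℚ.∣p*q∣≡∣p∣*∣q∣ (q - p) (ip * iq))
          (cong₂ _*_ (dist-sym q p) (ℚ.0≤p⇒∣p∣≡p 0≤ii)))

  *-dist : ∀ p p′ q q′ → ∣ p * q - p′ * q′ ∣ ≤ ∣ p ∣ * ∣ q - q′ ∣ + ∣ q′ ∣ * ∣ p - p′ ∣
  *-dist p p′ q q′ = subst₂ _≤_ (cong ∣_∣ (lem p p′ q q′))
    (cong₂ _+_ (ℚ.∣p*q∣≡∣p∣*∣q∣ p (q - q′)) (ℚ.∣p*q∣≡∣p∣*∣q∣ q′ (p - p′)))
    (ℚ.∣p+q∣≤∣p∣+∣q∣ (p * (q - q′)) (q′ * (p - p′)))
    where
    lem : ∀ p p′ q q′ → p * (q - q′) + q′ * (p - p′) ≡ p * q - p′ * q′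
    lem = solve 4 (λ p p′ q q′ → p :* (q :- q′) :+ q′ :* (p :- p′) := p :* q :- p′ :* q′) refl

  *-close : ∀ p p′ q q′ A B δ ε → 0ℚ ≤ δ → ∣ p ∣ ≤ A → ∣ q′ ∣ ≤ B →
            ∣ p - p′ ∣ ≤ δ → ∣ q - q′ ∣ ≤ δ → A * δ + B * δ ≡ ε → ∣ p * q - p′ * q′ ∣ ≤ ε
  *-close p p′ q q′ A B δ ε 0≤δ h k u v refl = ℚ.≤-trans (*-dist p p′ q q′)
    (ℚ.+-mono-≤ (*-mono-≤ (ℚ.0≤∣p∣ p) 0≤δ h v) (*-mono-≤ (ℚ.0≤∣p∣ q′) 0≤δ k u))

  toℚᵘ-/ : ∀ n d → ℚ.toℚᵘ (+ n ℚ./ suc d) ℚᵘ.≃ mkℚᵘ (+ n) d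
  toℚᵘ-/ n d = ℚ.toℚᵘ-fromℚᵘ (mkℚᵘ (+ n) d)

  /-mono : ∀ m a n b → m ℕ.* suc b ℕ.≤ n ℕ.* suc a → + m ℚ./ suc a ≤ + n ℚ./ suc b
  /-mono m a n b h = ℚ.toℚᵘ-cancel-≤
    (ℚᵘ.≤-respˡ-≃ (ℚᵘ.≃-sym (toℚᵘ-/ m a))
      (ℚᵘ.≤-respʳ-≃ (ℚᵘ.≃-sym (toℚᵘ-/ n b))
        (ℚᵘ.*≤* (subst₂ ℤ._≤_ (ℤ.pos-* m (suc b)) (ℤ.pos-* n (suc a)) (+≤+ h)))))

  fromℕ-mono : ∀ {m n} → m ℕ.≤ n → + m ℚ./ 1 ≤ + n ℚ./ 1
  fromℕ-mono {m} {n} h = /-mono m 0 n 0 (ℕ.*-monoˡ-≤ 1 h)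

  /-*-cancel : ∀ k → (+ 1 ℚ./ suc k) * (+ suc k ℚ./ 1) ≡ 1ℚ
  /-*-cancel k = ℚ.toℚᵘ-injective
    (ℚᵘ.≃-trans (ℚ.toℚᵘ-homo-* (+ 1 ℚ./ suc k) (+ suc k ℚ./ 1))
      (ℚᵘ.≃-trans (ℚᵘ.*-cong (toℚᵘ-/ 1 k) (toℚᵘ-/ (suc k) 0))
        (*≡* (cong (λ z → + suc z) (trans (ℕ.*-identityʳ _) (trans (ℕ.+-identityʳ k)
               (sym (trans (ℕ.+-identityʳ _) (ℕ.*-identityʳ k)))))))))

  ≤-ceil : ∀ p → ∃[ n ] p ≤ + n ℚ./ 1
  ≤-ceil (mkℚ (ℤ.-[1+ n ]) d c) = 0 , *≤* (subst (ℤ._≤ + 0) (sym (ℤ.*-identityʳ ℤ.-[1+ n ])) ℤ.-≤+)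
  ≤-ceil p@(mkℚ (+ n) d c) = n , subst (_≤ + n ℚ./ 1) (ℚ.↥p/↧p≡p p)
    (/-mono n d n 0 (ℕ.*-monoʳ-≤ n (ℕ.s≤s ℕ.z≤n)))

  /-nonNeg : ∀ n d → 0ℚ ≤ + n ℚ./ suc d
  /-nonNeg n d = /-mono 0 0 n d ℕ.z≤n

  pow : ℚ → ℕ → ℚ
  pow r zero    = 1ℚ
  pow r (suc j) = r * pow r j

  pow-nonNeg : ∀ r j → 0ℚ ≤ r → 0ℚ ≤ pow r j
  pow-nonNeg r zero    h = /-nonNeg 1 0
  pow-nonNeg r (suc j) h = subst (_≤ r * pow r j) (ℚ.*-zeroˡ 0ℚ)
    (*-mono-≤ ℚ.≤-refl (pow-nonNeg r j h) h (pow-nonNeg r j h))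

  fromℕ-suc : ∀ j → + suc j ℚ./ 1 ≡ 1ℚ + (+ j ℚ./ 1)
  fromℕ-suc j = ℚ.toℚᵘ-injective
    (ℚᵘ.≃-trans (toℚᵘ-/ (suc j) 0) (ℚᵘ.≃-sym
      (ℚᵘ.≃-trans (ℚ.toℚᵘ-homo-+ 1ℚ (+ j ℚ./ 1))
        (ℚᵘ.≃-trans (ℚᵘ.+-congʳ (ℚ.toℚᵘ 1ℚ) (toℚᵘ-/ j 0))
          (*≡* (cong (λ z → (+ 1 ℤ.+ z) ℤ.* + 1) (ℤ.*-identityʳ (+ j))))))))

  bernoulli : ∀ r j → 0ℚ ≤ r → 0ℚ ≤ 1ℚ - r →
              pow r j * (1ℚ + (+ j ℚ./ 1) * (1ℚ - r)) ≤ 1ℚ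
  bernoulli r zero    h k = ℚ.≤-reflexive
    (trans (ℚ.*-identityˡ _) (trans (cong (λ z → 1ℚ + z) (ℚ.*-zeroˡ (1ℚ - r))) refl))
  bernoulli r (suc j) h k = ℚ.≤-trans
    (subst (_≤ pow r j * (1ℚ + J * s)) (sym e)
      (ℚ.*-monoˡ-≤-nonNeg (pow r j) {{ℚ.nonNegative (pow-nonNeg r j h)}} step))
    (bernoulli r j h k)
    where
    s J : ℚ
    s = 1ℚ - r
    J = + j ℚ./ 1
    e : r * pow r j * (1ℚ + (+ suc j ℚ./ 1) * s) ≡ pow r j * (r * (1ℚ + (1ℚ + J) * s))
    e = trans (cong (λ z → r * pow r j * (1ℚ + z * s)) (fromℕ-suc j))
          (solve 3 (λ r p x → r :* p :* x := p :* (r :* x)) refl r (pow r j) (1ℚ + (1ℚ + J) * s))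
    0≤sq : 0ℚ ≤ (1ℚ + J) * (s * s)
    0≤sq = subst (_≤ (1ℚ + J) * (s * s)) (ℚ.*-zeroˡ 0ℚ)
      (*-mono-≤ ℚ.≤-refl 0≤ss (ℚ.+-mono-≤ (/-nonNeg 1 0) (/-nonNeg j 0)) 0≤ss)
      where
      0≤ss : 0ℚ ≤ s * s
      0≤ss = subst (_≤ s * s) (ℚ.*-zeroˡ 0ℚ) (*-mono-≤ ℚ.≤-refl k k k)
    step : r * (1ℚ + (1ℚ + J) * s) ≤ 1ℚ + J * s
    step = subst₂ _≤_ (lem r J) (ℚ.+-identityʳ _)
      (ℚ.+-monoʳ-≤ (1ℚ + J * s) (ℚ.neg-antimono-≤ 0≤sq))
      where
      lem : ∀ r J → (1ℚ + J * (1ℚ - r)) - (1ℚ + J) * ((1ℚ - r) * (1ℚ - r)) ≡ r * (1ℚ + (1ℚ + J) * (1ℚ - r))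
      lem = solve 2 (λ r J → (con 1ℚ :+ J :* (con 1ℚ :- r)) :- (con 1ℚ :+ J) :* ((con 1ℚ :- r) :* (con 1ℚ :- r))
              := r :* (con 1ℚ :+ (con 1ℚ :+ J) :* (con 1ℚ :- r))) refl

  module _ (v P : ℕ → ℚ) (P-suc : ∀ k → P (suc k) ≡ P k + v k)
           (r : ℚ) (0≤s : 0ℚ ≤ 1ℚ - r) (L : ℕ)
           (ratio : ∀ k → L ℕ.≤ k → ∣ v (suc k) ∣ ≤ r * ∣ v k ∣) where

    tail : ∀ l → (1ℚ - r) * ∣ P (l ℕ.+ L) - P L ∣ + ∣ v (l ℕ.+ L) ∣ ≤ ∣ v L ∣
    tail zero = ℚ.≤-reflexive (trans
      (cong (λ z → (1ℚ - r) * z + ∣ v L ∣) (cong ∣_∣ (ℚ.+-inverseʳ (P L))))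
      (trans (cong (_+ ∣ v L ∣) (ℚ.*-zeroʳ (1ℚ - r))) (ℚ.+-identityˡ _)))
    tail (suc l) = ℚ.≤-trans
      (ℚ.+-mono-≤
        (ℚ.*-monoˡ-≤-nonNeg (1ℚ - r) {{ℚ.nonNegative 0≤s}} grow)
        (ratio (l ℕ.+ L) (ℕ.m≤n+m L l)))
      (subst (_≤ ∣ v L ∣) (sym (lem r D ∣ v (l ℕ.+ L) ∣)) (tail l))
      where
      D : ℚ
      D = ∣ P (l ℕ.+ L) - P L ∣
      grow : ∣ P (suc (l ℕ.+ L)) - P L ∣ ≤ D + ∣ v (l ℕ.+ L) ∣
      grow = subst (λ z → ∣ z ∣ ≤ D + ∣ v (l ℕ.+ L) ∣)
        (trans (solve 3 (λ a b c → (a :- b) :+ c := (a :+ c) :- b) refl (P (l ℕ.+ L)) (P L) (v (l ℕ.+ L)))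
               (cong (_- P L) (sym (P-suc (l ℕ.+ L)))))
        (ℚ.∣p+q∣≤∣p∣+∣q∣ (P (l ℕ.+ L) - P L) (v (l ℕ.+ L)))
      lem : ∀ r D w → (1ℚ - r) * (D + w) + r * w ≡ (1ℚ - r) * D + w
      lem = solve 3 (λ r D w → (con 1ℚ :- r) :* (D :+ w) :+ r :* w := (con 1ℚ :- r) :* D :+ w) refl

  geometric : ∀ (v : ℕ → ℚ) r K → 0ℚ ≤ r → (∀ k → K ℕ.≤ k → ∣ v (suc k) ∣ ≤ r * ∣ v k ∣) →
              ∀ j → ∣ v (j ℕ.+ K) ∣ ≤ pow r j * ∣ v K ∣
  geometric v r K 0≤r h zero    = ℚ.≤-reflexive (sym (ℚ.*-identityˡ _))
  geometric v r K 0≤r h (suc j) = ℚ.≤-trans (h (j ℕ.+ K) (ℕ.m≤n+m K j))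
    (subst (r * ∣ v (j ℕ.+ K) ∣ ≤_) (sym (ℚ.*-assoc r (pow r j) ∣ v K ∣))
      (ℚ.*-monoˡ-≤-nonNeg r {{ℚ.nonNegative 0≤r}} (geometric v r K 0≤r h j)))

  decay : ∀ r C η .{{_ : Positive C}} .{{_ : Positive η}} → 0ℚ ≤ r → Positive (1ℚ - r) →
          ∃[ j ] pow r j * C ≤ η
  decay r C η 0≤r s>0 = j , final
    where
    s : ℚ
    s = 1ℚ - r
    sη>0 : Positive (s * η)
    sη>0 = ℚ.pos*pos⇒pos s {{s>0}} η
    q : ℚ
    q = C * inv (s * η) sη>0
    j : ℕ
    j = proj₁ (≤-ceil q)
    J : ℚ
    J = + j ℚ./ 1
    C≤ : C ≤ (J * s) * η
    C≤ = subst₂ _≤_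
      (trans (ℚ.*-assoc C (inv (s * η) sη>0) (s * η)) (trans (cong (C *_) (inv-*ˡ (s * η) sη>0)) (ℚ.*-identityʳ C)))
      (sym (ℚ.*-assoc J s η))
      (ℚ.*-monoʳ-≤-nonNeg (s * η) {{ℚ.pos⇒nonNeg (s * η) {{sη>0}}}} (proj₂ (≤-ceil q)))
    Js≤ : J * s ≤ 1ℚ + J * s
    Js≤ = subst (_≤ 1ℚ + J * s) (ℚ.+-identityˡ (J * s)) (ℚ.+-monoˡ-≤ (J * s) (/-nonNeg 1 0))
    pJs≤1 : pow r j * (J * s) ≤ 1ℚ
    pJs≤1 = ℚ.≤-trans
      (ℚ.*-monoˡ-≤-nonNeg (pow r j) {{ℚ.nonNegative (pow-nonNeg r j 0≤r)}} Js≤)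
      (bernoulli r j 0≤r (0≤pos s {{s>0}}))
    final : pow r j * C ≤ η
    final = ℚ.≤-trans
      (ℚ.*-monoˡ-≤-nonNeg (pow r j) {{ℚ.nonNegative (pow-nonNeg r j 0≤r)}} C≤)
      (subst₂ _≤_ (ℚ.*-assoc (pow r j) (J * s) η) (ℚ.*-identityˡ η)
        (ℚ.*-monoʳ-≤-nonNeg η {{ℚ.pos⇒nonNeg η}} pJs≤1))

  tail-index : ∀ r C δ .{{_ : Positive C}} .{{_ : Positive δ}} → 0ℚ ≤ r → Positive (1ℚ - r) →
    ∃[ j ] ∀ (v P : ℕ → ℚ) → (∀ k → P (suc k) ≡ P k + v k) →
    ∀ K → (∀ k → K ℕ.≤ k → ∣ v (suc k) ∣ ≤ r * ∣ v k ∣) → ∣ v K ∣ ≤ C →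
    ∀ m → j ℕ.+ K ℕ.≤ m → ∣ P m - P (j ℕ.+ K) ∣ ≤ δ
  tail-index r C δ {{C>0}} 0≤r s>0 = j , λ v P P-suc K ratio v≤C m L≤m →
    let L = j ℕ.+ K
        D = ∣ P m - P L ∣
        open ℚ.≤-Reasoning in
    ℚ.*-cancelˡ-≤-pos s {{s>0}} (begin
      s * D                        ≡⟨ ℚ.+-identityʳ (s * D) ⟨
      s * D + 0ℚ                   ≤⟨ ℚ.+-monoʳ-≤ (s * D) (ℚ.0≤∣p∣ (v m)) ⟩
      s * D + ∣ v m ∣              ≤⟨ subst (λ z → s * ∣ P z - P L ∣ + ∣ v z ∣ ≤ ∣ v L ∣) (ℕ.m∸n+n≡m L≤m)
                                        (tail v P P-suc r (0≤pos s {{s>0}}) L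
                                          (λ k L≤k → ratio k (ℕ.≤-trans (ℕ.m≤n+m K j) L≤k)) (m ℕ.∸ L)) ⟩
      ∣ v L ∣                      ≤⟨ geometric v r K 0≤r ratio j ⟩
      pow r j * ∣ v K ∣            ≤⟨ ℚ.*-monoˡ-≤-nonNeg (pow r j) {{ℚ.nonNegative (pow-nonNeg r j 0≤r)}} v≤C ⟩
      pow r j * C                  ≤⟨ proj₂ dec ⟩
      s * δ                        ∎)
    where
    s : ℚ
    s = 1ℚ - r
    sδ>0 : Positive (s * δ)
    sδ>0 = ℚ.pos*pos⇒pos s {{s>0}} δ
    dec : ∃[ j ] pow r j * C ≤ s * δ
    dec = decay r C (s * δ) {{C>0}} {{sδ>0}} 0≤r s>0
    j : ℕ
    j = proj₁ dec

  0≤* : ∀ {p q} → 0ℚ ≤ p → 0ℚ ≤ q → 0ℚ ≤ p * q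
  0≤* {p} {q} h g = subst (_≤ p * q) (ℚ.*-zeroˡ 0ℚ) (*-mono-≤ {0ℚ} {p} {0ℚ} {q} ℚ.≤-refl g h g)

  exp-ratio : ∀ w y B K k → ∣ y ∣ ≤ B → B + B ≤ + K ℚ./ 1 → K ℕ.≤ k →
              ∣ w * (y * (+ 1 ℚ./ suc k)) ∣ ≤ ½ * ∣ w ∣
  exp-ratio w y B K k y≤B 2B≤K K≤k = begin
    ∣ w * (y * c) ∣          ≡⟨ ℚ.∣p*q∣≡∣p∣*∣q∣ w (y * c) ⟩
    ∣ w ∣ * ∣ y * c ∣        ≡⟨ cong (∣ w ∣ *_) (ℚ.∣p*q∣≡∣p∣*∣q∣ y c) ⟩
    ∣ w ∣ * (∣ y ∣ * ∣ c ∣)  ≡⟨ cong (λ z → ∣ w ∣ * (∣ y ∣ * z)) (ℚ.0≤p⇒∣p∣≡p 0≤c) ⟩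
    ∣ w ∣ * (∣ y ∣ * c)      ≤⟨ ℚ.*-monoˡ-≤-nonNeg ∣ w ∣ {{ℚ.∣-∣-nonNeg w}} yc≤½ ⟩
    ∣ w ∣ * ½                ≡⟨ ℚ.*-comm ∣ w ∣ ½ ⟩
    ½ * ∣ w ∣                ∎
    where
    open ℚ.≤-Reasoning
    c : ℚ
    c = + 1 ℚ./ suc k
    0≤c : 0ℚ ≤ c
    0≤c = /-nonNeg 1 k
    y≤ : ∣ y ∣ ≤ ½ * (+ suc k ℚ./ 1)
    y≤ = ℚ.≤-trans y≤B
      (subst (_≤ ½ * (+ suc k ℚ./ 1)) (solve 1 (λ b → con ½ :* (b :+ b) := b) refl B)
        (ℚ.*-monoˡ-≤-nonNeg ½ (ℚ.≤-trans 2B≤K (fromℕ-mono (ℕ.m≤n⇒m≤1+n K≤k)))))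
    yc≤½ : ∣ y ∣ * c ≤ ½
    yc≤½ = begin
      ∣ y ∣ * c                      ≤⟨ ℚ.*-monoʳ-≤-nonNeg c {{ℚ.nonNegative 0≤c}} y≤ ⟩
      ½ * (+ suc k ℚ./ 1) * c        ≡⟨ solve 3 (λ h k c → (h :* k) :* c := h :* (c :* k)) refl ½ (+ suc k ℚ./ 1) c ⟩
      ½ * (c * (+ suc k ℚ./ 1))      ≡⟨ cong (½ *_) (/-*-cancel k) ⟩
      ½ * 1ℚ                         ≡⟨ ℚ.*-identityʳ ½ ⟩
      ½                              ∎

  mobius-bound : ∀ ε B → Positive ε → Positive B → ∃[ r ] (r < 1ℚ) ×
    (∀ a j → ε ≤ a → a ≤ B → 0ℚ ≤ j → (a + 1ℚ) * j ≡ 1ℚ → ∣ (a - 1ℚ) * j ∣ ≤ r)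
  mobius-bound ε B ε>0 B>0 = r , r<1 , bd
    where
    e : ℚ
    e = ε ℚ.⊓ 1ℚ
    e>0 : Positive e
    e>0 with ℚ.≤-total ε 1ℚ
    ... | inj₁ l = subst Positive (sym (ℚ.p≤q⇒p⊓q≡p l)) ε>0
    ... | inj₂ g = subst Positive (sym (ℚ.p≥q⇒p⊓q≡q g)) _
    S>0 : Positive (B + 1ℚ)
    S>0 = ℚ.pos+pos⇒pos B {{B>0}} 1ℚ
    i η r : ℚ
    i = inv (B + 1ℚ) S>0
    η = e * i
    r = 1ℚ - η
    η>0 : Positive η
    η>0 = ℚ.pos*pos⇒pos e {{e>0}} i {{inv-pos (B + 1ℚ) S>0}}
    r<1 : r < 1ℚ
    r<1 = subst (r <_) (ℚ.+-identityʳ 1ℚ)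
      (ℚ.+-monoʳ-< 1ℚ (ℚ.neg-antimono-< (ℚ.positive⁻¹ η {{η>0}})))
    bd : ∀ a j → ε ≤ a → a ≤ B → 0ℚ ≤ j → (a + 1ℚ) * j ≡ 1ℚ → ∣ (a - 1ℚ) * j ∣ ≤ r
    bd a j ε≤a a≤B 0≤j aj≡1 = begin
      ∣ (a - 1ℚ) * j ∣      ≡⟨ ℚ.∣p*q∣≡∣p∣*∣q∣ (a - 1ℚ) j ⟩
      ∣ a - 1ℚ ∣ * ∣ j ∣    ≡⟨ cong (∣ a - 1ℚ ∣ *_) (ℚ.0≤p⇒∣p∣≡p 0≤j) ⟩
      ∣ a - 1ℚ ∣ * j        ≤⟨ ℚ.*-monoʳ-≤-nonNeg j {{ℚ.nonNegative 0≤j}} num ⟩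
      r * (a + 1ℚ) * j      ≡⟨ ℚ.*-assoc r (a + 1ℚ) j ⟩
      r * ((a + 1ℚ) * j)    ≡⟨ cong (r *_) aj≡1 ⟩
      r * 1ℚ                ≡⟨ ℚ.*-identityʳ r ⟩
      r                     ∎
      where
      open ℚ.≤-Reasoning
      ηa≤e : η * (a + 1ℚ) ≤ e
      ηa≤e = begin
        η * (a + 1ℚ)    ≤⟨ ℚ.*-monoˡ-≤-nonNeg η {{ℚ.pos⇒nonNeg η {{η>0}}}} (ℚ.+-monoˡ-≤ 1ℚ a≤B) ⟩
        η * (B + 1ℚ)    ≡⟨ ℚ.*-assoc e i (B + 1ℚ) ⟩
        e * (i * (B + 1ℚ)) ≡⟨ cong (e *_) (inv-*ˡ (B + 1ℚ) S>0) ⟩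
        e * 1ℚ          ≡⟨ ℚ.*-identityʳ e ⟩
        e               ∎
      sub : ∀ d → e ≤ d → (a + 1ℚ) - d ≤ r * (a + 1ℚ)
      sub d e≤d = subst ((a + 1ℚ) - d ≤_)
        (solve 2 (λ a η → (a :+ con 1ℚ) :- η :* (a :+ con 1ℚ) := (con 1ℚ :- η) :* (a :+ con 1ℚ)) refl a η)
        (ℚ.+-monoʳ-≤ (a + 1ℚ) (ℚ.neg-antimono-≤ (ℚ.≤-trans ηa≤e e≤d)))
      num : ∣ a - 1ℚ ∣ ≤ r * (a + 1ℚ)
      num with ℚ.∣p∣≡p∨∣p∣≡-p (a - 1ℚ)
      ... | inj₁ q = subst (_≤ r * (a + 1ℚ))
        (trans (solve 1 (λ a → (a :+ con 1ℚ) :- (con 1ℚ :+ con 1ℚ) := a :- con 1ℚ) refl a) (sym q))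
        (sub (1ℚ + 1ℚ) (ℚ.≤-trans (ℚ.p⊓q≤q ε 1ℚ) (fromℕ-mono {1} {2} (ℕ.s≤s ℕ.z≤n))))
      ... | inj₂ q = subst (_≤ r * (a + 1ℚ))
        (trans (solve 1 (λ a → (a :+ con 1ℚ) :- (a :+ a) := :- (a :- con 1ℚ)) refl a) (sym q))
        (sub (a + a) (ℚ.≤-trans (ℚ.p⊓q≤p ε 1ℚ) (ℚ.≤-trans ε≤a
          (subst (_≤ a + a) (ℚ.+-identityʳ a)
            (ℚ.+-monoʳ-≤ a (ℚ.≤-trans (0≤pos ε {{ε>0}}) ε≤a))))))

  log-ratio : ∀ z w r k → 0ℚ ≤ r → r < 1ℚ → ∣ z ∣ ≤ r →
    ∣ z * (z * w) * (+ 2 ℚ./ suc (suc k ℕ.* 2)) ∣ ≤ r * ∣ w * (+ 2 ℚ./ suc (k ℕ.* 2)) ∣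
  log-ratio z w r k 0≤r r<1 z≤r = begin
    ∣ z * (z * w) * c′ ∣              ≡⟨ abs-coeff (z * (z * w)) (suc k ℕ.* 2) ⟩
    ∣ z * (z * w) ∣ * c′              ≡⟨ cong (_* c′) (ℚ.∣p*q∣≡∣p∣*∣q∣ z (z * w)) ⟩
    ∣ z ∣ * ∣ z * w ∣ * c′            ≡⟨ cong (λ u → ∣ z ∣ * u * c′) (ℚ.∣p*q∣≡∣p∣*∣q∣ z w) ⟩
    ∣ z ∣ * (∣ z ∣ * ∣ w ∣) * c′      ≡⟨ solve 3 (λ z w c → z :* (z :* w) :* c := z :* z :* (w :* c)) refl ∣ z ∣ ∣ w ∣ c′ ⟩
    ∣ z ∣ * ∣ z ∣ * (∣ w ∣ * c′)      ≤⟨ *-mono-≤ {∣ z ∣ * ∣ z ∣} {r} {∣ w ∣ * c′} {∣ w ∣ * c}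
                                           (0≤* (ℚ.0≤∣p∣ z) (ℚ.0≤∣p∣ z)) (0≤* (ℚ.0≤∣p∣ w) (/-nonNeg 2 (k ℕ.* 2)))
                                           zz≤ (ℚ.*-monoˡ-≤-nonNeg ∣ w ∣ {{ℚ.∣-∣-nonNeg w}} c′≤c) ⟩
    r * (∣ w ∣ * c)                   ≡⟨ cong (r *_) (abs-coeff w (k ℕ.* 2)) ⟨
    r * ∣ w * c ∣                     ∎
    where
    open ℚ.≤-Reasoning
    c c′ : ℚ
    c = + 2 ℚ./ suc (k ℕ.* 2)
    c′ = + 2 ℚ./ suc (suc k ℕ.* 2)
    c′≤c : c′ ≤ c
    c′≤c = /-mono 2 (suc k ℕ.* 2) 2 (k ℕ.* 2) (ℕ.*-monoʳ-≤ 2 (ℕ.s≤s (ℕ.m≤n+m (k ℕ.* 2) 2)))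
    zz≤ : ∣ z ∣ * ∣ z ∣ ≤ r
    zz≤ = subst (∣ z ∣ * ∣ z ∣ ≤_) (ℚ.*-identityʳ r)
      (*-mono-≤ {∣ z ∣} {r} {∣ z ∣} {1ℚ} (ℚ.0≤∣p∣ z) (/-nonNeg 1 0) z≤r (ℚ.≤-trans z≤r (ℚ.<⇒≤ r<1)))
    abs-coeff : ∀ p m → ∣ p * (+ 2 ℚ./ suc m) ∣ ≡ ∣ p ∣ * (+ 2 ℚ./ suc m)
    abs-coeff p m = trans (ℚ.∣p*q∣≡∣p∣*∣q∣ p (+ 2 ℚ./ suc m))
      (cong (∣ p ∣ *_) (ℚ.0≤p⇒∣p∣≡p (/-nonNeg 2 m)))

IsCauchy : (ℕ → ℚ) → Set
IsCauchy s = ∀ ε .{{_ : Positive ε}} →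
  ∃[ N ] ∀ m n → N ℕ.≤ m → N ℕ.≤ n → ℚ.∣ s m ℚ.- s n ∣ ℚ.≤ ε

-- Real numbers are Cauchy sequences of rationals, compared up to _≈_.
record ℝ : Set where
  constructor mkℝ
  field
    seq    : ℕ → ℚ
    cauchy : IsCauchy seq

open ℝ public

infix 4 _≈_ _≤_ _<_
infixr 4 _,_

_≈_ : ℝ → ℝ → Set
x ≈ y = ∀ ε .{{_ : Positive ε}} →
  ∃[ N ] ∀ n → N ℕ.≤ n → ℚ.∣ seq x n ℚ.- seq y n ∣ ℚ.≤ ε

_≤_ : ℝ → ℝ → Set
x ≤ y = ∀ ε .{{_ : Positive ε}} →
  ∃[ N ] ∀ n → N ℕ.≤ n → seq x n ℚ.≤ seq y n ℚ.+ ε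

_<_ : ℝ → ℝ → Set
x < y = Σ[ ε ∈ ℚ ] Positive ε ×
  (∃[ N ] ∀ n → N ℕ.≤ n → seq x n ℚ.+ ε ℚ.≤ seq y n)

bounded : ∀ x → Σ[ B ∈ ℚ ] Positive B × (∃[ N ] ∀ n → N ℕ.≤ n → ℚ.∣ seq x n ∣ ℚ.≤ B)
bounded x with cauchy x 1ℚ
... | N , h = ℚ.∣ seq x N ∣ ℚ.+ 1ℚ
            , ℚ.nonNeg+pos⇒pos ℚ.∣ seq x N ∣ {{ℚ.∣-∣-nonNeg (seq x N)}} 1ℚ
            , N , λ n N≤n → Q.bound⇒close (seq x n) (seq x N) (h n N N≤n ℕ.≤-refl)

half>0 : ∀ ε .{{_ : Positive ε}} → Positive (ε ℚ.* ½)
half>0 ε = ℚ.pos*pos⇒pos ε ½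

third>0 : ∀ ε .{{_ : Positive ε}} → Positive (ε ℚ.* Q.third)
third>0 ε = ℚ.pos*pos⇒pos ε Q.third

⊔-≤ˡ : ∀ {a b n} → a ℕ.⊔ b ℕ.≤ n → a ℕ.≤ n
⊔-≤ˡ {a} {b} = ℕ.m⊔n≤o⇒m≤o a b

⊔-≤ʳ : ∀ {a b n} → a ℕ.⊔ b ℕ.≤ n → b ℕ.≤ n
⊔-≤ʳ {a} {b} = ℕ.m⊔n≤o⇒n≤o a b

fromℚ : ℚ → ℝ
fromℚ q = mkℝ (λ _ → q) λ ε → 0 , λ _ _ _ _ →
  subst (ℚ._≤ ε) (sym (cong ℚ.∣_∣ (ℚ.+-inverseʳ q))) (Q.0≤pos ε)

fromℕ : ℕ → ℝ
fromℕ n = fromℚ (+ n ℚ./ 1)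

0ℝ 1ℝ : ℝ
0ℝ = fromℚ 0ℚ
1ℝ = fromℚ 1ℚ

infix  9 -_
infixl 6 _+_ _-_
infixl 7 _*_
infixr 8 _^_

_+_ : ℝ → ℝ → ℝ
x + y = mkℝ (λ n → seq x n ℚ.+ seq y n) c
  where
  open +-*-Solver
  lem : ∀ a b c → (a ℚ.+ b) ℚ.- (c ℚ.+ b) ≡ a ℚ.- c
  lem = solve 3 (λ a b c → (a :+ b) :- (c :+ b) := a :- c) refl
  lem′ : ∀ a b c → (a ℚ.+ b) ℚ.- (a ℚ.+ c) ≡ b ℚ.- c
  lem′ = solve 3 (λ a b c → (a :+ b) :- (a :+ c) := b :- c) refl
  c : IsCauchy (λ n → seq x n ℚ.+ seq y n)
  c ε with cauchy x (ε ℚ.* ½) {{half>0 ε}} | cauchy y (ε ℚ.* ½) {{half>0 ε}}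
  ... | M , h | N , k = M ℕ.⊔ N , λ m n p q →
    subst (ℚ.∣ (seq x m ℚ.+ seq y m) ℚ.- (seq x n ℚ.+ seq y n) ∣ ℚ.≤_) (Q.halves ε)
      (Q.triangle (seq x m ℚ.+ seq y m) (seq x n ℚ.+ seq y m) (seq x n ℚ.+ seq y n)
        (subst (λ z → ℚ.∣ z ∣ ℚ.≤ _) (sym (lem (seq x m) (seq y m) (seq x n))) (h m n (⊔-≤ˡ p) (⊔-≤ˡ q)))
        (subst (λ z → ℚ.∣ z ∣ ℚ.≤ _) (sym (lem′ (seq x n) (seq y m) (seq y n))) (k m n (⊔-≤ʳ {M} p) (⊔-≤ʳ {M} q))))

-_ : ℝ → ℝ
- x = mkℝ (λ n → ℚ.- seq x n) c
  where
  open +-*-Solver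
  lem : ∀ a b → (ℚ.- a) ℚ.- (ℚ.- b) ≡ b ℚ.- a
  lem = solve 2 (λ a b → (:- a) :- (:- b) := b :- a) refl
  c : IsCauchy (λ n → ℚ.- seq x n)
  c ε with cauchy x ε
  ... | N , h = N , λ m n p q →
    subst (λ z → ℚ.∣ z ∣ ℚ.≤ ε) (sym (lem (seq x m) (seq x n))) (h n m q p)

_-_ : ℝ → ℝ → ℝ
x - y = x + (- y)

_*_ : ℝ → ℝ → ℝ
x * y = mkℝ (λ n → seq x n ℚ.* seq y n) c
  where
  open +-*-Solver
  c : IsCauchy (λ n → seq x n ℚ.* seq y n)
  c ε = R , λ m n p q → Q.*-close (seq x m) (seq x n) (seq y m) (seq y n) A B δ ε
    (Q.0≤pos δ {{δ>0}})
    (h m (⊔-≤ˡ {M} (⊔-≤ˡ {M ℕ.⊔ N} p)))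
    (k n (⊔-≤ʳ {M} (⊔-≤ˡ {M ℕ.⊔ N} q)))
    (proj₂ cx m n (⊔-≤ˡ {proj₁ cx} (⊔-≤ʳ {M ℕ.⊔ N} p)) (⊔-≤ˡ {proj₁ cx} (⊔-≤ʳ {M ℕ.⊔ N} q)))
    (proj₂ cy m n (⊔-≤ʳ {proj₁ cx} (⊔-≤ʳ {M ℕ.⊔ N} p)) (⊔-≤ʳ {proj₁ cx} (⊔-≤ʳ {M ℕ.⊔ N} q)))
    total
    where
    A B : ℚ
    A = proj₁ (bounded x)
    B = proj₁ (bounded y)
    A>0 : Positive A
    A>0 = proj₁ (proj₂ (bounded x))
    B>0 : Positive B
    B>0 = proj₁ (proj₂ (bounded y))
    M N : ℕ
    M = proj₁ (proj₂ (proj₂ (bounded x)))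
    N = proj₁ (proj₂ (proj₂ (bounded y)))
    h = proj₂ (proj₂ (proj₂ (bounded x)))
    k = proj₂ (proj₂ (proj₂ (bounded y)))
    S>0 : Positive (A ℚ.+ B)
    S>0 = ℚ.pos+pos⇒pos A {{A>0}} B {{B>0}}
    i δ : ℚ
    i = Q.inv (A ℚ.+ B) S>0
    δ = ε ℚ.* i
    δ>0 : Positive δ
    δ>0 = ℚ.pos*pos⇒pos ε i {{Q.inv-pos (A ℚ.+ B) S>0}}
    cx = cauchy x δ {{δ>0}}
    cy = cauchy y δ {{δ>0}}
    R : ℕ
    R = (M ℕ.⊔ N) ℕ.⊔ (proj₁ cx ℕ.⊔ proj₁ cy)
    total : A ℚ.* δ ℚ.+ B ℚ.* δ ≡ ε
    total = trans
      (solve 4 (λ a b e i → a :* (e :* i) :+ b :* (e :* i) := e :* (i :* (a :+ b))) refl A B ε i)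
      (trans (cong (ε ℚ.*_) (Q.inv-*ˡ (A ℚ.+ B) S>0)) (ℚ.*-identityʳ ε))

∣_∣ : ℝ → ℝ
∣ x ∣ = mkℝ (λ n → ℚ.∣ seq x n ∣) c
  where
  c : IsCauchy (λ n → ℚ.∣ seq x n ∣)
  c ε with cauchy x ε
  ... | N , h = N , λ m n p q → ℚ.≤-trans (Q.reverse-triangle (seq x m) (seq x n)) (h m n p q)

_^_ : ℝ → ℕ → ℝ
x ^ zero  = 1ℝ
x ^ suc n = x * x ^ n

∑ : ℕ → (ℕ → ℝ) → ℝ
∑ zero    u = 0ℝ
∑ (suc n) u = ∑ n u + u n

RatioTest : (ℕ → ℝ) → Set
RatioTest u = Σ[ r ∈ ℚ ] (0ℚ ℚ.≤ r) × (r ℚ.< 1ℚ) ×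
  (∃[ K ] ∃[ N ] ∀ n k → N ℕ.≤ n → K ℕ.≤ k →
    ℚ.∣ seq (u (suc k)) n ∣ ℚ.≤ r ℚ.* ℚ.∣ seq (u k) n ∣)

-- The sum of the series Σ uₖ.  By the ratio test its partial sums converge
-- uniformly in the index of the approximating sequences, so the diagonal
-- sequence represents the limit.
series : (u : ℕ → ℝ) → RatioTest u → ℝ
series u (r , 0≤r , r<1 , K , N , ratio) = mkℝ (λ n → seq (∑ n u) n) c
  where
  s>0 : Positive (1ℚ ℚ.- r)
  s>0 = ℚ.positive (subst (ℚ._< 1ℚ ℚ.- r) (ℚ.+-inverseʳ r) (ℚ.+-monoˡ-< (ℚ.- r) r<1))
  C : ℚ
  C = proj₁ (bounded (u K))
  C>0 : Positive C
  C>0 = proj₁ (proj₂ (bounded (u K)))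
  M : ℕ
  M = proj₁ (proj₂ (proj₂ (bounded (u K))))
  b : ∀ n → M ℕ.≤ n → ℚ.∣ seq (u K) n ∣ ℚ.≤ C
  b = proj₂ (proj₂ (proj₂ (bounded (u K))))
  c : IsCauchy (λ n → seq (∑ n u) n)
  c ε = R , λ m n p q → Q.triangle₃
    (seq (∑ m u) m) (seq (∑ L u) m) (seq (∑ L u) n) (seq (∑ n u) n) ε
    (near m m (R≥M p) (R≥N p) (R≥L p))
    (proj₂ cL m n (R≥c p) (R≥c q))
    (near n n (R≥M q) (R≥N q) (R≥L q))
    where
    δ : ℚ
    δ = ε ℚ.* Q.third
    δ>0 : Positive δ
    δ>0 = third>0 ε
    j L R : ℕ
    j = proj₁ (Q.tail-index r C δ {{C>0}} {{δ>0}} 0≤r s>0)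
    L = j ℕ.+ K
    cL : ∃[ R ] ∀ m n → R ℕ.≤ m → R ℕ.≤ n → ℚ.∣ seq (∑ L u) m ℚ.- seq (∑ L u) n ∣ ℚ.≤ δ
    cL = cauchy (∑ L u) δ {{δ>0}}
    R = (M ℕ.⊔ N) ℕ.⊔ (L ℕ.⊔ proj₁ cL)
    R≥M : ∀ {n} → R ℕ.≤ n → M ℕ.≤ n
    R≥M p = ⊔-≤ˡ {M} {N} (⊔-≤ˡ {M ℕ.⊔ N} {L ℕ.⊔ proj₁ cL} p)
    R≥N : ∀ {n} → R ℕ.≤ n → N ℕ.≤ n
    R≥N p = ⊔-≤ʳ {M} {N} (⊔-≤ˡ {M ℕ.⊔ N} {L ℕ.⊔ proj₁ cL} p)
    R≥L : ∀ {n} → R ℕ.≤ n → L ℕ.≤ n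
    R≥L p = ⊔-≤ˡ {L} {proj₁ cL} (⊔-≤ʳ {M ℕ.⊔ N} {L ℕ.⊔ proj₁ cL} p)
    R≥c : ∀ {n} → R ℕ.≤ n → proj₁ cL ℕ.≤ n
    R≥c p = ⊔-≤ʳ {L} {proj₁ cL} (⊔-≤ʳ {M ℕ.⊔ N} {L ℕ.⊔ proj₁ cL} p)
    near : ∀ n m → M ℕ.≤ n → N ℕ.≤ n → L ℕ.≤ m →
           ℚ.∣ seq (∑ m u) n ℚ.- seq (∑ L u) n ∣ ℚ.≤ δ
    near n m M≤n N≤n L≤m =
      proj₂ (Q.tail-index r C δ {{C>0}} {{δ>0}} 0≤r s>0)
        (λ k → seq (u k) n) (λ k → seq (∑ k u) n) (λ _ → refl) K
        (λ k K≤k → ratio n k N≤n K≤k) (b n M≤n) m L≤m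

-- expTerm x k = xᵏ / k!
expTerm : ℝ → ℕ → ℝ
expTerm x zero    = 1ℝ
expTerm x (suc k) = expTerm x k * (x * fromℚ (+ 1 ℚ./ suc k))

expRatio : ∀ x → RatioTest (expTerm x)
expRatio x = ½ , ℚ.nonNegative⁻¹ ½ , ℚ.*<* (ℤ.+<+ (ℕ.s≤s (ℕ.s≤s ℕ.z≤n))) , K , N , λ n k N≤n K≤k →
  Q.exp-ratio (seq (expTerm x k) n) (seq x n) B K k (b n N≤n) 2B≤K K≤k
  where
  B : ℚ
  B = proj₁ (bounded x)
  N : ℕ
  N = proj₁ (proj₂ (proj₂ (bounded x)))
  b : ∀ n → N ℕ.≤ n → ℚ.∣ seq x n ∣ ℚ.≤ B
  b = proj₂ (proj₂ (proj₂ (bounded x)))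
  K : ℕ
  K = proj₁ (Q.≤-ceil (B ℚ.+ B))
  2B≤K : B ℚ.+ B ℚ.≤ + K ℚ./ 1
  2B≤K = proj₂ (Q.≤-ceil (B ℚ.+ B))

exp : ℝ → ℝ
exp x = series (expTerm x) (expRatio x)


record ℝ⁺ : Set where
  constructor _,_
  field
    real     : ℝ
    positive : 0ℝ < real

open ℝ⁺ public

0<⇒≤ : ∀ {ε q} → 0ℚ ℚ.+ ε ℚ.≤ q → ε ℚ.≤ q
0<⇒≤ {ε} {q} = subst (ℚ._≤ q) (ℚ.+-identityˡ ε)

≤⇒0< : ∀ {ε q} → ε ℚ.≤ q → 0ℚ ℚ.+ ε ℚ.≤ q
≤⇒0< {ε} {q} = subst (ℚ._≤ q) (sym (ℚ.+-identityˡ ε))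

infixl 6 _+⁺_
infixl 7 _*⁺_
infixr 8 _^⁺_

1⁺ : ℝ⁺
1⁺ = 1ℝ , (1ℚ , _ , 0 , λ _ _ → ≤⇒0< ℚ.≤-refl)

_+⁺_ : ℝ⁺ → ℝ⁺ → ℝ⁺
(x , (ε , ε>0 , M , h)) +⁺ (y , (δ , δ>0 , N , k)) =
  x + y , (ε ℚ.+ δ , ℚ.pos+pos⇒pos ε {{ε>0}} δ {{δ>0}} , M ℕ.⊔ N ,
    λ n p → ≤⇒0< {ε ℚ.+ δ} (ℚ.+-mono-≤ {ε} {seq x n} {δ} {seq y n}
      (0<⇒≤ {ε} (h n (⊔-≤ˡ {M} {N} p))) (0<⇒≤ {δ} (k n (⊔-≤ʳ {M} {N} p)))))

_*⁺_ : ℝ⁺ → ℝ⁺ → ℝ⁺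
(x , (ε , ε>0 , M , h)) *⁺ (y , (δ , δ>0 , N , k)) =
  x * y , (ε ℚ.* δ , ℚ.pos*pos⇒pos ε {{ε>0}} δ {{δ>0}} , M ℕ.⊔ N ,
    λ n p → let ε≤x = 0<⇒≤ {ε} (h n (⊔-≤ˡ {M} {N} p)); δ≤y = 0<⇒≤ {δ} (k n (⊔-≤ʳ {M} {N} p)) in
      ≤⇒0< {ε ℚ.* δ} (Q.*-mono-≤ {ε} {seq x n} {δ} {seq y n}
        (Q.0≤pos ε {{ε>0}}) (ℚ.≤-trans (Q.0≤pos δ {{δ>0}}) δ≤y) ε≤x δ≤y))

_^⁺_ : ℝ⁺ → ℕ → ℝ⁺
x ^⁺ zero  = 1⁺
x ^⁺ suc n = x *⁺ x ^⁺ n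

clamp>0 : ∀ ε → Positive ε → ∀ q → Positive (q ℚ.⊔ ε)
clamp>0 ε ε>0 q = Q.pos-≤ {{ε>0}} (ℚ.p≤q⊔p q ε)

infix 10 _⁻¹

-- The terms are clamped from below by the witness ε of positivity, so that
-- each of them can be inverted; eventually the clamp has no effect.
_⁻¹ : ℝ⁺ → ℝ⁺
(x , (ε , ε>0 , N , h)) ⁻¹ = mkℝ i c , p
  where
  y i : ℕ → ℚ
  y n = seq x n ℚ.⊔ ε
  i n = Q.inv (y n) (clamp>0 ε ε>0 (seq x n))
  y≡ : ∀ n → N ℕ.≤ n → y n ≡ seq x n
  y≡ n N≤n = ℚ.p≥q⇒p⊔q≡p (0<⇒≤ (h n N≤n))
  k k² : ℚ
  k = Q.inv ε ε>0
  k² = k ℚ.* k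
  k²>0 : Positive k²
  k²>0 = ℚ.pos*pos⇒pos k {{Q.inv-pos ε ε>0}} k {{Q.inv-pos ε ε>0}}
  c : IsCauchy i
  c η = M ℕ.⊔ N , λ m n p q → begin
    ℚ.∣ i m ℚ.- i n ∣            ≤⟨ Q.inv-dist ε (y m) (y n) ε>0 (clamp>0 ε ε>0 (seq x m)) (clamp>0 ε ε>0 (seq x n))
                                      (ℚ.p≤q⊔p (seq x m) ε) (ℚ.p≤q⊔p (seq x n) ε) ⟩
    ℚ.∣ y m ℚ.- y n ∣ ℚ.* k²     ≡⟨ cong₂ (λ a b → ℚ.∣ a ℚ.- b ∣ ℚ.* k²)
                                      (y≡ m (⊔-≤ʳ {M} {N} p)) (y≡ n (⊔-≤ʳ {M} {N} q)) ⟩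
    ℚ.∣ seq x m ℚ.- seq x n ∣ ℚ.* k²  ≤⟨ ℚ.*-monoʳ-≤-nonNeg k² {{ℚ.pos⇒nonNeg k² {{k²>0}}}}
                                      (proj₂ cx m n (⊔-≤ˡ {M} {N} p) (⊔-≤ˡ {M} {N} q)) ⟩
    δ ℚ.* k²                     ≡⟨ ℚ.*-assoc η (Q.inv k² k²>0) k² ⟩
    η ℚ.* (Q.inv k² k²>0 ℚ.* k²) ≡⟨ cong (η ℚ.*_) (Q.inv-*ˡ k² k²>0) ⟩
    η ℚ.* 1ℚ                     ≡⟨ ℚ.*-identityʳ η ⟩
    η                            ∎
    where
    open ℚ.≤-Reasoning
    δ : ℚ
    δ = η ℚ.* Q.inv k² k²>0
    cx : ∃[ R ] ∀ m n → R ℕ.≤ m → R ℕ.≤ n → ℚ.∣ seq x m ℚ.- seq x n ∣ ℚ.≤ δ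
    cx = cauchy x δ {{ℚ.pos*pos⇒pos η (Q.inv k² k²>0) {{Q.inv-pos k² k²>0}}}}
    M : ℕ
    M = proj₁ cx
  B : ℚ
  B = proj₁ (bounded x)
  p : 0ℝ < mkℝ i c
  p = Q.inv (B ℚ.⊔ ε) (clamp>0 ε ε>0 B) , Q.inv-pos (B ℚ.⊔ ε) (clamp>0 ε ε>0 B) ,
    proj₁ (proj₂ (proj₂ (bounded x))) , λ n M≤n →
      ≤⇒0< (Q.inv-anti (y n) (B ℚ.⊔ ε) (clamp>0 ε ε>0 (seq x n)) (clamp>0 ε ε>0 B)
        (ℚ.⊔-monoˡ-≤ ε (ℚ.≤-trans (Q.p≤∣p∣ (seq x n)) (proj₂ (proj₂ (proj₂ (bounded x))) n M≤n))))

⁻¹-inverse : ∀ x → ∃[ N ] ∀ n → N ℕ.≤ n →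
             (0ℚ ℚ.≤ seq (real (x ⁻¹)) n) × (seq (real x) n ℚ.* seq (real (x ⁻¹)) n ≡ 1ℚ)
⁻¹-inverse (x , (ε , ε>0 , N , h)) = N , λ n N≤n →
  let y>0 = clamp>0 ε ε>0 (seq x n); j = Q.inv (seq x n ℚ.⊔ ε) y>0 in
  Q.0≤pos j {{Q.inv-pos (seq x n ℚ.⊔ ε) y>0}} ,
  trans (ℚ.*-comm (seq x n) j)
    (trans (cong (j ℚ.*_) (sym (ℚ.p≥q⇒p⊔q≡p (0<⇒≤ (h n N≤n))))) (Q.inv-*ˡ (seq x n ℚ.⊔ ε) y>0))

-- logTerm t k = 2 z^(2k+1) / (2k+1) with z = mobius t = (t - 1) / (t + 1)
mobius : ℝ⁺ → ℝ
mobius t = (real t - 1ℝ) * real ((t +⁺ 1⁺) ⁻¹)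

logTerm : ℝ⁺ → ℕ → ℝ
logTerm t k = mobius t ^ suc (k ℕ.* 2) * fromℚ (+ 2 ℚ./ suc (k ℕ.* 2))

mobius-bound : ∀ t → Σ[ r ∈ ℚ ] (0ℚ ℚ.≤ r) × (r ℚ.< 1ℚ) ×
               (∃[ N ] ∀ n → N ℕ.≤ n → ℚ.∣ seq (mobius t) n ∣ ℚ.≤ r)
mobius-bound t@(x , (ε , ε>0 , M , h)) =
  r , ℚ.≤-trans (ℚ.0≤∣p∣ (seq (mobius t) R)) (bd R ℕ.≤-refl) , proj₁ (proj₂ bound) , R , bd
  where
  B : ℚ
  B = proj₁ (bounded x)
  B>0 : Positive B
  B>0 = proj₁ (proj₂ (bounded x))
  N N′ R : ℕ
  N = proj₁ (proj₂ (proj₂ (bounded x)))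
  N′ = proj₁ (⁻¹-inverse (t +⁺ 1⁺))
  R = (M ℕ.⊔ N) ℕ.⊔ N′
  b : ∀ n → N ℕ.≤ n → ℚ.∣ seq x n ∣ ℚ.≤ B
  b = proj₂ (proj₂ (proj₂ (bounded x)))
  bound = Q.mobius-bound ε B ε>0 B>0
  r : ℚ
  r = proj₁ bound
  bd : ∀ n → R ℕ.≤ n → ℚ.∣ seq (mobius t) n ∣ ℚ.≤ r
  bd n p = proj₂ (proj₂ bound) (seq x n) (seq (real ((t +⁺ 1⁺) ⁻¹)) n)
    (0<⇒≤ (h n (⊔-≤ˡ {M} {N} (⊔-≤ˡ {M ℕ.⊔ N} {N′} p))))
    (ℚ.≤-trans (Q.p≤∣p∣ (seq x n)) (b n (⊔-≤ʳ {M} {N} (⊔-≤ˡ {M ℕ.⊔ N} {N′} p))))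
    (proj₁ (proj₂ (⁻¹-inverse (t +⁺ 1⁺)) n (⊔-≤ʳ {M ℕ.⊔ N} {N′} p)))
    (proj₂ (proj₂ (⁻¹-inverse (t +⁺ 1⁺)) n (⊔-≤ʳ {M ℕ.⊔ N} {N′} p)))

logRatio : ∀ t → RatioTest (logTerm t)
logRatio t = let r , 0≤r , r<1 , N , b = mobius-bound t in
  r , 0≤r , r<1 , 0 , N , λ n k N≤n _ →
    Q.log-ratio (seq (mobius t) n) (seq (mobius t ^ suc (k ℕ.* 2)) n) r k 0≤r r<1 (b n N≤n)

-- The series log t = 2 artanh ((t - 1) / (t + 1)) converges for every t > 0.
log : ℝ⁺ → ℝ
log t = series (logTerm t) (logRatio t)

infixr 8 _^ʳ_

_^ʳ_ : ℝ⁺ → ℝ → ℝ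
t ^ʳ y = exp (y * log t)

-- A partition a = t₀ ≤ t₁ ≤ … ≤ t_N = b with tags tₖ ≤ sₖ ≤ tₖ₊₁; the values
-- of t beyond N and of s from N on are irrelevant.
record TaggedPartition (a b : ℝ⁺) : Set where
  field
    size   : ℕ
    point  : ℕ → ℝ⁺
    tag    : ℕ → ℝ⁺
    first  : real (point 0) ≈ real a
    last   : real (point size) ≈ real b
    lower  : ∀ k → k ℕ.< size → real (point k) ≤ real (tag k)
    upper  : ∀ k → k ℕ.< size → real (tag k) ≤ real (point (suc k))

  width : ℕ → ℝ
  width k = real (point (suc k)) - real (point k)

open TaggedPartition public

MeshBelow : ∀ {a b} → ℝ⁺ → TaggedPartition a b → Set
MeshBelow δ P = ∀ k → k ℕ.< size P → width P k < real δ

riemannSum : ∀ {a b} → (ℝ⁺ → ℝ) → TaggedPartition a b → ℝ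
riemannSum f P = ∑ (size P) (λ k → f (tag P k) * width P k)

-- I = ∫ₐᵇ f(t) dt, for [a, b] inside the half-line (0, ∞).
IsIntegral : (ℝ⁺ → ℝ) → ℝ⁺ → ℝ⁺ → ℝ → Set
IsIntegral f a b I = (ε : ℝ⁺) → Σ[ δ ∈ ℝ⁺ ] ((P : TaggedPartition a b) →
  MeshBelow δ P → ∣ riemannSum f P - I ∣ < real ε)

-- I = ∫₀^∞ f(t) dt, improper at both ends.
IsImproperIntegral : (ℝ⁺ → ℝ) → ℝ → Set
IsImproperIntegral f I = (ε : ℝ⁺) → Σ[ δ ∈ ℝ⁺ ] Σ[ M ∈ ℝ⁺ ] ((a b : ℝ⁺) →
  real a < real δ → real M < real b → real a < real b →
  Σ[ J ∈ ℝ ] IsIntegral f a b J × ∣ J - I ∣ < real ε)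

-- A function on (0, ∞) is the gamma function when it is given by Euler's
-- integral Γ(x) = ∫₀^∞ t^(x-1) e^(-t) dt; this determines it up to _≈_.
IsGammaFunction : (ℝ⁺ → ℝ) → Set
IsGammaFunction Γ = ∀ x →
  IsImproperIntegral (λ t → t ^ʳ (real x - 1ℝ) * exp (- real t)) (Γ x)

-- β takes Γ with values in (0, ∞), so that the division makes sense.
β : (ℝ⁺ → ℝ⁺) → ℝ⁺ → ℝ⁺ → ℝ⁺
β Γ x y = Γ x *⁺ Γ y *⁺ Γ (x +⁺ y) ⁻¹

Matrix : ℕ → ℕ → Set
Matrix m n = Fin m → Fin n → ℝ

det : ∀ {n} → Matrix n n → ℝ
det {zero}  A = 1ℝ
det {suc n} A = Vector.foldr _+_ 0ℝ λ j →
  (- 1ℝ) ^ toℕ j * (A Fin.zero j * det (λ i k → A (Fin.suc i) (punchIn j k)))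

-- Minors are indexed by increasing selections of at least one row and column.
TotallyPositive : ∀ {m n} → Matrix m n → Set
TotallyPositive {m} {n} A = ∀ k (r : Fin (suc k) → Fin m) (c : Fin (suc k) → Fin n) →
  (∀ {i j} → i Fin.< j → r i Fin.< r j) → (∀ {i j} → i Fin.< j → c i Fin.< c j) →
  0ℝ < det (λ i j → A (r i) (c j))

{-# OPTIONS --safe #-}

-- Since μⱼ = μ₁ + dⱼ with integers 0 = d₁ < d₂ < …, the functional equation
-- Γ(x + 1) = x Γ(x) turns Γ(λᵢ + μⱼ) into Γ(xᵢ) times the rising factorial
-- xᵢ (xᵢ + 1) ⋯ (xᵢ + dⱼ - 1) with xᵢ = λᵢ + μ₁.  Up to positive factors of the
-- rows and columns, both matrices become [P_{m dⱼ}(xᵢ)] for products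
-- P_d(x) = (x + c₀) ⋯ (x + c_{d-1}) of shifts c_l ≥ 0.  A determinant of this
-- kind is positive by induction on its size: column operations clear the first
-- row, and what remains is a positive combination of smaller determinants of
-- the same kind.
--
-- What is needed about Γ is its positivity and its functional equation.  After
-- the substitution t = exp s the Riemann sums of Euler's integral run over
-- uniform grids in s, and integration by parts is a telescoping sum with a
-- second-order error.  The addition theorem for exp and log (exp s) = s follow
-- from second-order estimates of the power series, because a function whose
-- increments are quadratically small is constant.
module Submission where

import Algebra.Solver.Ring
import Data.Fin.Properties as Fin
import Data.Nat.Properties as ℕ
import Data.Rational.Properties as ℚ
import Data.Rational.Unnormalised.Properties as ℚᵘ
import Data.Vec.Functional as Vector
import Defs as D
import Relation.Binary.Reasoning.PartialOrder
open import Algebra.Bundles using (CommutativeRing; RawRing)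
open import Algebra.Solver.Ring.AlmostCommutativeRing using (AlmostCommutativeRing; fromCommutativeRing; _-Raw-AlmostCommutative⟶_)
open import Data.Empty using (⊥-elim)
open import Data.Fin.Base as Fin using (Fin; toℕ; punchIn; punchOut; inject₁)
open import Data.Integer.Base as ℤ using (+_)
open import Data.Maybe.Base using (Maybe; just; nothing)
open import Data.Nat.Base as ℕ using (ℕ; zero; suc; NonZero)
open import Data.Nat.DivMod using (_/_; m<n⇒m/n≡0; m*n/n≡m; +-distrib-/-∣ʳ)
open import Data.Nat.Divisibility using (n∣m*n)
open import Data.Product using (_×_; _,_; proj₁; proj₂; Σ-syntax; ∃-syntax)
open import Data.Rational.Base as ℚ using (ℚ; 0ℚ; 1ℚ; ½; Positive)
open import Data.Rational.Solver using (module +-*-Solver)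
open import Data.Rational.Unnormalised.Base as ℚᵘ using ()
open import Data.Sum.Base using (_⊎_; inj₁; inj₂)
open import Defs using (module Q; ℝ; seq; cauchy; bounded; half>0; ⊔-≤ˡ; ⊔-≤ʳ; ℝ⁺; real)
open import Function.Base using (_∘_)
open import Relation.Binary.Bundles using (Poset)
open import Relation.Binary.PropositionalEquality
  using (_≡_; _≢_; refl; sym; trans; cong; cong₂; subst; subst₂)
open import Relation.Nullary using (yes; no)

-- The induction needs a class wider than powers of rising factorials. Clearing the first row and
-- dividing by x - x₀ yields all intermediate degrees, including those that are not multiples of m,
-- so m-th powers of rising factorials are not preserved; the partial products of one fixed sequence
-- of shifts c_l = floor(l / m) are. The reciprocal beta matrix needs no second argument: 1/β(λ,
-- μ)^m is Γ(λ + μ)^m times a factor depending on λ and one depending on μ.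
--
-- Comparison of Cauchy reals is undecidable. A positivity proof must therefore produce a rational
-- lower bound, and every use of a derivative becomes an estimate whose error is a constant times
-- the square of the increment, uniformly on a bounded set.
--
-- Convergence of Euler's integral is part of the hypothesis on Γ, so the integral may be evaluated
-- along any convenient partitions. Points in geometric progression make each cell proportional to
-- its left end t, which absorbs the missing factor t of t^(x-1) and leaves sums of t^x e^(-t) with
-- a constant mesh.

module Development where

  -- Rational estimates

  module ℚLemmas where
    open import Data.Rational.Base using (_+_; _*_; _-_; -_; ∣_∣; _≤_)
    open +-*-Solver

    ∣∣-≤ : ∀ {p q} → p ≤ q → - p ≤ q → ∣ p ∣ ≤ q
    ∣∣-≤ {p} {q} h k with ℚ.∣p∣≡p∨∣p∣≡-p p
    ... | inj₁ e = subst (_≤ q) (sym e) h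
    ... | inj₂ e = subst (_≤ q) (sym e) k

    -p≤∣p∣ : ∀ p → - p ≤ ∣ p ∣
    -p≤∣p∣ p = subst (- p ≤_) (ℚ.∣-p∣≡∣p∣ p) (Q.p≤∣p∣ (- p))

    -- An inequality is certified by a visibly nonnegative difference `c`; the remaining equation is
    -- left to the ring solver. The version for reals below serves the same purpose.
    ≤-cert : ∀ {p q} c → 0ℚ ≤ c → q ≡ p + c → p ≤ q
    ≤-cert {p} c h refl = subst (_≤ p + c) (ℚ.+-identityʳ p) (ℚ.+-monoʳ-≤ p h)

    0≤- : ∀ {p q} → p ≤ q → 0ℚ ≤ q - p
    0≤- {p} {q} h = subst (_≤ q - p) (ℚ.+-inverseʳ p) (ℚ.+-monoˡ-≤ (- p) h)

    0≤+ : ∀ {p q} → 0ℚ ≤ p → 0ℚ ≤ q → 0ℚ ≤ p + q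
    0≤+ h k = ℚ.+-mono-≤ h k

    ∣-∣-≤ : ∀ {p q ε} → p ≤ q + ε → q ≤ p + ε → ∣ p - q ∣ ≤ ε
    ∣-∣-≤ {p} {q} {ε} h k = ∣∣-≤
      (≤-cert ((q + ε) - p) (0≤- h) (solve 3 (λ p q e → e := (p :- q) :+ ((q :+ e) :- p))
        refl p q ε))
      (≤-cert ((p + ε) - q) (0≤- k) (solve 3 (λ p q e → e := :- (p :- q) :+ ((p :+ e) :- q))
        refl p q ε))

    ∣-∣-≤⁻ : ∀ {p q ε} → ∣ p - q ∣ ≤ ε → p ≤ q + ε
    ∣-∣-≤⁻ {p} {q} {ε} h = ≤-cert (ε - (p - q)) (0≤- (ℚ.≤-trans (Q.p≤∣p∣ (p - q)) h))
      (solve 3 (λ p q e → q :+ e := p :+ (e :- (p :- q))) refl p q ε)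

    0≤p*p : ∀ p → 0ℚ ≤ p * p
    0≤p*p p with ℚ.≤-total 0ℚ p
    ... | inj₁ h = Q.0≤* h h
    ... | inj₂ h = subst (0ℚ ≤_) (solve 1 (λ p → (:- p) :* (:- p) := p :* p) refl p)
      (Q.0≤* (ℚ.neg-antimono-≤ h) (ℚ.neg-antimono-≤ h))

    half-gap : ∀ p q ε → p + ε ≤ q + ε * ½ → p + ε * ½ ≤ q
    half-gap p q ε h = ≤-cert _ (0≤- h)
      (solve 3 (λ p q e → q := (p :+ e :* con ½) :+ ((q :+ e :* con ½) :- (p :+ e))) refl p q ε)

    add-halves : ∀ p q ε → p ≤ q + ε * ½ + ε * ½ → p ≤ q + ε
    add-halves p q ε = subst (p ≤_) (trans (ℚ.+-assoc q (ε * ½) (ε * ½))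
      (cong (λ z → q + z) (Q.halves ε)))

    cancel-half : ∀ p ε → ε ≤ p + ε * ½ → ε * ½ ≤ p
    cancel-half p ε h = ≤-cert _ (0≤- h)
      (solve 2 (λ p e → p := e :* con ½ :+ ((p :+ e :* con ½) :- e)) refl p ε)

    ⊔-lub-< : ∀ {p q r} → p ℚ.< r → q ℚ.< r → p ℚ.⊔ q ℚ.< r
    ⊔-lub-< {p} {q} {r} h k with ℚ.⊔-sel p q
    ... | inj₁ e = subst (ℚ._< r) (sym e) h
    ... | inj₂ e = subst (ℚ._< r) (sym e) k

  open ℚLemmas public using (∣∣-≤; -p≤∣p∣; ∣-∣-≤; ∣-∣-≤⁻)

  -- Second-order estimates for the partial sums of the exponential series

  module ExpSeries where
    open import Data.Rational.Base using (_+_; _*_; _-_; -_; ∣_∣; _≤_)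
    open +-*-Solver
    open ℚLemmas

    ∣∣-+ : ∀ {p q a b} → ∣ p ∣ ≤ a → ∣ q ∣ ≤ b → ∣ p + q ∣ ≤ a + b
    ∣∣-+ {p} {q} h k = ℚ.≤-trans (ℚ.∣p+q∣≤∣p∣+∣q∣ p q) (ℚ.+-mono-≤ h k)

    ∣∣-* : ∀ {p q a b} → ∣ p ∣ ≤ a → ∣ q ∣ ≤ b → ∣ p * q ∣ ≤ a * b
    ∣∣-* {p} {q} {a} {b} h k = subst (_≤ a * b) (sym (ℚ.∣p*q∣≡∣p∣*∣q∣ p q))
      (Q.*-mono-≤ (ℚ.0≤∣p∣ p) (ℚ.≤-trans (ℚ.0≤∣p∣ q) k) h k)

    ∣∣-nonNeg : ∀ {p} → 0ℚ ≤ p → ∣ p ∣ ≤ p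
    ∣∣-nonNeg h = ℚ.≤-reflexive (ℚ.0≤p⇒∣p∣≡p h)

    square : ℚ → ℚ
    square p = p * p

    recip : ℕ → ℚ
    recip k = + 1 ℚ./ suc k

    cancel : ∀ k p → recip k * ((1ℚ + (+ k ℚ./ 1)) * p) ≡ p
    cancel k p = trans (sym (ℚ.*-assoc (recip k) _ p))
      (trans (cong (_* p) (trans (cong (λ z → recip k * z) (sym (Q.fromℕ-suc k)))
        (Q./-*-cancel k))) (ℚ.*-identityˡ p))

    -- T k p = pᵏ / k! and E n p = Σ_{k<n} pᵏ / k!
    T E : ℕ → ℚ → ℚ
    T zero    p = 1ℚ
    T (suc k) p = T k p * (p * recip k)

    E zero    p = 0ℚ
    E (suc n) p = E n p + T n p

    T-abs : ∀ {z r} k → ∣ z ∣ ≤ r → ∣ T k z ∣ ≤ T k r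
    T-abs zero    h = ℚ.≤-refl
    T-abs (suc k) h = ∣∣-* (T-abs k h) (∣∣-* h (∣∣-nonNeg (Q./-nonNeg 1 k)))

    0≤T : ∀ {r} k → 0ℚ ≤ r → 0ℚ ≤ T k r
    0≤T zero    h = Q./-nonNeg 1 0
    0≤T (suc k) h = Q.0≤* (0≤T k h) (Q.0≤* h (Q./-nonNeg 1 k))

    E-abs : ∀ {z r} n → ∣ z ∣ ≤ r → ∣ E n z ∣ ≤ E n r
    E-abs zero    h = ℚ.≤-refl
    E-abs (suc n) h = ∣∣-+ (E-abs n h) (T-abs n h)

    E-step : ∀ {r} n → 0ℚ ≤ r → E n r ≤ E (suc n) r
    E-step n h = ≤-cert _ (0≤T n h) refl

    T-suc : ∀ k r → r * T k r ≡ (1ℚ + (+ k ℚ./ 1)) * T (suc k) r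
    T-suc k r = trans (sym (cancel k (r * T k r)))
      (solve 4 (λ c n r t → c :* (n :* (r :* t)) := n :* (t :* (r :* c))) refl (recip k)
        (1ℚ + (+ k ℚ./ 1)) r (T k r))

    -- The derivative of `T (suc k)` is `T k`, so this is its Taylor remainder of second order.
    T-rest : ℕ → ℚ → ℚ → ℚ
    T-rest k w z = (T (suc k) w - T (suc k) z) - (w - z) * T k z

    T-rest-suc : ∀ k w z → T-rest (suc k) w z ≡
      recip (suc k) * (w * T-rest k w z + square (w - z) * T k z)
    T-rest-suc k w z = trans
      (cong (λ x → (a * (w * c) - b * (z * c)) - (w - z) * x) b≡)
      (solve 6 (λ w z a b t c → (a :* (w :* c) :- b :* (z :* c)) :- (w :- z) :*
        (c :* (b :+ z :* t)) :=
        c :* (w :* ((a :- b) :- (w :- z) :* t) :+ (w :- z) :* (w :- z) :* t)) refl w z a b t c)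
      where
      a b t c J : ℚ
      a = T (suc k) w
      b = T (suc k) z
      t = T k z
      c = recip (suc k)
      J = + k ℚ./ 1
      -- Of the k + 2 copies of `b`, one is kept and the other k + 1 become `z * t` by `T-suc`; this
      -- puts all terms over the common denominator k + 2.
      b≡ : b ≡ c * (b + z * t)
      b≡ = trans (sym (cancel (suc k) b)) (cong (c *_) (trans
        (cong (λ x → (1ℚ + x) * b) (Q.fromℕ-suc k))
        (trans (solve 2 (λ J b → (con 1ℚ :+ (con 1ℚ :+ J)) :* b := b :+ (con 1ℚ :+ J) :* b)
          refl J b)
          (cong (λ x → b + x) (sym (T-suc k z))))))

    -- The second derivative of `T (2 + k)` is `T k`; the factor 1/2 of Taylor's bound is given
    -- away. Inserting the induction hypothesis in `T-rest-suc` yields the factor (k + 2)/(k + 3),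
    -- which is at most 1.
    T-rest-bound : ∀ {r} k w z → 0ℚ ≤ r → ∣ w ∣ ≤ r → ∣ z ∣ ≤ r →
      ∣ T-rest (suc k) w z ∣ ≤ square (w - z) * T k r
    T-rest-bound zero w z 0≤r h g = subst (_≤ square (w - z) * 1ℚ)
      (sym (trans (cong ∣_∣ (solve 2 (λ w z →
        (con 1ℚ :* (w :* con 1ℚ) :* (w :* con ½) :- con 1ℚ :* (z :* con 1ℚ) :* (z :* con ½)) :-
        (w :- z) :* (con 1ℚ :* (z :* con 1ℚ)) := (w :- z) :* (w :- z) :* con ½) refl w z))
        (ℚ.0≤p⇒∣p∣≡p (Q.0≤* (0≤p*p (w - z)) (ℚ.nonNegative⁻¹ ½)))))
      (ℚ.*-monoˡ-≤-nonNeg (square (w - z)) {{ℚ.nonNegative (0≤p*p (w - z))}}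
        (ℚ.*≤* (ℤ.+≤+ (ℕ.s≤s ℕ.z≤n))))
    T-rest-bound {r} (suc k) w z 0≤r h g = begin
      ∣ T-rest (suc (suc k)) w z ∣                       ≡⟨ cong ∣_∣ (T-rest-suc (suc k) w z) ⟩
      ∣ c * (w * T-rest (suc k) w z + d * T (suc k) z) ∣
        ≤⟨ ∣∣-* (∣∣-nonNeg 0≤c) (∣∣-+ (∣∣-* h (T-rest-bound k w z 0≤r h g))
                                                            (∣∣-* (∣∣-nonNeg (0≤p*p (w - z)))
                                                              (T-abs (suc k) g))) ⟩
      c * (r * (d * T k r) + d * t)
        ≡⟨ cong (λ x → c * (x + d * t))
        (trans (solve 3 (λ r d t → r :* (d :* t) := d :* (r :* t)) refl r d (T k r))
        (cong (d *_) (T-suc k r))) ⟩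
      c * (d * ((1ℚ + J) * t) + d * t)
        ≤⟨ ≤-cert (c * (d * t)) (Q.0≤* 0≤c (Q.0≤* (0≤p*p (w - z)) (0≤T (suc k) 0≤r)))
                                                            (solve 4 (λ c J d t → c :* ((con
                                                              1ℚ :+ (con 1ℚ :+ (con 1ℚ :+ J))) :*
                                                              (d :* t)) := c :* (d :* ((con
                                                              1ℚ :+ J) :* t) :+ d :* t) :+ c :*
                                                              (d :* t)) refl c J d t) ⟩
      c * ((1ℚ + (1ℚ + (1ℚ + J))) * (d * t))             ≡⟨ cong (λ x → c * ((1ℚ + x) * (d * t)))
        (sym (trans (Q.fromℕ-suc (suc k)) (cong (λ x → 1ℚ + x) (Q.fromℕ-suc k)))) ⟩
      c * ((1ℚ + (+ suc (suc k) ℚ./ 1)) * (d * t))       ≡⟨ cancel (suc (suc k)) (d * t) ⟩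
      d * t                                              ∎
      where
      open ℚ.≤-Reasoning
      c d t J : ℚ
      c = recip (suc (suc k))
      d = square (w - z)
      t = T (suc k) r
      J = + k ℚ./ 1
      0≤c : 0ℚ ≤ c
      0≤c = Q./-nonNeg 1 (suc (suc k))

    E-rest : ∀ {r} n w z → 0ℚ ≤ r → ∣ w ∣ ≤ r → ∣ z ∣ ≤ r →
      ∣ (E (2 ℕ.+ n) w - E (2 ℕ.+ n) z) - (w - z) * E (1 ℕ.+ n) z ∣ ≤ square (w - z) * E n r
    E-rest {r} zero w z 0≤r h g = ℚ.≤-reflexive (trans
      (cong ∣_∣ (solve 2 (λ w z → (((con 0ℚ :+ con 1ℚ) :+ con 1ℚ :* (w :* con 1ℚ)) :-
        ((con 0ℚ :+ con 1ℚ) :+ con 1ℚ :* (z :* con 1ℚ))) :- (w :- z) :* (con 0ℚ :+ con 1ℚ) :=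
        con 0ℚ) refl w z))
      (sym (ℚ.*-zeroʳ (square (w - z)))))
    E-rest {r} (suc n) w z 0≤r h g = subst₂ _≤_
      (cong ∣_∣ (solve 8 (λ Ew Ez E′z Tw Tz T′z w z →
        ((Ew :- Ez) :- (w :- z) :* E′z) :+ ((Tw :- Tz) :- (w :- z) :* T′z) :=
        ((Ew :+ Tw) :- (Ez :+ Tz)) :- (w :- z) :* (E′z :+ T′z)) refl
        (E (2 ℕ.+ n) w) (E (2 ℕ.+ n) z) (E (1 ℕ.+ n) z) (T (2 ℕ.+ n) w) (T (2 ℕ.+ n) z)
          (T (1 ℕ.+ n) z) w z))
      (sym (ℚ.*-distribˡ-+ (square (w - z)) (E n r) (T n r)))
      (∣∣-+ (E-rest n w z 0≤r h g) (T-rest-bound n w z 0≤r h g))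

    -- The true derivative of `E (2 + n)` is `E (1 + n)`. Writing `E (2 + n)` instead makes all
    -- terms those of `exp` at one index; the price is the last summand of `E (2 + n) z`, bounded by
    -- the difference of two consecutive partial sums at `r`.
    E-estimate : ∀ {r} n w z → 0ℚ ≤ r → ∣ w ∣ ≤ r → ∣ z ∣ ≤ r →
      ∣ (E (2 ℕ.+ n) w - E (2 ℕ.+ n) z) - (w - z) * E (2 ℕ.+ n) z ∣ ≤
      E (2 ℕ.+ n) r * square (w - z) + (r + r) * ∣ E (2 ℕ.+ n) r - E (1 ℕ.+ n) r ∣
    E-estimate {r} n w z 0≤r h g = begin
      ∣ (E (2 ℕ.+ n) w - E (2 ℕ.+ n) z) - (w - z) * E (2 ℕ.+ n) z ∣
        ≡⟨ cong ∣_∣ (solve 5 (λ a b d e t → (a :- b) :- d :* (e :+ t) :=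
          ((a :- b) :- d :* e) :+ (:- d) :* t) refl
             (E (2 ℕ.+ n) w) (E (2 ℕ.+ n) z) (w - z) (E (1 ℕ.+ n) z) (T (1 ℕ.+ n) z)) ⟩
      ∣ ((E (2 ℕ.+ n) w - E (2 ℕ.+ n) z) - (w - z) * E (1 ℕ.+ n) z) + (- (w - z)) * T (1 ℕ.+ n) z ∣
        ≤⟨ ∣∣-+ (E-rest n w z 0≤r h g) (∣∣-* dist (T-abs (1 ℕ.+ n) g)) ⟩
      square (w - z) * E n r + (r + r) * T (1 ℕ.+ n) r
        ≤⟨ ℚ.+-mono-≤
             (ℚ.≤-trans (ℚ.*-monoˡ-≤-nonNeg (square (w - z)) {{ℚ.nonNegative (0≤p*p (w - z))}}
                (ℚ.≤-trans (E-step n 0≤r) (E-step (suc n) 0≤r)))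
               (ℚ.≤-reflexive (ℚ.*-comm (square (w - z)) (E (2 ℕ.+ n) r))))
             (ℚ.*-monoˡ-≤-nonNeg (r + r) {{ℚ.nonNegative (0≤+ 0≤r 0≤r)}}
               (ℚ.≤-trans (Q.p≤∣p∣ (T (1 ℕ.+ n) r))
                 (ℚ.≤-reflexive (cong ∣_∣ (solve 2 (λ e t → t := (e :+ t) :- e)
                   refl (E (1 ℕ.+ n) r) (T (1 ℕ.+ n) r)))))) ⟩
      E (2 ℕ.+ n) r * square (w - z) + (r + r) * ∣ E (2 ℕ.+ n) r - E (1 ℕ.+ n) r ∣ ∎
      where
      open ℚ.≤-Reasoning
      dist : ∣ - (w - z) ∣ ≤ r + r
      dist = subst (_≤ r + r) (sym (ℚ.∣-p∣≡∣p∣ (w - z)))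
        (∣∣-+ h (subst (_≤ r) (sym (ℚ.∣-p∣≡∣p∣ z)) g))

    E-zero : ∀ n → E (suc n) 0ℚ ≡ 1ℚ
    E-zero zero    = refl
    E-zero (suc n) = trans (cong₂ _+_ (E-zero n) (trans (cong (T n 0ℚ *_) (ℚ.*-zeroˡ (recip n)))
      (ℚ.*-zeroʳ (T n 0ℚ)))) refl

  -- Second-order estimates for the partial sums of 2 artanh

  module LogSeries where
    open import Data.Rational.Base using (_+_; _*_; _-_; -_; ∣_∣; _≤_)
    open +-*-Solver
    open ℚLemmas
    open ExpSeries using (∣∣-+; ∣∣-*; ∣∣-nonNeg; square)
    open Q using (pow)

    private
      ι : ℕ → ℚ
      ι n = + n ℚ./ 1

      2ℚ : ℚ
      2ℚ = 1ℚ + 1ℚ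

    coeff : ℕ → ℚ
    coeff m = + 2 ℚ./ suc m

    -- Partial sums of 2 artanh z, the series behind `log` with z = (t - 1)/(t + 1).
    A : ℕ → ℚ → ℚ
    A zero    z = 0ℚ
    A (suc n) z = A n z + pow z (suc (n ℕ.* 2)) * coeff (n ℕ.* 2)

    A-zero : ∀ n → A n 0ℚ ≡ 0ℚ
    A-zero zero    = refl
    A-zero (suc n) = trans (cong₂ _+_ (A-zero n)
      (trans (cong (_* coeff (n ℕ.* 2)) (ℚ.*-zeroˡ (pow 0ℚ (n ℕ.* 2))))
      (ℚ.*-zeroˡ (coeff (n ℕ.* 2))))) refl

    coeff≡ : ∀ m → coeff m ≡ 2ℚ * (+ 1 ℚ./ suc m)
    coeff≡ m = ℚ.toℚᵘ-injective (ℚᵘ.≃-trans (Q.toℚᵘ-/ 2 m) (ℚᵘ.≃-sym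
      (ℚᵘ.≃-trans (ℚ.toℚᵘ-homo-* 2ℚ (+ 1 ℚ./ suc m))
        (ℚᵘ.≃-trans (ℚᵘ.*-congˡ {ℚ.toℚᵘ 2ℚ} (Q.toℚᵘ-/ 1 m))
        (ℚᵘ.*≡* (cong (λ k → + 2 ℤ.* + suc k) (sym (ℕ.+-identityʳ m))))))))

    coeff-cancel : ∀ m → coeff m * (1ℚ + ι m) ≡ 2ℚ
    coeff-cancel m = trans (cong₂ _*_ (coeff≡ m) (sym (Q.fromℕ-suc m)))
      (trans (ℚ.*-assoc 2ℚ (+ 1 ℚ./ suc m) (ι (suc m))) (cong (2ℚ *_) (Q./-*-cancel m)))

    0≤coeff : ∀ m → 0ℚ ≤ coeff m
    0≤coeff m = Q./-nonNeg 2 m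

    pow-abs : ∀ {z r} k → ∣ z ∣ ≤ r → ∣ pow z k ∣ ≤ pow r k
    pow-abs zero    h = ℚ.≤-refl
    pow-abs (suc k) h = ∣∣-* h (pow-abs k h)

    -- deriv r m = m r^(m-1)
    deriv : ℚ → ℕ → ℚ
    deriv r zero    = 0ℚ
    deriv r (suc m) = r * deriv r m + pow r m

    0≤deriv : ∀ {r} m → 0ℚ ≤ r → 0ℚ ≤ deriv r m
    0≤deriv zero    h = ℚ.≤-refl
    0≤deriv {r} (suc m) h = 0≤+ (Q.0≤* h (0≤deriv m h)) (Q.pow-nonNeg r m h)

    pow-rest : ℕ → ℚ → ℚ → ℚ
    pow-rest m w z = (pow w (suc m) - pow z (suc m)) - (w - z) * ((1ℚ + ι m) * pow z m)

    -- Taylor's bound with second derivative (m + 1) m r^(m-1), again without the factor 1/2.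
    pow-rest-bound : ∀ {r} m w z → 0ℚ ≤ r → ∣ w ∣ ≤ r → ∣ z ∣ ≤ r →
      ∣ pow-rest m w z ∣ ≤ square (w - z) * ((1ℚ + ι m) * deriv r m)
    pow-rest-bound zero w z 0≤r h g = ℚ.≤-reflexive (trans
      (cong ∣_∣ (solve 2 (λ w z → (w :* con 1ℚ :- z :* con 1ℚ) :- (w :- z) :*
        ((con 1ℚ :+ con 0ℚ) :* con 1ℚ) := con 0ℚ) refl w z))
      (solve 1 (λ d → con 0ℚ := d :* ((con 1ℚ :+ con 0ℚ) :* con 0ℚ)) refl (square (w - z))))
    pow-rest-bound {r} (suc m) w z 0≤r h g = begin
      ∣ pow-rest (suc m) w z ∣
        ≡⟨ cong ∣_∣ (trans (cong (λ x →
          (w * (w * a) - z * (z * b)) - (w - z) * ((1ℚ + x) * (z * b))) (Q.fromℕ-suc m))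
             (solve 5 (λ w z a b J → (w :* (w :* a) :- z :* (z :* b)) :- (w :- z) :*
               ((con 1ℚ :+ (con 1ℚ :+ J)) :* (z :* b)) :=
               w :* ((w :* a :- z :* b) :- (w :- z) :* ((con 1ℚ :+ J) :* b)) :+
                 ((w :- z) :* (w :- z)) :* ((con 1ℚ :+ J) :* b)) refl w z a b J)) ⟩
      ∣ w * pow-rest m w z + d * ((1ℚ + J) * b) ∣
        ≤⟨ ∣∣-+ (∣∣-* h (pow-rest-bound m w z 0≤r h g)) (∣∣-* (∣∣-nonNeg (0≤p*p (w - z)))
          (∣∣-* (∣∣-nonNeg 0≤1+J) (pow-abs m g))) ⟩
      r * (d * ((1ℚ + J) * deriv r m)) + d * ((1ℚ + J) * pow r m)
        ≤⟨ ≤-cert (d * deriv r (suc m)) (Q.0≤* (0≤p*p (w - z)) (0≤deriv (suc m) 0≤r))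
             (solve 5 (λ r d J e p → d :* ((con 1ℚ :+ (con 1ℚ :+ J)) :* (r :* e :+ p)) :=
               (r :* (d :* ((con 1ℚ :+ J) :* e)) :+ d :* ((con 1ℚ :+ J) :* p)) :+ d :*
                 (r :* e :+ p)) refl r d J (deriv r m) (pow r m)) ⟩
      d * ((1ℚ + (1ℚ + J)) * deriv r (suc m))
        ≡⟨ cong (λ x → d * ((1ℚ + x) * deriv r (suc m))) (Q.fromℕ-suc m) ⟨
      d * ((1ℚ + ι (suc m)) * deriv r (suc m)) ∎
      where
      open ℚ.≤-Reasoning
      a b d J : ℚ
      a = pow w m
      b = pow z m
      d = square (w - z)
      J = ι m
      0≤1+J : 0ℚ ≤ 1ℚ + J
      0≤1+J = 0≤+ (Q./-nonNeg 1 0) (Q./-nonNeg m 0)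

    -- `2ℚ * evenDerivs r n` is the second derivative of `A n` at `r`. It is compared with the sum
    -- `derivs` over all exponents, which has a simple bound.
    geom derivs evenDerivs : ℚ → ℕ → ℚ
    geom r zero    = 0ℚ
    geom r (suc m) = geom r m + pow r m
    derivs r zero    = 0ℚ
    derivs r (suc m) = derivs r m + deriv r m
    evenDerivs r zero    = 0ℚ
    evenDerivs r (suc k) = evenDerivs r k + deriv r (k ℕ.* 2)

    geom-sum : ∀ r m → (1ℚ - r) * geom r m + pow r m ≡ 1ℚ
    geom-sum r zero    = solve 1 (λ r → (con 1ℚ :- r) :* con 0ℚ :+ con 1ℚ := con 1ℚ) refl r
    geom-sum r (suc m) = trans (solve 3 (λ r g p → (con 1ℚ :- r) :* (g :+ p) :+ r :* p :=
      (con 1ℚ :- r) :* g :+ p) refl r (geom r m) (pow r m)) (geom-sum r m)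

    derivs-sum : ∀ r m → (1ℚ - r) * derivs r m + deriv r m ≡ geom r m
    derivs-sum r zero    = solve 1 (λ r → (con 1ℚ :- r) :* con 0ℚ :+ con 0ℚ := con 0ℚ) refl r
    derivs-sum r (suc m) = trans
      (solve 4 (λ r g d p → (con 1ℚ :- r) :* (g :+ d) :+ (r :* d :+ p) :=
      ((con 1ℚ :- r) :* g :+ d) :+ p) refl r (derivs r m) (deriv r m) (pow r m))
      (cong (_+ pow r m) (derivs-sum r m))

    evenDerivs≤derivs : ∀ {r} k → 0ℚ ≤ r → evenDerivs r k ≤ derivs r (k ℕ.* 2)
    evenDerivs≤derivs zero    h = ℚ.≤-refl
    evenDerivs≤derivs {r} (suc k) h =
      ℚ.≤-trans (ℚ.+-monoˡ-≤ (deriv r (k ℕ.* 2)) (evenDerivs≤derivs k h))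
      (≤-cert _ (0≤deriv (suc (k ℕ.* 2)) h) refl)

    module _ (r : ℚ) (0≤r : 0ℚ ≤ r) (s>0 : Positive (1ℚ - r)) where
      i κ : ℚ
      i = Q.inv (1ℚ - r) s>0
      κ = i * i

      0≤i : 0ℚ ≤ i
      0≤i = Q.0≤pos i {{Q.inv-pos (1ℚ - r) s>0}}

      div-bound : ∀ {x y b} → 0ℚ ≤ y → (1ℚ - r) * x + y ≤ b → x ≤ i * b
      div-bound {x} {y} {b} h k = subst (_≤ i * b)
        (trans (sym (ℚ.*-assoc i (1ℚ - r) x)) (trans (cong (_* x) (Q.inv-*ˡ (1ℚ - r) s>0))
          (ℚ.*-identityˡ x)))
        (ℚ.*-monoˡ-≤-nonNeg i {{ℚ.nonNegative 0≤i}} (ℚ.≤-trans (≤-cert y h refl) k))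

      -- Dividing `derivs-sum` and `geom-sum` by 1 - r bounds the sum of m r^(m-1) by 1/(1 - r)²,
      -- whatever the number of terms.
      derivs≤κ : ∀ m → derivs r m ≤ κ
      derivs≤κ m = div-bound (0≤deriv m 0≤r) (ℚ.≤-trans (ℚ.≤-reflexive (derivs-sum r m))
        (subst (geom r m ≤_) (ℚ.*-identityʳ i) (div-bound (Q.pow-nonNeg r m 0≤r)
          (ℚ.≤-reflexive (geom-sum r m)))))

      evenSquares : ℕ → ℚ → ℚ
      evenSquares zero    z = 0ℚ
      evenSquares (suc k) z = evenSquares k z + pow z (k ℕ.* 2)

      evenSquares-sum : ∀ k z → (1ℚ - z * z) * evenSquares k z ≡ 1ℚ - pow z (k ℕ.* 2)
      evenSquares-sum zero    z = solve 1 (λ z → (con 1ℚ :- z :* z) :* con 0ℚ := con 1ℚ :- con 1ℚ)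
        refl z
      evenSquares-sum (suc k) z = trans (ℚ.*-distribˡ-+ (1ℚ - z * z) (evenSquares k z)
        (pow z (k ℕ.* 2)))
        (trans (cong (_+ (1ℚ - z * z) * pow z (k ℕ.* 2)) (evenSquares-sum k z))
          (solve 2 (λ z p → (con 1ℚ :- p) :+ (con 1ℚ :- z :* z) :* p := con 1ℚ :- z :* (z :* p))
            refl z (pow z (k ℕ.* 2))))

      A-rest : ∀ n w z → ∣ w ∣ ≤ r → ∣ z ∣ ≤ r →
        ∣ (A n w - A n z) - (w - z) * (2ℚ * evenSquares n z) ∣ ≤ square
          (w - z) * (2ℚ * evenDerivs r n)
      A-rest zero w z h g = ℚ.≤-reflexive (trans
        (cong ∣_∣ (solve 2 (λ w z → (con 0ℚ :- con 0ℚ) :- (w :- z) :* (con 2ℚ :* con 0ℚ) := con 0ℚ)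
          refl w z))
        (solve 1 (λ d → con 0ℚ := d :* (con 2ℚ :* con 0ℚ)) refl (square (w - z))))
      A-rest (suc n) w z h g = subst₂ _≤_
        (cong ∣_∣ (trans
          (cong (λ x → ((A n w - A n z) - (w - z) * (2ℚ * evenSquares n z)) +
            ((a * c - b * c) - (w - z) * (x * p))) (coeff-cancel (n ℕ.* 2)))
          (solve 9 (λ Aw Az w z s a b c p →
            ((Aw :- Az) :- (w :- z) :* (con 2ℚ :* s)) :+ ((a :* c :- b :* c) :- (w :- z) :*
              (con 2ℚ :* p)) :=
            ((Aw :+ a :* c) :- (Az :+ b :* c)) :- (w :- z) :* (con 2ℚ :* (s :+ p))) refl (A n w)
              (A n z) w z (evenSquares n z) a b c p)))
        (trans (cong (λ x → square (w - z) * (2ℚ * evenDerivs r n) + square (w - z) * (x * q))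
          (coeff-cancel (n ℕ.* 2)))
          (solve 3 (λ d e q → d :* (con 2ℚ :* e) :+ d :* (con 2ℚ :* q) :=
            d :* (con 2ℚ :* (e :+ q))) refl (square (w - z)) (evenDerivs r n) q))
        (∣∣-+ (A-rest n w z h g) term)
        where
        a b c p q J : ℚ
        a = pow w (suc (n ℕ.* 2))
        b = pow z (suc (n ℕ.* 2))
        c = coeff (n ℕ.* 2)
        p = pow z (n ℕ.* 2)
        q = deriv r (n ℕ.* 2)
        J = 1ℚ + ι (n ℕ.* 2)
        term : ∣ (a * c - b * c) - (w - z) * ((c * J) * p) ∣ ≤ square (w - z) * ((c * J) * q)
        term = subst₂ _≤_
          (cong ∣_∣ (solve 6 (λ c a b h J p → c :* ((a :- b) :- h :* (J :* p)) :=
            (a :* c :- b :* c) :- h :* ((c :* J) :* p)) refl c a b (w - z) J p))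
          (solve 4 (λ c d J q → c :* (d :* (J :* q)) := d :* ((c :* J) :* q))
            refl c (square (w - z)) J q)
          (∣∣-* (∣∣-nonNeg (0≤coeff (n ℕ.* 2))) (pow-rest-bound (n ℕ.* 2) w z 0≤r h g))

      r≤1 : r ≤ 1ℚ
      r≤1 = ≤-cert (1ℚ - r) (Q.0≤pos (1ℚ - r) {{s>0}})
        (solve 1 (λ r → con 1ℚ := r :+ (con 1ℚ :- r)) refl r)

      -- Multiplication by 1 - z² turns the limiting derivative 2/(1 - z²) into the constant 2. For
      -- the partial sums there remains an error 2 (w - z) z^(2n), at most 4 r^(2n), which tends to
      -- 0.
      A-estimate : ∀ n w z → ∣ w ∣ ≤ r → ∣ z ∣ ≤ r →
        ∣ (1ℚ - z * z) * (A n w - A n z) - 2ℚ * (w - z) ∣ ≤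
        ((2ℚ * 2ℚ) * κ) * square (w - z) + (2ℚ * 2ℚ) * pow r (n ℕ.* 2)
      A-estimate n w z h g = begin
        ∣ (1ℚ - z * z) * (A n w - A n z) - 2ℚ * (w - z) ∣
          ≡⟨ cong ∣_∣ (trans
               (solve 5 (λ z x h s p → (con 1ℚ :- z :* z) :* x :- con 2ℚ :* h :=
                 (con 1ℚ :- z :* z) :* (x :- h :* (con 2ℚ :* s)) :+ (con 2ℚ :* h) :*
                   ((con 1ℚ :- z :* z) :* s :- con 1ℚ)) refl z (A n w - A n z) (w - z)
                   (evenSquares n z) p)
               (cong (λ x → (1ℚ - z * z) * ((A n w - A n z) - (w - z) * (2ℚ * evenSquares n z)) +
                 (2ℚ * (w - z)) * (x - 1ℚ)) (evenSquares-sum n z))) ⟩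
        ∣ (1ℚ - z * z) * ((A n w - A n z) - (w - z) * (2ℚ * evenSquares n z)) + (2ℚ * (w - z)) *
          ((1ℚ - p) - 1ℚ) ∣
          ≤⟨ ∣∣-+ (∣∣-* ∣1-zz∣ (A-rest n w z h g)) (∣∣-* (∣∣-* (∣∣-nonNeg (Q./-nonNeg 2 0)) ∣w-z∣)
            ∣p∣) ⟩
        2ℚ * (d * (2ℚ * evenDerivs r n)) + (2ℚ * 2ℚ) * pow r (n ℕ.* 2)
          ≤⟨ ℚ.+-monoˡ-≤ ((2ℚ * 2ℚ) * pow r (n ℕ.* 2)) (≤-cert {2ℚ * (d * (2ℚ * evenDerivs r n))}
            ((2ℚ * 2ℚ) * d * (κ - evenDerivs r n))
               (Q.0≤* (Q.0≤* (Q./-nonNeg 4 0) (0≤p*p (w - z)))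
                 (0≤- (ℚ.≤-trans (evenDerivs≤derivs n 0≤r) (derivs≤κ (n ℕ.* 2)))))
               (solve 3 (λ d e k → ((con 2ℚ :* con 2ℚ) :* k) :* d :=
                 con 2ℚ :* (d :* (con 2ℚ :* e)) :+ (con 2ℚ :* con 2ℚ) :* d :* (k :- e)) refl d
                 (evenDerivs r n) κ)) ⟩
        ((2ℚ * 2ℚ) * κ) * d + (2ℚ * 2ℚ) * pow r (n ℕ.* 2) ∎
        where
        open ℚ.≤-Reasoning
        d p : ℚ
        d = square (w - z)
        p = pow z (n ℕ.* 2)
        ∣-x∣ : ∀ {x b} → ∣ x ∣ ≤ b → ∣ - x ∣ ≤ b
        ∣-x∣ {x} {b} k = subst (_≤ b) (sym (ℚ.∣-p∣≡∣p∣ x)) k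
        ∣1-zz∣ : ∣ 1ℚ - z * z ∣ ≤ 2ℚ
        ∣1-zz∣ = ∣∣-+ ℚ.≤-refl (∣-x∣ {z * z} (∣∣-* {z} {z} {1ℚ} {1ℚ} (ℚ.≤-trans g r≤1)
          (ℚ.≤-trans g r≤1)))
        ∣w-z∣ : ∣ w - z ∣ ≤ 2ℚ
        ∣w-z∣ = ∣∣-+ (ℚ.≤-trans h r≤1) (∣-x∣ {z} (ℚ.≤-trans g r≤1))
        ∣p∣ : ∣ (1ℚ - p) - 1ℚ ∣ ≤ pow r (n ℕ.* 2)
        ∣p∣ = subst (λ x → ∣ x ∣ ≤ pow r (n ℕ.* 2))
          (solve 1 (λ p → :- p := (con 1ℚ :- p) :- con 1ℚ) refl p) (∣-x∣ {p} (pow-abs (n ℕ.* 2) g))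

      pow-anti : ∀ l j → pow r (l ℕ.+ j) ≤ pow r j
      pow-anti zero    j = ℚ.≤-refl
      pow-anti (suc l) j = ℚ.≤-trans (subst (r * pow r (l ℕ.+ j) ≤_) (ℚ.*-identityˡ _)
        (ℚ.*-monoʳ-≤-nonNeg (pow r (l ℕ.+ j)) {{ℚ.nonNegative (Q.pow-nonNeg r (l ℕ.+ j) 0≤r)}}
          r≤1)) (pow-anti l j)

      pow-vanishes : ∀ ε .{{_ : Positive ε}} → ∃[ N ] ∀ n → N ℕ.≤ n →
        (2ℚ * 2ℚ) * pow r (n ℕ.* 2) ≤ ε
      pow-vanishes ε = N , λ n N≤n → subst (_≤ ε) (ℚ.*-comm (pow r (n ℕ.* 2)) (2ℚ * 2ℚ)) (ℚ.≤-trans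
        (ℚ.*-monoʳ-≤-nonNeg (2ℚ * 2ℚ) (subst (λ k → pow r k ≤ pow r N)
          (ℕ.m∸n+n≡m (ℕ.≤-trans N≤n (ℕ.m≤m*n n 2))) (pow-anti (n ℕ.* 2 ℕ.∸ N) N))) (proj₂ dec))
        where
        dec : ∃[ j ] pow r j * (2ℚ * 2ℚ) ≤ ε
        dec = Q.decay r (2ℚ * 2ℚ) ε 0≤r s>0
        N : ℕ
        N = proj₁ dec

    MobiusBelow : ℚ → ℚ → ℚ → Set
    MobiusBelow ε B r = ∀ a j → ε ≤ a → a ≤ B → 0ℚ ≤ j → (a + 1ℚ) * j ≡ 1ℚ → ∣ (a - 1ℚ) * j ∣ ≤ r

    mobius-below : ∀ ε B → Positive ε → Positive B → ∃[ r ] 0ℚ ≤ r × Positive (1ℚ - r) ×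
      MobiusBelow ε B r
    -- The bound `r` of `Q.mobius-bound` comes without a sign, so it is replaced by its maximum with
    -- 0.
    mobius-below ε B ε>0 B>0 = r ℚ.⊔ 0ℚ , ℚ.p≤q⊔p r 0ℚ , s>0 ,
        λ a j h g k e → ℚ.≤-trans (proj₂ (proj₂ m) a j h g k e) (ℚ.p≤p⊔q r 0ℚ)
      where
      m : ∃[ r ] (r ℚ.< 1ℚ) × MobiusBelow ε B r
      m = Q.mobius-bound ε B ε>0 B>0
      r : ℚ
      r = proj₁ m
      s>0 : Positive (1ℚ - (r ℚ.⊔ 0ℚ))
      s>0 = ℚ.positive (subst (ℚ._< 1ℚ - (r ℚ.⊔ 0ℚ)) (ℚ.+-inverseʳ (r ℚ.⊔ 0ℚ))
        (ℚ.+-monoˡ-< (- (r ℚ.⊔ 0ℚ)) {r ℚ.⊔ 0ℚ} {1ℚ} (⊔-lub-< (proj₁ (proj₂ m)) (ℚ.positive⁻¹ 1ℚ))))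

  -- The ordered field of real numbers

  infix  4 _≈_ _≤_ _<_
  infix  9 -_
  infixl 6 _+_ _-_
  infixl 7 _*_

  -- Opaque copies of the relations and operations: the originals unfold to
  -- statements about sequences, from which their arguments cannot be inferred.
  opaque
    _≈_ _≤_ : ℝ → ℝ → Set
    _≈_ = D._≈_
    _≤_ = D._≤_

  opaque
    _<_ : ℝ → ℝ → Set
    _<_ = D._<_

  opaque
    _+_ _*_ : ℝ → ℝ → ℝ
    _+_ = D._+_
    _*_ = D._*_

    -_ ∣_∣ : ℝ → ℝ
    -_ = D.-_
    ∣_∣ = D.∣_∣

    fromℚ : ℚ → ℝ
    fromℚ = D.fromℚ

  _-_ : ℝ → ℝ → ℝ
  x - y = x + (- y)

  0ℝ 1ℝ : ℝ
  0ℝ = fromℚ 0ℚ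
  1ℝ = fromℚ 1ℚ

  opaque
    unfolding _≈_ _<_

    ≈-in : ∀ {x y} → x D.≈ y → x ≈ y
    ≈-in h = h

    ≈-out : ∀ {x y} → x ≈ y → x D.≈ y
    ≈-out h = h

    ≤-in : ∀ {x y} → x D.≤ y → x ≤ y
    ≤-in h = h

    ≤-out : ∀ {x y} → x ≤ y → x D.≤ y
    ≤-out h = h

    <-in : ∀ {x y} → x D.< y → x < y
    <-in h = h

    <-out : ∀ {x y} → x < y → x D.< y
    <-out h = h

  Eventually : (ℕ → Set) → Set
  Eventually P = ∃[ N ] ∀ n → N ℕ.≤ n → P n

  always : ∀ {P : ℕ → Set} → (∀ n → P n) → Eventually P
  always h = 0 , λ n _ → h n

  ev-map : ∀ {P Q : ℕ → Set} → (∀ n → P n → Q n) → Eventually P → Eventually Q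
  ev-map f (N , h) = N , λ n p → f n (h n p)

  ev-map₂ : ∀ {P Q R : ℕ → Set} → (∀ n → P n → Q n → R n) →
            Eventually P → Eventually Q → Eventually R
  ev-map₂ f (M , h) (N , k) = M ℕ.⊔ N , λ n p →
    f n (h n (⊔-≤ˡ {M} {N} p)) (k n (⊔-≤ʳ {M} {N} p))


  ev-both : ∀ {P Q : ℕ → Set} → Eventually P → Eventually Q → Eventually (λ n → P n × Q n)
  ev-both = ev-map₂ (λ n p q → p , q)

  opaque
    unfolding _+_

    ≤-intro : ∀ {x y} → (∀ ε .{{_ : Positive ε}} → Eventually (λ n → seq x n ℚ.≤ seq y n ℚ.+ ε)) →
      x ≤ y
    ≤-intro h = ≤-in h

    ≤-elim : ∀ {x y} → x ≤ y → ∀ ε .{{_ : Positive ε}} →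
      Eventually (λ n → seq x n ℚ.≤ seq y n ℚ.+ ε)
    ≤-elim h = ≤-out h

    ≤-eventually : ∀ {x y} → Eventually (λ n → seq x n ℚ.≤ seq y n) → x ≤ y
    ≤-eventually {x} {y} h = ≤-intro λ ε → ev-map (λ n k → ℚ.≤-trans k
      (ℚLemmas.≤-cert ε (Q.0≤pos ε) refl)) h

    ≤-pointwise : ∀ {x y} → (∀ n → seq x n ℚ.≤ seq y n) → x ≤ y
    ≤-pointwise h = ≤-eventually (always h)

    ≤-antisym : ∀ {x y} → x ≤ y → y ≤ x → x ≈ y
    ≤-antisym {x} {y} h k = ≈-in λ ε → ev-map₂ (λ n → ∣-∣-≤) (≤-elim h ε) (≤-elim k ε)

    ≈⇒≤ : ∀ {x y} → x ≈ y → x ≤ y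
    ≈⇒≤ h = ≤-intro λ ε → ev-map (λ n → ∣-∣-≤⁻) (≈-out h ε)

    ≤-refl : ∀ {x} → x ≤ x
    ≤-refl = ≤-pointwise λ n → ℚ.≤-refl

    ≤-trans : ∀ {x y z} → x ≤ y → y ≤ z → x ≤ z
    ≤-trans {x} {y} {z} h k = ≤-intro λ ε → ev-map₂
      (λ n p q → ℚ.≤-trans p (ℚ.≤-trans (ℚ.+-monoˡ-≤ (ε ℚ.* ½) q)
        (ℚ.≤-reflexive (trans (ℚ.+-assoc (seq z n) _ _) (cong (seq z n ℚ.+_) (Q.halves ε))))))
      (≤-elim h (ε ℚ.* ½) {{half>0 ε}}) (≤-elim k (ε ℚ.* ½) {{half>0 ε}})

    ≈-pointwise : ∀ {x y} → (∀ n → seq x n ≡ seq y n) → x ≈ y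
    ≈-pointwise h = ≤-antisym (≤-pointwise λ n → ℚ.≤-reflexive (h n)) (≤-pointwise λ n →
      ℚ.≤-reflexive (sym (h n)))

    ≈-refl : ∀ {x} → x ≈ x
    ≈-refl = ≈-pointwise λ n → refl

    ≈-sym : ∀ {x y} → x ≈ y → y ≈ x
    ≈-sym {x} {y} h = ≈-in λ ε → ev-map (λ n → subst (ℚ._≤ ε) (Q.dist-sym (seq x n) (seq y n)))
      (≈-out h ε)

    ≈-trans : ∀ {x y z} → x ≈ y → y ≈ z → x ≈ z
    ≈-trans h k = ≤-antisym (≤-trans (≈⇒≤ h) (≈⇒≤ k)) (≤-trans (≈⇒≤ (≈-sym k)) (≈⇒≤ (≈-sym h)))

    +-mono-≤ : ∀ {x y u v} → x ≤ y → u ≤ v → x + u ≤ y + v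
    +-mono-≤ {x} {y} {u} {v} h k = ≤-intro λ ε → ev-map₂
      (λ n p q → ℚ.≤-trans (ℚ.+-mono-≤ p q) (ℚ.≤-reflexive
         (solve 3 (λ y v e → (y :+ e :* con ½) :+ (v :+ e :* con ½) := (y :+ v) :+ e)
           refl (seq y n) (seq v n) ε)))
      (≤-elim h (ε ℚ.* ½) {{half>0 ε}}) (≤-elim k (ε ℚ.* ½) {{half>0 ε}})
      where open +-*-Solver

    neg-anti-≤ : ∀ {x y} → x ≤ y → - y ≤ - x
    neg-anti-≤ {x} {y} h = ≤-intro λ ε → ev-map
      (λ n p → ℚLemmas.≤-cert ((seq y n ℚ.+ ε) ℚ.- seq x n) (ℚLemmas.0≤- p)
        (solve 3 (λ x y e → :- x :+ e := :- y :+ ((y :+ e) :- x)) refl (seq x n) (seq y n) ε))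
      (≤-elim h ε)
      where open +-*-Solver

    +-cong : ∀ {x y u v} → x ≈ y → u ≈ v → x + u ≈ y + v
    +-cong h k = ≤-antisym (+-mono-≤ (≈⇒≤ h) (≈⇒≤ k)) (+-mono-≤ (≈⇒≤ (≈-sym h)) (≈⇒≤ (≈-sym k)))

    -‿cong : ∀ {x y} → x ≈ y → - x ≈ - y
    -‿cong h = ≤-antisym (neg-anti-≤ (≈⇒≤ (≈-sym h))) (neg-anti-≤ (≈⇒≤ h))

    *-cong : ∀ {x y u v} → x ≈ y → u ≈ v → x * u ≈ y * v
    *-cong {x} {y} {u} {v} h k = ≈-in cl
      where
      open +-*-Solver
      A B : ℚ
      A = proj₁ (bounded x)
      B = proj₁ (bounded v)
      S>0 : Positive (A ℚ.+ B)
      S>0 = ℚ.pos+pos⇒pos A {{proj₁ (proj₂ (bounded x))}} B {{proj₁ (proj₂ (bounded v))}}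
      i : ℚ
      i = Q.inv (A ℚ.+ B) S>0
      cl : x * u D.≈ y * v
      cl ε = ev-map₂ (λ n (a , b) (c , d) →
          Q.*-close (seq x n) (seq y n) (seq u n) (seq v n) A B δ ε (Q.0≤pos δ {{δ>0}}) a b c d
            total)
        (ev-both (proj₂ (proj₂ (bounded x))) (proj₂ (proj₂ (bounded v))))
        (ev-both (≈-out h δ {{δ>0}}) (≈-out k δ {{δ>0}}))
        where
        δ : ℚ
        δ = ε ℚ.* i
        δ>0 : Positive δ
        δ>0 = ℚ.pos*pos⇒pos ε i {{Q.inv-pos (A ℚ.+ B) S>0}}
        total : A ℚ.* δ ℚ.+ B ℚ.* δ ≡ ε
        total = trans
          (solve 4 (λ a b e i → a :* (e :* i) :+ b :* (e :* i) := e :* (i :* (a :+ b))) refl A B ε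
            i)
          (trans (cong (ε ℚ.*_) (Q.inv-*ˡ (A ℚ.+ B) S>0)) (ℚ.*-identityʳ ε))

    +-assoc : ∀ x y z → (x + y) + z ≈ x + (y + z)
    +-assoc x y z = ≈-pointwise λ n → ℚ.+-assoc (seq x n) (seq y n) (seq z n)

    +-comm : ∀ x y → x + y ≈ y + x
    +-comm x y = ≈-pointwise λ n → ℚ.+-comm (seq x n) (seq y n)

    +-identityˡ : ∀ x → 0ℝ + x ≈ x
    +-identityˡ x = ≈-pointwise λ n → ℚ.+-identityˡ (seq x n)

    +-inverseʳ : ∀ x → x + - x ≈ 0ℝ
    +-inverseʳ x = ≈-pointwise λ n → ℚ.+-inverseʳ (seq x n)

    *-assoc : ∀ x y z → (x * y) * z ≈ x * (y * z)
    *-assoc x y z = ≈-pointwise λ n → ℚ.*-assoc (seq x n) (seq y n) (seq z n)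

    *-comm : ∀ x y → x * y ≈ y * x
    *-comm x y = ≈-pointwise λ n → ℚ.*-comm (seq x n) (seq y n)

    *-identityˡ : ∀ x → 1ℝ * x ≈ x
    *-identityˡ x = ≈-pointwise λ n → ℚ.*-identityˡ (seq x n)

    fromℚ-+ : ∀ p q → fromℚ (p ℚ.+ q) ≈ fromℚ p + fromℚ q
    fromℚ-+ p q = ≈-pointwise λ n → refl

    fromℚ-* : ∀ p q → fromℚ (p ℚ.* q) ≈ fromℚ p * fromℚ q
    fromℚ-* p q = ≈-pointwise λ n → refl

    fromℚ-neg : ∀ p → fromℚ (ℚ.- p) ≈ - fromℚ p
    fromℚ-neg p = ≈-pointwise λ n → refl

    *-distribˡ-+ : ∀ x y z → x * (y + z) ≈ x * y + x * z
    *-distribˡ-+ x y z = ≈-pointwise λ n → ℚ.*-distribˡ-+ (seq x n) (seq y n) (seq z n)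

  -- The ring structure and its solver

  ℝ-commutativeRing : CommutativeRing _ _
  ℝ-commutativeRing = record
    { Carrier = ℝ ; _≈_ = _≈_ ; _+_ = _+_ ; _*_ = _*_ ; -_ = -_ ; 0# = 0ℝ ; 1# = 1ℝ
    ; isCommutativeRing = record
      { isRing = record
        { +-isAbelianGroup = record
          { isGroup = record
            { isMonoid = record
              { isSemigroup = record
                { isMagma = record
                  { isEquivalence = record { refl = ≈-refl ; sym = ≈-sym ; trans = ≈-trans }
                  ; ∙-cong = +-cong }
                ; assoc = +-assoc }
              ; identity = +-identityˡ , (λ x → ≈-trans (+-comm x 0ℝ) (+-identityˡ x)) }
            ; inverse = (λ x → ≈-trans (+-comm (- x) x) (+-inverseʳ x)) , +-inverseʳ
            ; ⁻¹-cong = -‿cong }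
          ; comm = +-comm }
        ; *-cong = *-cong
        ; *-assoc = *-assoc
        ; *-identity = *-identityˡ , (λ x → ≈-trans (*-comm x 1ℝ) (*-identityˡ x))
        ; distrib = *-distribˡ-+ , (λ x y z → ≈-trans (*-comm (y + z) x)
          (≈-trans (*-distribˡ-+ x y z) (+-cong (*-comm x y) (*-comm x z)))) }
      ; *-comm = *-comm } }

  module ℝ-Ring = CommutativeRing ℝ-commutativeRing

  module ℝ-Solver where
    ℝ-almostCommutativeRing : AlmostCommutativeRing _ _
    ℝ-almostCommutativeRing = fromCommutativeRing ℝ-commutativeRing

    ℚ-rawRing : RawRing _ _
    ℚ-rawRing = ℚ.+-*-rawRing

    -- Equality of reals is undecidable, so the solver computes with rational coefficients, whose
    -- equality is decidable. This also admits constants such as `con ½` in the identities.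
    fromℚ-morphism : ℚ-rawRing -Raw-AlmostCommutative⟶ ℝ-almostCommutativeRing
    fromℚ-morphism = record
      { ⟦_⟧ = fromℚ
      ; +-homo = fromℚ-+
      ; *-homo = fromℚ-*
      ; -‿homo = fromℚ-neg
      ; 0-homo = ≈-refl
      ; 1-homo = ≈-refl }

    fromℚ-≟ : ∀ p q → Maybe (fromℚ p ≈ fromℚ q)
    fromℚ-≟ p q with p ℚ.≟ q
    ... | yes refl = just ≈-refl
    ... | no _     = nothing

    open Algebra.Solver.Ring ℚ-rawRing ℝ-almostCommutativeRing fromℚ-morphism fromℚ-≟ public

  open ℝ-Solver using (solve; con; _:=_; _:+_; _:*_; _:-_; :-_; _:^_) public

  ≤-poset : Poset _ _ _
  ≤-poset = record
    { Carrier = ℝ ; _≈_ = _≈_ ; _≤_ = _≤_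
    ; isPartialOrder = record
      { isPreorder = record
        { isEquivalence = ℝ-Ring.isEquivalence ; reflexive = ≈⇒≤ ; trans = ≤-trans }
      ; antisym = ≤-antisym } }

  module ≤-R = Relation.Binary.Reasoning.PartialOrder ≤-poset

  ≡⇒≈ : ∀ {x y} → x ≡ y → x ≈ y
  ≡⇒≈ refl = ≈-refl

  ≤-resp : ∀ {x y u v} → x ≈ y → u ≈ v → x ≤ u → y ≤ v
  ≤-resp h k l = ≤-trans (≈⇒≤ (≈-sym h)) (≤-trans l (≈⇒≤ k))

  *-congˡ : ∀ {x y} c → x ≈ y → c * x ≈ c * y
  *-congˡ c = *-cong ≈-refl

  *-congʳ : ∀ {x y} c → x ≈ y → x * c ≈ y * c
  *-congʳ c h = *-cong h ≈-refl

  sub-cong : ∀ {x y u v} → x ≈ y → u ≈ v → x - u ≈ y - v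
  sub-cong h k = +-cong h (-‿cong k)

  ≤-cert : ∀ {x y} c → 0ℝ ≤ c → y ≈ x + c → x ≤ y
  ≤-cert {x} {y} c h e = ≤-resp
    (solve 1 (λ x → x :+ con 0ℚ := x) ≈-refl x) (≈-sym e) (+-mono-≤ (≤-refl {x}) h)

  0≤- : ∀ {x y} → x ≤ y → 0ℝ ≤ y - x
  0≤- {x} {y} h = ≤-resp (solve 1 (λ x → x :- x := con 0ℚ) ≈-refl x)
    ≈-refl (+-mono-≤ h (≤-refl { - x}))

  0≤-⁻ : ∀ {x y} → 0ℝ ≤ y - x → x ≤ y
  0≤-⁻ {x} {y} h = ≤-cert (y - x) h (solve 2 (λ x y → y := x :+ (y :- x)) ≈-refl x y)

  0≤+ : ∀ {x y} → 0ℝ ≤ x → 0ℝ ≤ y → 0ℝ ≤ x + y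
  0≤+ h k = ≤-resp (solve 0 (con 0ℚ :+ con 0ℚ := con 0ℚ) ≈-refl) ≈-refl (+-mono-≤ h k)

  opaque
    unfolding _+_

    x≤∣x∣ : ∀ x → x ≤ ∣ x ∣
    x≤∣x∣ x = ≤-pointwise λ n → Q.p≤∣p∣ (seq x n)

    -x≤∣x∣ : ∀ x → - x ≤ ∣ x ∣
    -x≤∣x∣ x = ≤-pointwise λ n → -p≤∣p∣ (seq x n)

    0≤∣x∣ : ∀ x → 0ℝ ≤ ∣ x ∣
    0≤∣x∣ x = ≤-pointwise λ n → ℚ.0≤∣p∣ (seq x n)

    ∣x∣-least : ∀ {x y} → x ≤ y → - x ≤ y → ∣ x ∣ ≤ y
    ∣x∣-least {x} {y} h k = ≤-intro λ ε → ev-map₂ (λ n → ∣∣-≤) (≤-elim h ε) (≤-elim k ε)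

    ∣x*y∣≈∣x∣*∣y∣ : ∀ x y → ∣ x * y ∣ ≈ ∣ x ∣ * ∣ y ∣
    ∣x*y∣≈∣x∣*∣y∣ x y = ≈-pointwise λ n → ℚ.∣p*q∣≡∣p∣*∣q∣ (seq x n) (seq y n)

    0≤x*x : ∀ x → 0ℝ ≤ x * x
    0≤x*x x = ≤-pointwise λ n → ℚLemmas.0≤p*p (seq x n)

    fromℚ-mono : ∀ {p q} → p ℚ.≤ q → fromℚ p ≤ fromℚ q
    fromℚ-mono h = ≤-pointwise λ n → h

    ∣fromℚ∣ : ∀ p → ∣ fromℚ p ∣ ≈ fromℚ ℚ.∣ p ∣
    ∣fromℚ∣ p = ≈-pointwise λ n → refl

    ≤-closed : ∀ {x y} → (∀ ε .{{_ : Positive ε}} → x ≤ y + fromℚ ε) → x ≤ y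
    ≤-closed {x} {y} h = ≤-intro λ ε → ev-map (λ n → ℚLemmas.add-halves (seq x n) (seq y n) ε)
      (≤-elim (h (ε ℚ.* ½) {{half>0 ε}}) (ε ℚ.* ½) {{half>0 ε}})

    rational-bound : ∀ x → Σ[ B ∈ ℚ ] Positive B × ∣ x ∣ ≤ fromℚ B
    rational-bound x = proj₁ b , proj₁ (proj₂ b) , ≤-eventually (proj₂ (proj₂ b))
      where
      b : Σ[ B ∈ ℚ ] Positive B × Eventually (λ n → ℚ.∣ seq x n ∣ ℚ.≤ B)
      b = bounded x

  opaque
    unfolding _+_ _<_

    <⇒gap : ∀ {x y} → x < y → Σ[ ε ∈ ℚ ] Positive ε × x + fromℚ ε ≤ y
    <⇒gap (ε , ε>0 , h) = ε , ε>0 , ≤-eventually h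

    gap⇒< : ∀ {x y} ε → Positive ε → x + fromℚ ε ≤ y → x < y
    -- Half of the gap absorbs the error that `≤` leaves to the approximating terms.
    gap⇒< {x} {y} ε ε>0 h = ε ℚ.* ½ , half>0 ε {{ε>0}} ,
      ev-map (λ n → ℚLemmas.half-gap (seq x n) (seq y n) ε)
      (≤-elim h (ε ℚ.* ½) {{half>0 ε {{ε>0}}}})

    real⁺>0 : ∀ x → 0ℝ < real x
    real⁺>0 (x D., h) = h

    inverse : (x : ℝ⁺) → real x * real (x D.⁻¹) ≈ 1ℝ
    inverse x = ≤-antisym (≤-eventually (ev-map (λ n h → ℚ.≤-reflexive (proj₂ h)) (D.⁻¹-inverse x)))
      (≤-eventually (ev-map (λ n h → ℚ.≤-reflexive (sym (proj₂ h))) (D.⁻¹-inverse x)))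

  opaque
    unfolding _+_

    positive⁺ : ∀ {x} → 0ℝ < x → D.0ℝ D.< x
    positive⁺ h = <-out h

  real⁺ : (x : ℝ) → 0ℝ < x → ℝ⁺
  real⁺ x h = x D., positive⁺ h

  <⇒≤ : ∀ {x y} → x < y → x ≤ y
  <⇒≤ {x} h =
    let ε , ε>0 , k = <⇒gap h in ≤-trans (≤-cert (fromℚ ε) (fromℚ-mono (Q.0≤pos ε {{ε>0}})) ≈-refl)
          k

  <-≤-trans : ∀ {x y z} → x < y → y ≤ z → x < z
  <-≤-trans h k =
    let ε , ε>0 , l = <⇒gap h in gap⇒< ε ε>0 (≤-trans l k)

  ≤-<-trans : ∀ {x y z} → x ≤ y → y < z → x < z
  ≤-<-trans h k =
    let ε , ε>0 , l = <⇒gap k in gap⇒< ε ε>0 (≤-trans (+-mono-≤ h ≤-refl) l)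

  fromℚ-pos : ∀ ε .{{_ : Positive ε}} → 0ℝ < fromℚ ε
  fromℚ-pos ε = gap⇒< ε (ℚ.positive (ℚ.positive⁻¹ ε))
    (≈⇒≤ (solve 1 (λ e → con 0ℚ :+ e := e) ≈-refl (fromℚ ε)))

  0<⇒rational : ∀ {x} → 0ℝ < x → Σ[ ε ∈ ℚ ] Positive ε × fromℚ ε ≤ x
  0<⇒rational h =
    let ε , ε>0 , k = <⇒gap h in ε , ε>0 ,
          ≤-resp (solve 1 (λ e → con 0ℚ :+ e := e) ≈-refl (fromℚ ε)) ≈-refl k

  0<- : ∀ {x y} → x < y → 0ℝ < y - x
  0<- {x} {y} h =
    let ε , ε>0 , k = <⇒gap h in <-≤-trans (fromℚ-pos ε {{ε>0}}) (≤-cert (y - (x + fromℚ ε)) (0≤- k)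
    (solve 3 (λ x y e → y :- x := e :+ (y :- (x :+ e))) ≈-refl x y (fromℚ ε)))

  <-resp : ∀ {x y u v} → x ≈ y → u ≈ v → x < u → y < v
  <-resp h k l = ≤-<-trans (≈⇒≤ (≈-sym h)) (<-≤-trans l (≈⇒≤ k))

  0<+ : ∀ {x y} → 0ℝ < x → 0ℝ ≤ y → 0ℝ < x + y
  0<+ {x} {y} h k = <-≤-trans h (≤-cert y k ≈-refl)

  ∣∣-resp : ∀ {x y a} → x ≈ y → ∣ x ∣ ≤ a → ∣ y ∣ ≤ a
  ∣∣-resp {x} h k = ∣x∣-least (≤-trans (≈⇒≤ (≈-sym h)) (≤-trans (x≤∣x∣ x) k))
    (≤-trans (≈⇒≤ (-‿cong (≈-sym h))) (≤-trans (-x≤∣x∣ x) k))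

  ∣∣-cong : ∀ {x y} → x ≈ y → ∣ x ∣ ≈ ∣ y ∣
  ∣∣-cong h = ≤-antisym (∣∣-resp (≈-sym h) ≤-refl) (∣∣-resp h ≤-refl)

  ∣∣-neg : ∀ {x a} → ∣ x ∣ ≤ a → ∣ - x ∣ ≤ a
  ∣∣-neg {x} k = ∣x∣-least (≤-trans (-x≤∣x∣ x) k)
    (≤-trans (≈⇒≤ (solve 1 (λ x → :- (:- x) := x) ≈-refl x)) (≤-trans (x≤∣x∣ x) k))

  ∣∣-+ : ∀ {x y a b} → ∣ x ∣ ≤ a → ∣ y ∣ ≤ b → ∣ x + y ∣ ≤ a + b
  ∣∣-+ {x} {y} h k = ∣x∣-least
    (+-mono-≤ (≤-trans (x≤∣x∣ x) h) (≤-trans (x≤∣x∣ y) k))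
    (≤-trans (≈⇒≤ (solve 2 (λ x y → :- (x :+ y) := :- x :+ :- y) ≈-refl x y))
      (+-mono-≤ (≤-trans (-x≤∣x∣ x) h) (≤-trans (-x≤∣x∣ y) k)))

  ∣∣-sub : ∀ {x y a b} → ∣ x ∣ ≤ a → ∣ y ∣ ≤ b → ∣ x - y ∣ ≤ a + b
  ∣∣-sub h k = ∣∣-+ h (∣∣-neg k)

  0≤⇒∣x∣≈x : ∀ {x} → 0ℝ ≤ x → ∣ x ∣ ≈ x
  0≤⇒∣x∣≈x {x} h = ≤-antisym (∣x∣-least ≤-refl
    (≤-cert (x + x) (0≤+ h h) (solve 1 (λ x → x := :- x :+ (x :+ x)) ≈-refl x))) (x≤∣x∣ x)

  0≤* : ∀ {x y} → 0ℝ ≤ x → 0ℝ ≤ y → 0ℝ ≤ x * y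
  0≤* {x} {y} h k = ≤-trans (0≤∣x∣ (x * y)) (≈⇒≤
    (≈-trans (∣x*y∣≈∣x∣*∣y∣ x y) (*-cong (0≤⇒∣x∣≈x h) (0≤⇒∣x∣≈x k))))

  *-monoˡ-≤ : ∀ {x y c} → 0ℝ ≤ c → x ≤ y → c * x ≤ c * y
  *-monoˡ-≤ {x} {y} {c} h k = ≤-cert (c * (y - x)) (0≤* h (0≤- k))
    (solve 3 (λ x y c → c :* y := c :* x :+ c :* (y :- x)) ≈-refl x y c)

  *-monoʳ-≤ : ∀ {x y c} → 0ℝ ≤ c → x ≤ y → x * c ≤ y * c
  *-monoʳ-≤ {x} {y} {c} h k = ≤-resp (*-comm c x) (*-comm c y) (*-monoˡ-≤ h k)

  *-mono-≤ : ∀ {x y u v} → 0ℝ ≤ x → 0ℝ ≤ v → x ≤ y → u ≤ v → x * u ≤ y * v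
  *-mono-≤ h k p q = ≤-trans (*-monoˡ-≤ h q) (*-monoʳ-≤ k p)

  ∣∣-* : ∀ {x y a b} → ∣ x ∣ ≤ a → ∣ y ∣ ≤ b → ∣ x * y ∣ ≤ a * b
  ∣∣-* {x} {y} h k = ≤-trans (≈⇒≤ (∣x*y∣≈∣x∣*∣y∣ x y))
    (*-mono-≤ (0≤∣x∣ x) (≤-trans (0≤∣x∣ y) k) h k)

  ∣x∣*∣x∣≈x*x : ∀ x → ∣ x ∣ * ∣ x ∣ ≈ x * x
  ∣x∣*∣x∣≈x*x x = ≈-trans (≈-sym (∣x*y∣≈∣x∣*∣y∣ x x)) (0≤⇒∣x∣≈x (0≤x*x x))

  ∣∣-square : ∀ {x a} → ∣ x ∣ ≤ a → x * x ≤ a * a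
  ∣∣-square {x} h = ≤-trans (≈⇒≤ (≈-sym (∣x∣*∣x∣≈x*x x)))
    (*-mono-≤ (0≤∣x∣ x) (≤-trans (0≤∣x∣ x) h) h h)

  0<* : ∀ {x y} → 0ℝ < x → 0ℝ < y → 0ℝ < x * y
  0<* h k =
    let ε , ε>0 , p = 0<⇒rational h
        δ , δ>0 , q = 0<⇒rational k in
    <-≤-trans
    (fromℚ-pos (ε ℚ.* δ) {{ℚ.pos*pos⇒pos ε {{ε>0}} δ {{δ>0}}}})
    (≤-trans (≈⇒≤ (fromℚ-* ε δ)) (*-mono-≤ (fromℚ-mono (Q.0≤pos ε {{ε>0}})) (<⇒≤ k) p q))

  recip : ∀ x → 0ℝ < x → ∃[ y ] 0ℝ < y × x * y ≈ 1ℝ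
  recip x h = real y , real⁺>0 y , inverse (real⁺ x h)
    where
    y : ℝ⁺
    y = real⁺ x h D.⁻¹

  *-cancel-0≤ : ∀ {c x} → 0ℝ < c → 0ℝ ≤ c * x → 0ℝ ≤ x
  *-cancel-0≤ {c} {x} h k =
    let i , i>0 , e = recip c h in ≤-trans (0≤* (<⇒≤ i>0) k) (≈⇒≤ (≈-trans
    (solve 3 (λ c i x → i :* (c :* x) := (c :* i) :* x) ≈-refl c i x)
    (≈-trans (*-congʳ x e) (*-identityˡ x))))

  *-cancel-≤ : ∀ {c x y} → 0ℝ < c → c * x ≤ c * y → x ≤ y
  *-cancel-≤ {c} {x} {y} h k = 0≤-⁻ (*-cancel-0≤ h (≤-trans (0≤- k)
    (≈⇒≤ (solve 3 (λ c x y → c :* y :- c :* x := c :* (y :- x)) ≈-refl c x y))))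

  *-cancel-≈ : ∀ {c x y} → 0ℝ < c → c * x ≈ c * y → x ≈ y
  *-cancel-≈ h k = ≤-antisym (*-cancel-≤ h (≈⇒≤ k)) (*-cancel-≤ h (≈⇒≤ (≈-sym k)))

  -- With a rational bound `B` of the inverse `y`, the relation 1 = x y ≤ x B gives the explicit
  -- lower bound 1/B of `x`.
  ≥0-invertible⇒>0 : ∀ {x y} → 0ℝ ≤ x → x * y ≈ 1ℝ → 0ℝ < x
  ≥0-invertible⇒>0 {x} {y} h e = <-≤-trans (fromℚ-pos i {{Q.inv-pos B B>0}})
    (*-cancel-≤ (fromℚ-pos B {{B>0}}) (begin
      fromℚ B * fromℚ i    ≈⟨ fromℚ-* B i ⟨
      fromℚ (B ℚ.* i)      ≈⟨ ≡⇒≈ (cong fromℚ (trans (ℚ.*-comm B i) (Q.inv-*ˡ B B>0))) ⟩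
      1ℝ                   ≈⟨ e ⟨
      x * y                ≤⟨ *-monoˡ-≤ h (≤-trans (x≤∣x∣ y) (proj₂ (proj₂ (rational-bound y)))) ⟩
      x * fromℚ B          ≈⟨ *-comm x (fromℚ B) ⟩
      fromℚ B * x          ∎))
    where
    open ≤-R
    B : ℚ
    B = proj₁ (rational-bound y)
    B>0 : Positive B
    B>0 = proj₁ (proj₂ (rational-bound y))
    i : ℚ
    i = Q.inv B B>0

  x-y≈0⇒x≈y : ∀ {x y} → x - y ≈ 0ℝ → x ≈ y
  x-y≈0⇒x≈y {x} {y} h = ≈-trans (solve 2 (λ x y → x := (x :- y) :+ y) ≈-refl x y)
    (≈-trans (+-cong h ≈-refl) (+-identityˡ y))

  ∣x∣≤0⇒x≈0 : ∀ {x} → ∣ x ∣ ≤ 0ℝ → x ≈ 0ℝ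
  ∣x∣≤0⇒x≈0 {x} h = ≤-antisym (≤-trans (x≤∣x∣ x) h)
    (≤-resp (solve 0 (:- con 0ℚ := con 0ℚ) ≈-refl) (solve 1 (λ x → :- (:- x) := x) ≈-refl x)
      (neg-anti-≤ (≤-trans (-x≤∣x∣ x) h)))

  -- A rational bound of `K` reduces this to `Q.decay`: powers of 1/2 fall below every positive
  -- rational.
  ≤0-squeeze : ∀ {x} K → (∀ n → x ≤ K * fromℚ (Q.pow ½ n)) → x ≤ 0ℝ
  ≤0-squeeze {x} K h = ≤-closed bd
    where
    open ≤-R
    B : ℚ
    B = proj₁ (rational-bound K)
    B>0 : Positive B
    B>0 = proj₁ (proj₂ (rational-bound K))
    bd : ∀ ε .{{_ : Positive ε}} → x ≤ 0ℝ + fromℚ ε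
    bd ε = begin
      x                              ≤⟨ h j ⟩
      K * fromℚ (Q.pow ½ j)
        ≤⟨ *-monoʳ-≤ (fromℚ-mono (Q.pow-nonNeg ½ j (ℚ.nonNegative⁻¹ ½)))
                                          (≤-trans (x≤∣x∣ K) (proj₂ (proj₂ (rational-bound K)))) ⟩
      fromℚ B * fromℚ (Q.pow ½ j)    ≈⟨ *-comm _ _ ⟩
      fromℚ (Q.pow ½ j) * fromℚ B    ≈⟨ fromℚ-* (Q.pow ½ j) B ⟨
      fromℚ (Q.pow ½ j ℚ.* B)        ≤⟨ fromℚ-mono (proj₂ dec) ⟩
      fromℚ ε                        ≈⟨ +-identityˡ _ ⟨
      0ℝ + fromℚ ε                   ∎
      where
      dec : ∃[ j ] Q.pow ½ j ℚ.* B ℚ.≤ ε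
      dec = Q.decay ½ B ε {{B>0}} (ℚ.nonNegative⁻¹ ½) _
      j : ℕ
      j = proj₁ dec

  ≈0-squeeze : ∀ {x} K → (∀ n → ∣ x ∣ ≤ K * fromℚ (Q.pow ½ n)) → x ≈ 0ℝ
  ≈0-squeeze K h = ∣x∣≤0⇒x≈0 (≤0-squeeze K h)

  -- Natural numbers as reals and finite sums

  fromℕ : ℕ → ℝ
  fromℕ n = fromℚ (+ n ℚ./ 1)

  fromℕ-suc : ∀ n → fromℕ (suc n) ≈ 1ℝ + fromℕ n
  fromℕ-suc n = ≈-trans (≡⇒≈ (cong fromℚ (Q.fromℕ-suc n))) (fromℚ-+ 1ℚ (+ n ℚ./ 1))

  0≤fromℕ : ∀ n → 0ℝ ≤ fromℕ n
  0≤fromℕ n = fromℚ-mono (Q./-nonNeg n 0)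

  ceiling : ∀ x → ∃[ n ] x ≤ fromℕ n
  ceiling x = let B , _ , h = rational-bound x
                  n , k = Q.≤-ceil B in
    n , ≤-trans (x≤∣x∣ x) (≤-trans h (fromℚ-mono k))

  ∑ : ℕ → (ℕ → ℝ) → ℝ
  ∑ zero    u = 0ℝ
  ∑ (suc n) u = ∑ n u + u n

  opaque
    unfolding _+_

    D0≈0 : D.0ℝ ≈ 0ℝ
    D0≈0 = ≈-refl

    +-def : ∀ x y → x D.+ y ≡ x + y
    +-def x y = refl

    *-def : ∀ x y → x D.* y ≡ x * y
    *-def x y = refl

    neg-def : ∀ x → D.- x ≡ - x
    neg-def x = refl

    sub-def : ∀ x y → x D.- y ≈ x - y
    sub-def x y = ≈-pointwise λ n → refl

    dist-def : ∀ x y → D.∣ x D.- y ∣ ≈ ∣ x - y ∣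
    dist-def x y = ≈-pointwise λ n → refl

  ∑-mono-≤ : ∀ n {u v} → (∀ k → k ℕ.< n → u k ≤ v k) → ∑ n u ≤ ∑ n v
  ∑-mono-≤ zero    h = ≤-refl
  ∑-mono-≤ (suc n) h = +-mono-≤ (∑-mono-≤ n λ k p → h k (ℕ.m≤n⇒m≤1+n p)) (h n ℕ.≤-refl)

  ∑-cong : ∀ n {u v} → (∀ k → k ℕ.< n → u k ≈ v k) → ∑ n u ≈ ∑ n v
  ∑-cong n h = ≤-antisym (∑-mono-≤ n λ k p → ≈⇒≤ (h k p)) (∑-mono-≤ n λ k p → ≈⇒≤ (≈-sym (h k p)))

  ∑-def : ∀ n {u v : ℕ → ℝ} → (∀ k → u k ≈ v k) → D.∑ n u ≈ ∑ n v
  ∑-def zero    h = D0≈0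
  ∑-def (suc n) {u} {v} h = ≈-trans (≡⇒≈ (+-def (D.∑ n u) (u n))) (+-cong (∑-def n h) (h n))

  ∑-scale : ∀ n c u → ∑ n (λ k → c * u k) ≈ c * ∑ n u
  ∑-scale zero    c u = solve 1 (λ c → con 0ℚ := c :* con 0ℚ) ≈-refl c
  ∑-scale (suc n) c u = ≈-trans (+-cong (∑-scale n c u) ≈-refl)
    (≈-sym (*-distribˡ-+ c (∑ n u) (u n)))

  ∑-sub : ∀ n u v → ∑ n (λ k → u k - v k) ≈ ∑ n u - ∑ n v
  ∑-sub zero    u v = solve 0 (con 0ℚ := con 0ℚ :- con 0ℚ) ≈-refl
  ∑-sub (suc n) u v = ≈-trans (+-cong (∑-sub n u v) ≈-refl)
    (solve 4 (λ a b c d → (a :- b) :+ (c :- d) := (a :+ c) :- (b :+ d)) ≈-refl (∑ n u) (∑ n v)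
      (u n) (v n))

  ∑-telescope : ∀ n (f : ℕ → ℝ) → ∑ n (λ k → f (suc k) - f k) ≈ f n - f 0
  ∑-telescope zero    f = solve 1 (λ a → con 0ℚ := a :- a) ≈-refl (f 0)
  ∑-telescope (suc n) f = ≈-trans (+-cong (∑-telescope n f) ≈-refl)
    (solve 3 (λ a b c → (b :- a) :+ (c :- b) := c :- a) ≈-refl (f 0) (f n) (f (suc n)))

  ∑-∣∣-≤ : ∀ n {u c} → (∀ k → k ℕ.< n → ∣ u k ∣ ≤ c) → ∣ ∑ n u ∣ ≤ fromℕ n * c
  ∑-∣∣-≤ zero    {u} {c} h = ∣∣-resp (≈-refl {0ℝ})
    (≤-resp (≈-sym (∣fromℚ∣ 0ℚ)) (solve 1 (λ c → con 0ℚ := con 0ℚ :* c) ≈-refl c) ≤-refl)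
  ∑-∣∣-≤ (suc n) {u} {c} h = ≤-trans (∣∣-+ (∑-∣∣-≤ n λ k p → h k (ℕ.m≤n⇒m≤1+n p)) (h n ℕ.≤-refl))
    (≈⇒≤ (≈-trans (solve 2 (λ n c → n :* c :+ c := (con 1ℚ :+ n) :* c) ≈-refl (fromℕ n) c)
      (*-congʳ c (≈-sym (fromℕ-suc n)))))

  0≤∑ : ∀ n {u} → (∀ k → k ℕ.< n → 0ℝ ≤ u k) → 0ℝ ≤ ∑ n u
  0≤∑ zero    h = ≤-refl
  0≤∑ (suc n) h = 0≤+ (0≤∑ n λ k p → h k (ℕ.m≤n⇒m≤1+n p)) (h n ℕ.≤-refl)

  ∑-split : ∀ n m u → ∑ (n ℕ.+ m) u ≈ ∑ m u + ∑ n (λ k → u (k ℕ.+ m))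
  ∑-split zero    m u = solve 1 (λ a → a := a :+ con 0ℚ) ≈-refl (∑ m u)
  ∑-split (suc n) m u = ≈-trans (+-cong (∑-split n m u) ≈-refl) (+-assoc _ _ _)

  -- The exponential function

  opaque
    exp : ℝ → ℝ
    exp = D.exp

  expTerm-seq : ∀ k x n → seq (D.expTerm x k) n ≡ ExpSeries.T k (seq x n)
  expTerm-seq zero    x n = refl
  expTerm-seq (suc k) x n = cong (λ t → t ℚ.* (seq x n ℚ.* ExpSeries.recip k)) (expTerm-seq k x n)

  opaque
    unfolding exp

    exp-seq : ∀ x n → seq (exp x) n ≡ ExpSeries.E n (seq x n)
    exp-seq x n = go n
      where
      go : ∀ k → seq (D.∑ k (D.expTerm x)) n ≡ ExpSeries.E k (seq x n)
      go zero    = refl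
      go (suc k) = cong₂ ℚ._+_ (go k) (expTerm-seq k x n)

  opaque
    unfolding _+_

    -- The `1ℚ` is the error that `≤` allows in the approximating terms; it is the origin of `B + 1`
    -- in all constants for `exp`.
    bounded-by : ∀ {x B} → ∣ x ∣ ≤ fromℚ B → Eventually (λ n → ℚ.∣ seq x n ∣ ℚ.≤ B ℚ.+ 1ℚ)
    bounded-by h = ≤-elim h 1ℚ

    exp-bounded : ∀ B x → ∣ x ∣ ≤ fromℚ B → ∣ exp x ∣ ≤ exp (fromℚ (B ℚ.+ 1ℚ))
    exp-bounded B x h = ≤-eventually (ev-map (λ n k →
      subst₂ (λ a b → ℚ.∣ a ∣ ℚ.≤ b) (sym (exp-seq x n)) (sym (exp-seq (fromℚ (B ℚ.+ 1ℚ)) n))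
        (ExpSeries.E-abs n k)) (bounded-by {x} {B} h))

    -- The sequence representing `exp (fromℚ r)` is `E n r` itself, so its Cauchy property controls
    -- consecutive partial sums.
    exp-tail : ∀ r η .{{_ : Positive η}} → Eventually (λ n →
      ℚ.∣ ExpSeries.E (2 ℕ.+ n) r ℚ.- ExpSeries.E (1 ℕ.+ n) r ∣ ℚ.≤ η)
    exp-tail r η = N , λ n N≤n → bd n N≤n
      where
      N : ℕ
      N = proj₁ (cauchy (exp (fromℚ r)) η)
      bd : ∀ n → N ℕ.≤ n → ℚ.∣ ExpSeries.E (2 ℕ.+ n) r ℚ.- ExpSeries.E (1 ℕ.+ n) r ∣ ℚ.≤ η
      bd n N≤n = subst₂ (λ a b → ℚ.∣ a ℚ.- b ∣ ℚ.≤ η) (exp-seq (fromℚ r) (2 ℕ.+ n))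
        (exp-seq (fromℚ r) (1 ℕ.+ n))
        (proj₂ (cauchy (exp (fromℚ r)) η) (2 ℕ.+ n) (1 ℕ.+ n) (ℕ.m≤n⇒m≤1+n (ℕ.m≤n⇒m≤1+n N≤n))
          (ℕ.m≤n⇒m≤1+n N≤n))

  ev-shift : ∀ {P : ℕ → Set} k → Eventually (λ n → P (k ℕ.+ n)) → Eventually P
  ev-shift {P} k (N , h) = k ℕ.+ N , λ n p →
    subst P (ℕ.m+[n∸m]≡n (ℕ.≤-trans (ℕ.m≤m+n k N) p))
      (h (n ℕ.∸ k) (ℕ.≤-trans (ℕ.≤-reflexive (sym (ℕ.m+n∸m≡n k N))) (ℕ.∸-monoˡ-≤ k p)))

  ev-unshift : ∀ {P : ℕ → Set} k → Eventually P → Eventually (λ n → P (k ℕ.+ n))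
  ev-unshift k (N , h) = N , λ n p → h (k ℕ.+ n) (ℕ.≤-trans p (ℕ.m≤n+m n k))

  opaque
    unfolding _+_

    -- The second-order Taylor estimate holds for the partial sums up to the
    -- difference of two consecutive ones, which tends to zero.
    exp-estimate : ∀ B → Positive B → ∀ x y → ∣ x ∣ ≤ fromℚ B → ∣ y ∣ ≤ fromℚ B →
      ∣ (exp y - exp x) - (y - x) * exp x ∣ ≤ exp (fromℚ (B ℚ.+ 1ℚ)) * ((y - x) * (y - x))
    exp-estimate B B>0 x y h g = ≤-intro λ ε → ev-shift 2 (ev-map₂ (λ n (a , b) t → step ε n a b t)
        (ev-both (ev-unshift 2 (bounded-by {y} {B} g)) (ev-unshift 2 (bounded-by {x} {B} h)))
        (exp-tail r (η ε) {{η>0 ε}}))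
      where
      open ExpSeries
      r : ℚ
      r = B ℚ.+ 1ℚ
      r>0 : Positive r
      r>0 = ℚ.pos+pos⇒pos B {{B>0}} 1ℚ
      2r>0 : Positive (r ℚ.+ r)
      2r>0 = ℚ.pos+pos⇒pos r {{r>0}} r {{r>0}}
      η : ∀ ε .{{_ : Positive ε}} → ℚ
      η ε = Q.inv (r ℚ.+ r) 2r>0 ℚ.* ε
      η>0 : ∀ ε .{{_ : Positive ε}} → Positive (η ε)
      η>0 ε = ℚ.pos*pos⇒pos (Q.inv (r ℚ.+ r) 2r>0) {{Q.inv-pos (r ℚ.+ r) 2r>0}} ε
      total : ∀ ε .{{_ : Positive ε}} → (r ℚ.+ r) ℚ.* η ε ≡ ε
      total ε = trans (sym (ℚ.*-assoc (r ℚ.+ r) i ε)) (trans (cong (ℚ._* ε)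
        (trans (ℚ.*-comm (r ℚ.+ r) i) (Q.inv-*ˡ (r ℚ.+ r) 2r>0))) (ℚ.*-identityˡ ε))
        where
        i : ℚ
        i = Q.inv (r ℚ.+ r) 2r>0
      step : ∀ ε .{{_ : Positive ε}} n →
        ℚ.∣ seq y (2 ℕ.+ n) ∣ ℚ.≤ r → ℚ.∣ seq x (2 ℕ.+ n) ∣ ℚ.≤ r →
        ℚ.∣ E (2 ℕ.+ n) r ℚ.- E (1 ℕ.+ n) r ∣ ℚ.≤ η ε →
        ℚ.∣ (seq (exp y) (2 ℕ.+ n) ℚ.- seq (exp x) (2 ℕ.+ n)) ℚ.-
          (seq y (2 ℕ.+ n) ℚ.- seq x (2 ℕ.+ n)) ℚ.* seq (exp x) (2 ℕ.+ n) ∣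
        ℚ.≤ seq (exp (fromℚ r)) (2 ℕ.+ n) ℚ.* ((seq y (2 ℕ.+ n) ℚ.- seq x (2 ℕ.+ n)) ℚ.*
          (seq y (2 ℕ.+ n) ℚ.- seq x (2 ℕ.+ n))) ℚ.+ ε
      step ε n a b t = subst₂ ℚ._≤_
        (sym (cong₂ (λ u v → ℚ.∣ (u ℚ.- v) ℚ.- (w ℚ.- z) ℚ.* v ∣) (exp-seq y (2 ℕ.+ n))
          (exp-seq x (2 ℕ.+ n))))
        (cong₂ (λ u v → u ℚ.* square (w ℚ.- z) ℚ.+ v) (sym (exp-seq (fromℚ r) (2 ℕ.+ n))) (total ε))
        (ℚ.≤-trans (E-estimate n w z (Q.0≤pos r {{r>0}}) a b)
          (ℚ.+-monoʳ-≤ (E (2 ℕ.+ n) r ℚ.* square (w ℚ.- z))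
            (ℚ.*-monoˡ-≤-nonNeg (r ℚ.+ r) {{ℚ.pos⇒nonNeg (r ℚ.+ r) {{2r>0}}}} t)))
        where
        w z : ℚ
        w = seq y (2 ℕ.+ n)
        z = seq x (2 ℕ.+ n)

    exp-0 : exp 0ℝ ≈ 1ℝ
    exp-0 = ≤-antisym
      (≤-eventually {exp 0ℝ} {1ℝ} (ev-shift 1 (always λ n →
        ℚ.≤-reflexive (trans (exp-seq 0ℝ (suc n)) (ExpSeries.E-zero n)))))
      (≤-eventually {1ℝ} {exp 0ℝ} (ev-shift 1 (always λ n →
        ℚ.≤-reflexive (sym (trans (exp-seq 0ℝ (suc n)) (ExpSeries.E-zero n))))))

  ½ℝ : ℝ
  ½ℝ = fromℚ ½

  pow½-suc : ∀ n → fromℚ (Q.pow ½ (suc n)) ≈ ½ℝ * fromℚ (Q.pow ½ n)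
  pow½-suc n = fromℚ-* ½ (Q.pow ½ n)

  -- Halving an interval halves the bound for the increment over it.
  quadratic⇒constant : (D : ℝ → Set) → (∀ s t → D s → D t → D ((s + t) * ½ℝ)) → (φ : ℝ → ℝ) → ∀ K →
    (∀ s t → D s → D t → ∣ φ t - φ s ∣ ≤ K * ((t - s) * (t - s))) →
    ∀ s t → D s → D t → φ t ≈ φ s
  quadratic⇒constant D mid φ K h s t Ds Dt = x-y≈0⇒x≈y (≈0-squeeze (K * ((t - s) * (t - s))) λ n →
      ≤-trans (iterate n s t Ds Dt)
        (≈⇒≤ (solve 3 (λ K p d → K :* p :* d := K :* d :* p) ≈-refl K (fromℚ (Q.pow ½ n))
        ((t - s) * (t - s)))))
    where
    iterate : ∀ n s t → D s → D t → ∣ φ t - φ s ∣ ≤ K * fromℚ (Q.pow ½ n) * ((t - s) * (t - s))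
    iterate zero    s t Ds Dt = ≤-trans (h s t Ds Dt)
      (≈⇒≤ (solve 2 (λ K d → K :* d := K :* con 1ℚ :* d) ≈-refl K _))
    iterate (suc n) s t Ds Dt = ∣∣-resp
      (solve 3 (λ a b c → (c :- b) :+ (b :- a) := c :- a) ≈-refl (φ s) (φ m) (φ t))
      (≤-trans (∣∣-+ (iterate n m t (mid s t Ds Dt) Dt) (iterate n s m Ds (mid s t Ds Dt)))
        (≈⇒≤ (≈-trans (solve 4 (λ K p s t →
            K :* p :* ((t :- (s :+ t) :* con ½) :* (t :- (s :+ t) :* con ½)) :+
            K :* p :* (((s :+ t) :* con ½ :- s) :* ((s :+ t) :* con ½ :- s)) :=
            K :* (con ½ :* p) :* ((t :- s) :* (t :- s))) ≈-refl K (fromℚ (Q.pow ½ n)) s t)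
          (*-congʳ _ (*-congˡ K (≈-sym (pow½-suc n)))))))
      where
      m : ℝ
      m = (s + t) * ½ℝ

  0≤½ℝ : 0ℝ ≤ ½ℝ
  0≤½ℝ = fromℚ-mono (ℚ.nonNegative⁻¹ ½)

  ∣∣≤-mid : ∀ {s t b} → ∣ s ∣ ≤ b → ∣ t ∣ ≤ b → ∣ (s + t) * ½ℝ ∣ ≤ b
  ∣∣≤-mid {b = b} h k = ≤-trans (∣∣-* (∣∣-+ h k) (≈⇒≤ (0≤⇒∣x∣≈x 0≤½ℝ)))
    (≈⇒≤ (solve 1 (λ b → (b :+ b) :* con ½ := b) ≈-refl b))

  -- In `exp-estimate` both the linear term and the bound carry a factor y - x, hence vanish when x
  -- ≈ y.
  exp-cong : ∀ {x y} → x ≈ y → exp x ≈ exp y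
  exp-cong {x} {y} h = ≈-sym (x-y≈0⇒x≈y (∣x∣≤0⇒x≈0 (∣∣-resp
      (≈-trans (sub-cong ≈-refl (*-congʳ (exp x) y-x≈0)) (solve 2 (λ d e → d :- con 0ℚ :* e := d)
        ≈-refl (exp y - exp x) (exp x)))
      (≤-trans (exp-estimate B (proj₁ (proj₂ b)) x y (proj₂ (proj₂ b))
        (∣∣-resp h (proj₂ (proj₂ b))))
        (≈⇒≤ (≈-trans (*-congˡ _ (*-cong y-x≈0 y-x≈0)) (solve 1 (λ c → c :* (con 0ℚ :* con 0ℚ) :=
          con 0ℚ) ≈-refl (exp (fromℚ (B ℚ.+ 1ℚ))))))))))
    where
    b = rational-bound x
    B : ℚ
    B = proj₁ b
    y-x≈0 : y - x ≈ 0ℝ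
    y-x≈0 = ≈-trans (sub-cong (≈-sym h) ≈-refl) (+-inverseʳ x)

  module _ (x y : ℝ) where
    private
      c : ℝ
      c = x + y
      bx = rational-bound x
      by = rational-bound y
      B : ℚ
      B = proj₁ bx ℚ.+ proj₁ by
      B>0 : Positive B
      B>0 = ℚ.pos+pos⇒pos (proj₁ bx) {{proj₁ (proj₂ bx)}} (proj₁ by) {{proj₁ (proj₂ by)}}
      C b : ℝ
      C = exp (fromℚ (B ℚ.+ 1ℚ))
      b = fromℚ B
      0≤b : 0ℝ ≤ b
      0≤b = fromℚ-mono (Q.0≤pos B {{B>0}})

      -- Both arguments s and c - s must stay bounded by `b`, so that the same constant `C` serves
      -- both factors of `φ`.
      Dom : ℝ → Set
      Dom s = (∣ s ∣ ≤ b) × (∣ c - s ∣ ≤ b)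

      mid : ∀ s t → Dom s → Dom t → Dom ((s + t) * ½ℝ)
      mid s t (p , q) (p′ , q′) = ∣∣≤-mid p p′ , ∣∣-resp
        (solve 3 (λ c s t → ((c :- s) :+ (c :- t)) :* con ½ := c :- (s :+ t) :* con ½) ≈-refl c s t)
        (∣∣≤-mid q q′)

      -- The derivative of exp s · exp (c - s) is zero; comparing its values at s = 0 and s = x
      -- gives the addition theorem.
      φ : ℝ → ℝ
      φ s = exp s * exp (c - s)

      K : ℝ
      K = C * C + (C * (C + (b + b) * C) + C * C)

      φ-increment : ∀ s t → Dom s → Dom t → ∣ φ t - φ s ∣ ≤ K * ((t - s) * (t - s))
      φ-increment s t (p , q) (p′ , q′) = ∣∣-resp
        -- The first-order terms h u v and -h u v cancel. What is left is -h² u v and two products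
        -- containing a remainder of `exp-estimate`; bounding the three summands gives the constant
        -- `K`.
        (solve 5 (λ h u u′ v v′ → (:- (h :* h)) :* (u :* v) :+
          (((u′ :- u) :- h :* u) :* (v :- h :* v) :+ u′ :* ((v′ :- v) :- (:- h) :* v))
          := u′ :* v′ :- u :* v) ≈-refl (t - s) (exp s) (exp t) (exp (c - s)) (exp (c - t)))
        (≤-trans (∣∣-+ (∣∣-* (∣∣-neg (≈⇒≤ (0≤⇒∣x∣≈x (0≤x*x (t - s)))))
          (∣∣-* (exp-bounded B s p) (exp-bounded B (c - s) q)))
                  (∣∣-+ (∣∣-* (exp-estimate B B>0 s t p p′) (∣∣-sub (exp-bounded B (c - s) q)
                    (∣∣-* (∣∣-sub p′ p) (exp-bounded B (c - s) q))))
                        (∣∣-* (exp-bounded B t p′) R₂)))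
          (≈⇒≤ (solve 3 (λ C b d → d :* (C :* C) :+ ((C :* d) :* (C :+ (b :+ b) :* C) :+ C :*
            (C :* d)) :=
                 (C :* C :+ (C :* (C :+ (b :+ b) :* C) :+ C :* C)) :* d) ≈-refl C b
                   ((t - s) * (t - s)))))
        where
        R₂ : ∣ (exp (c - t) - exp (c - s)) - (- (t - s)) * exp (c - s) ∣ ≤ C * ((t - s) * (t - s))
        R₂ = ∣∣-resp (sub-cong ≈-refl
          (*-congʳ _ (solve 3 (λ c s t → (c :- t) :- (c :- s) := :- (t :- s)) ≈-refl c s t)))
          (≤-trans (exp-estimate B B>0 (c - s) (c - t) q q′)
            (≈⇒≤ (*-congˡ C (solve 3 (λ c s t → ((c :- t) :- (c :- s)) :* ((c :- t) :- (c :- s)) :=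
              (t :- s) :* (t :- s)) ≈-refl c s t))))

      ∣x∣≤b : ∣ x ∣ ≤ b
      ∣x∣≤b = ≤-trans (proj₂ (proj₂ bx))
        (≤-cert (fromℚ (proj₁ by)) (fromℚ-mono (Q.0≤pos (proj₁ by) {{proj₁ (proj₂ by)}}))
        (fromℚ-+ _ _))

      ∣y∣≤b : ∣ y ∣ ≤ b
      ∣y∣≤b = ≤-trans (proj₂ (proj₂ by))
        (≤-cert (fromℚ (proj₁ bx)) (fromℚ-mono (Q.0≤pos (proj₁ bx) {{proj₁ (proj₂ bx)}}))
        (≈-trans (fromℚ-+ _ _) (+-comm _ _)))

      ∣c∣≤b : ∣ c ∣ ≤ b
      ∣c∣≤b = ≤-trans (∣∣-+ (proj₂ (proj₂ bx)) (proj₂ (proj₂ by))) (≈⇒≤ (≈-sym (fromℚ-+ _ _)))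

      ∣0∣≤b : ∣ 0ℝ ∣ ≤ b
      ∣0∣≤b = ≤-trans (≈⇒≤ (0≤⇒∣x∣≈x ≤-refl)) 0≤b

    exp-+ : exp (x + y) ≈ exp x * exp y
    exp-+ = begin-equality
      exp (x + y)           ≈⟨ exp-cong (solve 1 (λ c → c := c :- con 0ℚ) ≈-refl c) ⟩
      exp (c - 0ℝ)          ≈⟨ *-identityˡ _ ⟨
      1ℝ * exp (c - 0ℝ)     ≈⟨ *-congʳ _ exp-0 ⟨
      exp 0ℝ * exp (c - 0ℝ) ≈⟨ quadratic⇒constant Dom mid φ K φ-increment x 0ℝ
                                 (∣x∣≤b , ∣∣-resp (solve 2 (λ x y → y := (x :+ y) :- x) ≈-refl x y)
                                   ∣y∣≤b)
                                 (∣0∣≤b , ∣∣-resp (solve 1 (λ c → c := c :- con 0ℚ) ≈-refl c)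
                                   ∣c∣≤b) ⟩
      exp x * exp (c - x)   ≈⟨ *-congˡ _
        (exp-cong (solve 2 (λ x y → (x :+ y) :- x := y) ≈-refl x y)) ⟩
      exp x * exp y         ∎
      where open ≤-R

  exp-inverse : ∀ x → exp x * exp (- x) ≈ 1ℝ
  exp-inverse x = ≈-trans (≈-sym (exp-+ x (- x))) (≈-trans (exp-cong (+-inverseʳ x)) exp-0)

  exp-halves : ∀ x → exp x ≈ exp (x * ½ℝ) * exp (x * ½ℝ)
  exp-halves x = ≈-trans (exp-cong (solve 1 (λ x → x := x :* con ½ :+ x :* con ½) ≈-refl x))
    (exp-+ _ _)

  opaque
    -- Nonnegative as the square of exp (x/2), and invertible with inverse exp (-x).
    0<exp : ∀ x → 0ℝ < exp x
    0<exp x = ≥0-invertible⇒>0 (≤-trans (0≤x*x _) (≈⇒≤ (≈-sym (exp-halves x)))) (exp-inverse x)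

  -- If 1 + h/2 - δ ≤ e for e = exp (h/2), then exp h = e² ≥ 2e - 1 ≥ 1 + h - 2δ;
  -- since the error is quadratic in h, halving h gains a factor 2.
  1+x≤exp : ∀ x → 1ℝ + x ≤ exp x
  1+x≤exp x = 0≤-⁻ (≤-resp (solve 0 (:- con 0ℚ := con 0ℚ) ≈-refl) (solve 1 (λ y → :- (:- y) := y)
    ≈-refl _)
      (neg-anti-≤ (≤0-squeeze (C * (x * x)) λ n → ≤-cert _ (0≤- (iterate n x ∣x∣≤b))
        (solve 5 (λ x e C d p → C :* d :* p :=
          (:- (e :- (con 1ℚ :+ x))) :+ (e :- ((con 1ℚ :+ x) :- C :* p :* d)))
          ≈-refl x (exp x) C (x * x) (fromℚ (Q.pow ½ n))))))
    where
    B : ℚ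
    B = proj₁ (rational-bound x)
    B>0 : Positive B
    B>0 = proj₁ (proj₂ (rational-bound x))
    ∣x∣≤b : ∣ x ∣ ≤ fromℚ B
    ∣x∣≤b = proj₂ (proj₂ (rational-bound x))
    C : ℝ
    C = exp (fromℚ (B ℚ.+ 1ℚ))
    ∣0∣≤b : ∣ 0ℝ ∣ ≤ fromℚ B
    ∣0∣≤b = ≤-trans (≈⇒≤ (0≤⇒∣x∣≈x ≤-refl)) (fromℚ-mono (Q.0≤pos B {{B>0}}))
    iterate : ∀ n h → ∣ h ∣ ≤ fromℚ B → (1ℝ + h) - C * fromℚ (Q.pow ½ n) * (h * h) ≤ exp h
    iterate zero h k = ≤-cert _ (0≤- est)
      (≈-trans (solve 4 (λ e₀ e h C → e := ((e₀ :+ h :* e₀) :- C :* con 1ℚ :* (h :* h)) :+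
        (C :* ((h :- con 0ℚ) :* (h :- con 0ℚ)) :- (:- ((e :- e₀) :- (h :- con 0ℚ) :* e₀)))) ≈-refl
        (exp 0ℝ) (exp h) h C)
        (+-cong (sub-cong (+-cong exp-0
          (≈-trans (*-congˡ h exp-0) (solve 1 (λ h → h :* con 1ℚ := h) ≈-refl h))) ≈-refl) ≈-refl))
      where
      est : - ((exp h - exp 0ℝ) - (h - 0ℝ) * exp 0ℝ) ≤ C * ((h - 0ℝ) * (h - 0ℝ))
      est = ≤-trans (-x≤∣x∣ _) (exp-estimate B B>0 0ℝ h ∣0∣≤b k)
    iterate (suc n) h k = ≤-trans (≤-cert (a + a + a′) (0≤+ (0≤+ 0≤a 0≤a) (0≤x*x (e - 1ℝ)))
        (≈-trans (solve 4 (λ e h C p → e :* e :=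
          ((con 1ℚ :+ h) :- C :* (con ½ :* p) :* (h :* h)) :+
          (((e :- ((con 1ℚ :+ h :* con ½) :- C :* p :* ((h :* con ½) :* (h :* con ½)))) :+
            (e :- ((con 1ℚ :+ h :* con ½) :- C :* p :* ((h :* con ½) :* (h :* con ½))))) :+
              (e :- con 1ℚ) :* (e :- con 1ℚ)))
          ≈-refl e h C (fromℚ (Q.pow ½ n)))
         (+-cong (sub-cong ≈-refl (*-congʳ _ (*-congˡ C (≈-sym (pow½-suc n))))) ≈-refl)))
      (≈⇒≤ (≈-sym (exp-halves h)))
      where
      e a a′ : ℝ
      e = exp (h * ½ℝ)
      a = e - ((1ℝ + h * ½ℝ) - C * fromℚ (Q.pow ½ n) * ((h * ½ℝ) * (h * ½ℝ)))
      a′ = (e - 1ℝ) * (e - 1ℝ)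
      0≤a : 0ℝ ≤ a
      0≤a = 0≤- (iterate n (h * ½ℝ) (∣∣-resp (solve 1 (λ h → (h :+ con 0ℚ) :* con ½ := h :* con ½)
        ≈-refl h) (∣∣≤-mid k ∣0∣≤b)))

  exp-mono-≤ : ∀ {x y} → x ≤ y → exp x ≤ exp y
  exp-mono-≤ {x} {y} h = ≤-trans
    (≤-cert (exp x * ((exp (y - x) - (1ℝ + (y - x))) + (y - x)))
      (0≤* (<⇒≤ (0<exp x)) (0≤+ (0≤- (1+x≤exp (y - x))) (0≤- h)))
      (solve 4 (λ e f x y → e :* f := e :+ e :* ((f :- (con 1ℚ :+ (y :- x))) :+ (y :- x)))
        ≈-refl (exp x) (exp (y - x)) x y))
    (≈⇒≤ (≈-trans (≈-sym (exp-+ x (y - x)))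
      (exp-cong (solve 2 (λ x y → x :+ (y :- x) := y) ≈-refl x y))))

  -- The logarithm

  opaque
    log : ℝ⁺ → ℝ
    log = D.log

  ^-seq : ∀ x k n → seq (x D.^ k) n ≡ Q.pow (seq x n) k
  ^-seq x zero    n = refl
  ^-seq x (suc k) n = cong (seq x n ℚ.*_) (^-seq x k n)

  opaque
    unfolding log

    log-seq : ∀ t n → seq (log t) n ≡ LogSeries.A n (seq (D.mobius t) n)
    log-seq t n = go n
      where
      go : ∀ k → seq (D.∑ k (D.logTerm t)) n ≡ LogSeries.A k (seq (D.mobius t) n)
      go zero    = refl
      go (suc k) = cong₂ (λ a b → a ℚ.+ b ℚ.* LogSeries.coeff (k ℕ.* 2)) (go k)
        (^-seq (D.mobius t) (suc (k ℕ.* 2)) n)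

  2ℝ 4ℝ : ℝ
  2ℝ = fromℚ (1ℚ ℚ.+ 1ℚ)
  4ℝ = fromℚ ((1ℚ ℚ.+ 1ℚ) ℚ.* (1ℚ ℚ.+ 1ℚ))

  -- (1 - z²) d(log t) = 2 dz for z = mobius t, up to a second-order error.
  opaque
    unfolding _+_

    log-mobius-estimate : ∀ r → 0ℚ ℚ.≤ r → Positive (1ℚ ℚ.- r) → ∃[ c ] ∀ t u →
      Eventually (λ n → ℚ.∣ seq (D.mobius t) n ∣ ℚ.≤ r) →
        Eventually (λ n → ℚ.∣ seq (D.mobius u) n ∣ ℚ.≤ r) →
      ∣ (1ℝ - D.mobius t * D.mobius t) * (log u - log t) - 2ℝ * (D.mobius u - D.mobius t) ∣ ≤
      fromℚ c * ((D.mobius u - D.mobius t) * (D.mobius u - D.mobius t))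
    log-mobius-estimate r 0≤r s>0 = c , λ t u h g → ≤-intro λ ε →
      ev-map₂ (λ n (a , b) p → step t u ε n a b p) (ev-both h g) (LogSeries.pow-vanishes r 0≤r s>0
        ε)
      where
      2ℚ c : ℚ
      2ℚ = 1ℚ ℚ.+ 1ℚ
      c = (2ℚ ℚ.* 2ℚ) ℚ.* LogSeries.κ r 0≤r s>0
      step : ∀ t u ε .{{_ : Positive ε}} n → let z = seq (D.mobius t) n; w = seq (D.mobius u) n in
        ℚ.∣ z ∣ ℚ.≤ r → ℚ.∣ w ∣ ℚ.≤ r → (2ℚ ℚ.* 2ℚ) ℚ.* Q.pow r (n ℕ.* 2) ℚ.≤ ε →
        ℚ.∣ (1ℚ ℚ.- z ℚ.* z) ℚ.* (seq (log u) n ℚ.- seq (log t) n) ℚ.- 2ℚ ℚ.* (w ℚ.- z) ∣ ℚ.≤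
        c ℚ.* ((w ℚ.- z) ℚ.* (w ℚ.- z)) ℚ.+ ε
      step t u ε n a b p = subst₂ (λ x y → ℚ.∣ (1ℚ ℚ.- z ℚ.* z) ℚ.* (x ℚ.- y) ℚ.- 2ℚ ℚ.* (w ℚ.- z)
        ∣ ℚ.≤ c ℚ.* ((w ℚ.- z) ℚ.* (w ℚ.- z)) ℚ.+ ε)
        (sym (log-seq u n)) (sym (log-seq t n))
        (ℚ.≤-trans (LogSeries.A-estimate r 0≤r s>0 n w z b a)
          (ℚ.+-monoʳ-≤ (c ℚ.* ((w ℚ.- z) ℚ.* (w ℚ.- z))) p))
        where
        z w : ℚ
        z = seq (D.mobius t) n
        w = seq (D.mobius u) n

    mobius-def : ∀ t → D.mobius t ≈ (real t - 1ℝ) * real ((t D.+⁺ D.1⁺) D.⁻¹)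
    mobius-def t = ≈-pointwise λ n → refl

    real-+⁺ : ∀ t u → real (t D.+⁺ u) ≡ real t + real u
    real-+⁺ t u = refl

    real-1⁺ : real D.1⁺ ≡ 1ℝ
    real-1⁺ = refl

    -- Bounds `ε` and `B` for the real `t` hold for its terms only up to an error, hence the larger
    -- interval from ε/2 to B + 1.
    mobius-bounded : ∀ ε B r → Positive ε → LogSeries.MobiusBelow (ε ℚ.* ½) (B ℚ.+ 1ℚ) r → ∀ t →
      fromℚ ε ≤ real t → real t ≤ fromℚ B → Eventually (λ n → ℚ.∣ seq (D.mobius t) n ∣ ℚ.≤ r)
    mobius-bounded ε B r ε>0 bd t h g = ev-map₂ (λ n (a , b) (c , d) →
        bd (seq (real t) n) (seq (real ((t D.+⁺ D.1⁺) D.⁻¹)) n)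
          (ℚLemmas.cancel-half (seq (real t) n) ε a) b c d)
      (ev-both (≤-elim h (ε ℚ.* ½) {{half>0 ε {{ε>0}}}}) (≤-elim g 1ℚ)) (D.⁻¹-inverse (t D.+⁺ D.1⁺))

    log-1⁺ : log D.1⁺ ≈ 0ℝ
    log-1⁺ = ≈-pointwise λ n → trans (log-seq D.1⁺ n)
      (trans (cong (LogSeries.A n) (ℚ.*-zeroˡ (seq (real ((D.1⁺ D.+⁺ D.1⁺) D.⁻¹)) n)))
        (LogSeries.A-zero n))

  -- Put z = `mobius t`, w = `mobius u` and multiply `log-mobius-estimate` by (t + 1)²/4. Since 1 -
  -- z² = 4t/(t + 1)² and w - z = 2(u - t)/((t + 1)(u + 1)), this compares t (log u - log t) with (u
  -- - t)(t + 1)/(u + 1), which differs from u - t by (u - t)²/(u + 1).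
  log-estimate : ∀ ε B → Positive ε → Positive B → ∃[ K ] ∀ t u →
    fromℚ ε ≤ real t → real t ≤ fromℚ B → fromℚ ε ≤ real u → real u ≤ fromℚ B →
    ∣ real t * (log u - log t) - (real u - real t) ∣ ≤ K * ((real u - real t) * (real u - real t))
  log-estimate ε B ε>0 B>0 = K , est
    where
    mb = LogSeries.mobius-below (ε ℚ.* ½) (B ℚ.+ 1ℚ) (half>0 ε {{ε>0}}) (ℚ.pos+pos⇒pos B {{B>0}} 1ℚ)
    lm = log-mobius-estimate (proj₁ mb) (proj₁ (proj₂ mb)) (proj₁ (proj₂ (proj₂ mb)))
    below = mobius-bounded ε B (proj₁ mb) ε>0 (proj₂ (proj₂ (proj₂ mb)))
    c : ℚ
    -- The constant comes without a sign; the monotonicity steps need it nonnegative.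
    c = 0ℚ ℚ.⊔ proj₁ lm
    b : ℝ
    b = fromℚ B + 1ℝ
    K : ℝ
    K = ((b * b) * (fromℚ c * 1ℝ) + 1ℝ)
    0≤ε : 0ℝ ≤ fromℚ ε
    0≤ε = fromℚ-mono (Q.0≤pos ε {{ε>0}})
    0≤1 : 0ℝ ≤ 1ℝ
    0≤1 = fromℚ-mono (ℚ.nonNegative⁻¹ 1ℚ)

    module _ (t⁺ : ℝ⁺) where
      private
        t i : ℝ
        t = real t⁺
        i = real ((t⁺ D.+⁺ D.1⁺) D.⁻¹)

      inv-e : (t + 1ℝ) * i ≈ 1ℝ
      inv-e = subst (λ p → p * i ≈ 1ℝ) (trans (real-+⁺ t⁺ D.1⁺) (cong (λ x → t + x) real-1⁺))
        (inverse (t⁺ D.+⁺ D.1⁺))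

      inv-abs : ∣ i ∣ ≤ 1ℝ
      inv-abs = ≤-trans (≈⇒≤ (0≤⇒∣x∣≈x 0≤i)) (≤-cert (t * i) (0≤* (<⇒≤ (real⁺>0 t⁺)) 0≤i)
        (≈-trans (≈-sym inv-e) (solve 2 (λ t i → (t :+ con 1ℚ) :* i := i :+ t :* i) ≈-refl t i)))
        where
        0≤i : 0ℝ ≤ i
        0≤i = <⇒≤ (real⁺>0 ((t⁺ D.+⁺ D.1⁺) D.⁻¹))

    est : ∀ t u → fromℚ ε ≤ real t → real t ≤ fromℚ B → fromℚ ε ≤ real u → real u ≤ fromℚ B →
      ∣ real t * (log u - log t) - (real u - real t) ∣ ≤ K * ((real u - real t) * (real u - real t))
    est t⁺ u⁺ εt tB εu uB = ∣∣-resp identity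
      (≤-trans (∣∣-sub (∣∣-* (≤-trans
        (≈⇒≤ (0≤⇒∣x∣≈x (0≤* (fromℚ-mono (ℚ.nonNegative⁻¹ (½ ℚ.* ½))) (0≤x*x (t + 1ℝ)))))
        (*-monoˡ-≤ (fromℚ-mono (ℚ.nonNegative⁻¹ (½ ℚ.* ½))) (∣∣-square ∣t+1∣)))
                       X-bound)
                (∣∣-* (≈⇒≤ (0≤⇒∣x∣≈x (0≤x*x h))) (inv-abs u⁺)))
        (≈⇒≤ (solve 3 (λ b c h → con (½ ℚ.* ½) :* (b :* b) :* (c :* (con 4q :* (h :* h))) :+
          (h :* h) :* con 1ℚ :=
            ((b :* b) :* (c :* con 1ℚ) :+ con 1ℚ) :* (h :* h)) ≈-refl b (fromℚ c) h)))
      where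
      4q : ℚ
      4q = (1ℚ ℚ.+ 1ℚ) ℚ.* (1ℚ ℚ.+ 1ℚ)
      t u i j Λ h z w : ℝ
      t = real t⁺
      u = real u⁺
      i = real ((t⁺ D.+⁺ D.1⁺) D.⁻¹)
      j = real ((u⁺ D.+⁺ D.1⁺) D.⁻¹)
      Λ = log u⁺ - log t⁺
      h = u - t
      z = (t - 1ℝ) * i
      w = (u - 1ℝ) * j
      X : ℝ
      X = (1ℝ - z * z) * Λ - 2ℝ * (w - z)
      ∣t+1∣ : ∣ t + 1ℝ ∣ ≤ b
      ∣t+1∣ = ≤-trans (≈⇒≤ (0≤⇒∣x∣≈x (0≤+ (≤-trans 0≤ε εt) 0≤1))) (+-mono-≤ tB ≤-refl)
      vanish : ∀ {e} M → e ≈ 1ℝ → (e - 1ℝ) * M ≈ 0ℝ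
      vanish M k = ≈-trans (*-congʳ M (sub-cong k ≈-refl))
        (solve 1 (λ m → (con 1ℚ :- con 1ℚ) :* m := con 0ℚ) ≈-refl M)
      -- The solver knows nothing of (t + 1) i ≈ 1 and (u + 1) j ≈ 1. Identities modulo these two
      -- relations are proved as polynomial identities with explicit cofactors `M` and `N`.
      drop : ∀ {x y e f} M N → e ≈ 1ℝ → f ≈ 1ℝ → x ≈ y + ((e - 1ℝ) * M + (f - 1ℝ) * N) → x ≈ y
      drop {y = y} M N k l p = ≈-trans p (≈-trans (+-cong ≈-refl (+-cong (vanish M k) (vanish N l)))
        (solve 1 (λ y → y :+ (con 0ℚ :+ con 0ℚ) := y) ≈-refl y))
      identity : (fromℚ (½ ℚ.* ½) * ((t + 1ℝ) * (t + 1ℝ))) * X - (h * h) * j ≈ t * Λ - h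
      identity = drop
        (fromℚ ½ * (t + 1ℝ) * (t - 1ℝ) - fromℚ (½ ℚ.* ½) * (t - 1ℝ) * (t - 1ℝ) *
          ((t + 1ℝ) * i + 1ℝ) * Λ)
        (- (fromℚ ½ * (t + 1ℝ) * (t - 1ℝ) + (u - t))) (inv-e t⁺) (inv-e u⁺)
        (solve 5 (λ t u i j L →
          (con (½ ℚ.* ½) :* ((t :+ con 1ℚ) :* (t :+ con 1ℚ))) :*
            ((con 1ℚ :- ((t :- con 1ℚ) :* i) :* ((t :- con 1ℚ) :* i)) :* L :- con
              (1ℚ ℚ.+ 1ℚ) :* ((u :- con 1ℚ) :* j :- (t :- con 1ℚ) :* i))
            :- ((u :- t) :* (u :- t)) :* j :=
          (t :* L :- (u :- t)) :+
          (((t :+ con 1ℚ) :* i :- con 1ℚ) :* (con ½ :* (t :+ con 1ℚ) :* (t :- con 1ℚ) :- con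
            (½ ℚ.* ½) :* (t :- con 1ℚ) :* (t :- con 1ℚ) :* ((t :+ con 1ℚ) :* i :+ con 1ℚ) :* L) :+
           ((u :+ con 1ℚ) :* j :- con 1ℚ) :*
             (:- (con ½ :* (t :+ con 1ℚ) :* (t :- con 1ℚ) :+ (u :- t))))) ≈-refl t u i j Λ)
      w-z : w - z ≈ fromℚ (1ℚ ℚ.+ 1ℚ) * h * (i * j)
      w-z = drop (- ((u - 1ℝ) * j)) ((t - 1ℝ) * i) (inv-e t⁺) (inv-e u⁺)
        (solve 4 (λ t u i j → (u :- con 1ℚ) :* j :- (t :- con 1ℚ) :* i :=
          con (1ℚ ℚ.+ 1ℚ) :* (u :- t) :* (i :* j) :+
          (((t :+ con 1ℚ) :* i :- con 1ℚ) :* (:- ((u :- con 1ℚ) :* j)) :+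
            ((u :+ con 1ℚ) :* j :- con 1ℚ) :* ((t :- con 1ℚ) :* i))) ≈-refl t u i j)
      z≈ : D.mobius t⁺ ≈ z
      z≈ = mobius-def t⁺
      w-z≈ : D.mobius u⁺ - D.mobius t⁺ ≈ w - z
      w-z≈ = sub-cong (mobius-def u⁺) z≈
      X-bound : ∣ X ∣ ≤ fromℚ c * (4ℝ * (h * h))
      X-bound = ≤-trans
        (≤-resp (∣∣-cong (sub-cong (*-congʳ Λ (sub-cong ≈-refl (*-cong z≈ z≈))) (*-congˡ 2ℝ w-z≈)))
          (*-congˡ _ (*-cong w-z≈ w-z≈))
          (proj₂ lm t⁺ u⁺ (below t⁺ εt tB) (below u⁺ εu uB)))
        (≤-trans (*-monoʳ-≤ (0≤x*x (w - z)) (fromℚ-mono (ℚ.p≤q⊔p 0ℚ (proj₁ lm))))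
          (*-monoˡ-≤ (fromℚ-mono (ℚ.p≤p⊔q 0ℚ (proj₁ lm))) (≤-trans (≈⇒≤ (≈-trans (*-cong w-z w-z)
            (solve 2 (λ h e → con (1ℚ ℚ.+ 1ℚ) :* h :* e :* (con (1ℚ ℚ.+ 1ℚ) :* h :* e) :=
              con 4q :* (h :* h) :* (e :* e)) ≈-refl h (i * j))))
            (≤-trans (*-monoˡ-≤ (0≤* (fromℚ-mono (ℚ.nonNegative⁻¹ 4q)) (0≤x*x h))
              (∣∣-square (∣∣-* (inv-abs t⁺) (inv-abs u⁺))))
              (≈⇒≤ (solve 1 (λ h → con 4q :* (h :* h) :* ((con 1ℚ :* con 1ℚ) :* (con 1ℚ :* con 1ℚ))
                := con 4q :* (h :* h)) ≈-refl h))))))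

  -- Besides compatibility with `≈`, this shows that `log` does not depend on the positivity witness
  -- in its argument, on which the inverse inside `mobius` is built.
  log-cong : ∀ t u → real t ≈ real u → log t ≈ log u
  log-cong t u h = ≈-sym (x-y≈0⇒x≈y (*-cancel-≈ (real⁺>0 t) (≈-trans
      (∣x∣≤0⇒x≈0 (∣∣-resp (≈-trans (sub-cong ≈-refl u-t≈0) (solve 1 (λ x → x :- con 0ℚ := x)
        ≈-refl _))
        (≤-trans (proj₂ le t u εt (≤-trans (x≤∣x∣ _) tB) (≤-trans εt (≈⇒≤ h))
          (≤-trans (≈⇒≤ (≈-sym h)) (≤-trans (x≤∣x∣ _) tB)))
          (≈⇒≤ (≈-trans (*-congˡ (proj₁ le) (*-cong u-t≈0 u-t≈0))
            (solve 1 (λ k → k :* (con 0ℚ :* con 0ℚ) := con 0ℚ) ≈-refl (proj₁ le)))))))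
      (solve 1 (λ t → con 0ℚ := t :* con 0ℚ) ≈-refl (real t)))))
    where
    lo = 0<⇒rational (real⁺>0 t)
    hi = rational-bound (real t)
    εt = proj₂ (proj₂ lo)
    tB = proj₂ (proj₂ hi)
    le = log-estimate (proj₁ lo) (proj₁ hi) (proj₁ (proj₂ lo)) (proj₁ (proj₂ hi))
    u-t≈0 : real u - real t ≈ 0ℝ
    u-t≈0 = ≈-trans (sub-cong (≈-sym h) ≈-refl) (+-inverseʳ (real t))

  exp⁺ : ℝ → ℝ⁺
  exp⁺ s = real⁺ (exp s) (0<exp s)

  -- The function ψ x = log (exp x) - x has quadratically small increments: exp x times such an
  -- increment is the sum of the errors of `log-estimate` and `exp-estimate`, and exp x is bounded
  -- below on a bounded interval. Finally ψ 0 = 0.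
  log-exp : ∀ s → log (exp⁺ s) ≈ s
  log-exp s = begin-equality
      log (exp⁺ s)                 ≈⟨ solve 2 (λ l s → l := (l :- s) :+ s) ≈-refl (log (exp⁺ s)) s ⟩
      (log (exp⁺ s) - s) + s
        ≈⟨ +-cong (quadratic⇒constant (λ x → ∣ x ∣ ≤ b) (λ x y → ∣∣≤-mid) ψ K increment 0ℝ s ∣0∣≤b
        ∣s∣≤b) ≈-refl ⟩
      (log (exp⁺ 0ℝ) - 0ℝ) + s
        ≈⟨ +-cong (sub-cong (≈-trans
        (log-cong (exp⁺ 0ℝ) D.1⁺ (subst (exp 0ℝ ≈_) (sym real-1⁺) exp-0)) log-1⁺) ≈-refl) ≈-refl ⟩
      (0ℝ - 0ℝ) + s                ≈⟨ solve 1 (λ s → (con 0ℚ :- con 0ℚ) :+ s := s) ≈-refl s ⟩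
      s                            ∎
    where
    open ≤-R
    rb = rational-bound s
    B₀ : ℚ
    B₀ = proj₁ rb
    B₀>0 : Positive B₀
    B₀>0 = proj₁ (proj₂ rb)
    b : ℝ
    b = fromℚ B₀
    ∣s∣≤b : ∣ s ∣ ≤ b
    ∣s∣≤b = proj₂ (proj₂ rb)
    ∣0∣≤b : ∣ 0ℝ ∣ ≤ b
    ∣0∣≤b = ≤-trans (≈⇒≤ (0≤⇒∣x∣≈x ≤-refl)) (fromℚ-mono (Q.0≤pos B₀ {{B₀>0}}))
    lo = 0<⇒rational (0<exp (- b))
    hi = rational-bound (exp b)
    ε : ℚ
    ε = proj₁ lo
    ε>0 : Positive ε
    ε>0 = proj₁ (proj₂ lo)
    M : ℝ
    M = fromℚ (proj₁ hi)
    le = log-estimate ε (proj₁ hi) ε>0 (proj₁ (proj₂ hi))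
    lower : ∀ x → ∣ x ∣ ≤ b → fromℚ ε ≤ exp x
    lower x h = ≤-trans (proj₂ (proj₂ lo))
      (exp-mono-≤ (≤-trans (neg-anti-≤ (≤-trans (-x≤∣x∣ x) h))
      (≈⇒≤ (solve 1 (λ x → :- (:- x) := x) ≈-refl x))))
    upper : ∀ x → ∣ x ∣ ≤ b → exp x ≤ M
    upper x h = ≤-trans (exp-mono-≤ (≤-trans (x≤∣x∣ x) h)) (≤-trans (x≤∣x∣ _) (proj₂ (proj₂ hi)))
    ψ : ℝ → ℝ
    ψ x = log (exp⁺ x) - x
    -- `L` is a Lipschitz constant of `exp` between -b and b. `K₀` bounds the increment of `ψ` after
    -- multiplication by exp x, and `i` = 1/ε removes that factor.
    C L K₀ K i : ℝ
    C = exp (fromℚ (B₀ ℚ.+ 1ℚ))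
    L = M + (b + b) * C
    K₀ = ∣ proj₁ le ∣ * (L * L) + C
    i = fromℚ (Q.inv ε ε>0)
    K = i * K₀
    increment : ∀ x y → ∣ x ∣ ≤ b → ∣ y ∣ ≤ b → ∣ ψ y - ψ x ∣ ≤ K * ((y - x) * (y - x))
    increment x y p q = *-cancel-≤ (fromℚ-pos ε {{ε>0}}) (begin
        fromℚ ε * ∣ a ∣       ≤⟨ *-monoʳ-≤ (0≤∣x∣ a) (≤-trans (lower x p) (x≤∣x∣ u)) ⟩
        ∣ u ∣ * ∣ a ∣         ≈⟨ ∣x*y∣≈∣x∣*∣y∣ u a ⟨
        ∣ u * a ∣             ≤⟨ ua ⟩
        K₀ * (h * h)          ≈⟨ *-identityˡ _ ⟨
        1ℝ * (K₀ * (h * h))   ≈⟨ *-congʳ _ εi ⟨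
        fromℚ ε * i * (K₀ * (h * h)) ≈⟨ solve 4 (λ e i k d → e :* i :* (k :* d) :=
          e :* (i :* k :* d)) ≈-refl (fromℚ ε) i K₀ (h * h) ⟩
        fromℚ ε * (K * (h * h)) ∎)
      where
      u v h a Λ : ℝ
      u = exp x
      v = exp y
      h = y - x
      Λ = log (exp⁺ y) - log (exp⁺ x)
      a = ψ y - ψ x
      εi : fromℚ ε * i ≈ 1ℝ
      εi = ≈-trans (≈-sym (fromℚ-* ε (Q.inv ε ε>0)))
        (≡⇒≈ (cong fromℚ (trans (ℚ.*-comm ε (Q.inv ε ε>0)) (Q.inv-*ˡ ε ε>0))))
      R : ∣ (v - u) - h * u ∣ ≤ C * (h * h)
      R = exp-estimate B₀ B₀>0 x y p q
      v-u : ∣ v - u ∣ ≤ ∣ h ∣ * L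
      v-u = ∣∣-resp (solve 3 (λ u v h → ((v :- u) :- h :* u) :+ h :* u := v :- u) ≈-refl u v h)
        (≤-trans (∣∣-+ (≤-trans R (*-monoˡ-≤ (<⇒≤ (0<exp _)) (≤-trans (≈⇒≤ (≈-sym (∣x∣*∣x∣≈x*x h)))
          (*-monoˡ-≤ (0≤∣x∣ h) (∣∣-sub q p)))))
                   (∣∣-* ≤-refl (≤-trans (≈⇒≤ (0≤⇒∣x∣≈x (<⇒≤ (0<exp x)))) (upper x p))))
          (≈⇒≤ (solve 4 (λ c h b m → c :* (h :* (b :+ b)) :+ h :* m := h :* (m :+ (b :+ b) :* c))
            ≈-refl C ∣ h ∣ b M)))
      est : ∣ u * Λ - (v - u) ∣ ≤ proj₁ le * ((v - u) * (v - u))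
      est = proj₂ le (exp⁺ x) (exp⁺ y) (lower x p) (upper x p) (lower y q) (upper y q)
      ua : ∣ u * a ∣ ≤ K₀ * (h * h)
      ua = ∣∣-resp (solve 6 (λ u v x y ly lx →
        (u :* (ly :- lx) :- (v :- u)) :+ ((v :- u) :- (y :- x) :* u) :=
        u :* ((ly :- y) :- (lx :- x))) ≈-refl u v x y (log (exp⁺ y)) (log (exp⁺ x)))
        (≤-trans (∣∣-+ (≤-trans est (≤-trans (*-monoʳ-≤ (0≤x*x (v - u)) (x≤∣x∣ (proj₁ le)))
          (*-monoˡ-≤ (0≤∣x∣ (proj₁ le)) (∣∣-square v-u)))) R)
          (≈⇒≤ (≈-trans (+-cong (*-congˡ _
            (≈-trans (solve 2 (λ h l → h :* l :* (h :* l) := h :* h :* (l :* l)) ≈-refl ∣ h ∣ L)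
            (*-congʳ _ (∣x∣*∣x∣≈x*x h)))) ≈-refl)
            (solve 4 (λ k d l c → k :* (d :* l) :+ c :* d := (k :* l :+ c) :* d) ≈-refl ∣ proj₁ le
              ∣ (h * h) (L * L) C))))

  -- Riemann sums on exponential grids

  step : ℕ → ℝ
  step n = fromℚ (+ 1 ℚ./ suc n)

  0≤step : ∀ n → 0ℝ ≤ step n
  0≤step n = fromℚ-mono (Q./-nonNeg 1 n)

  fromℕ-suc*step : ∀ n → fromℕ (suc n) * step n ≈ 1ℝ
  fromℕ-suc*step n = ≈-trans (≈-sym (fromℚ-* (+ suc n ℚ./ 1) (+ 1 ℚ./ suc n)))
    (≡⇒≈ (cong fromℚ (trans (ℚ.*-comm (+ suc n ℚ./ 1) (+ 1 ℚ./ suc n)) (Q./-*-cancel n))))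

  fromℕ-mono : ∀ {m n} → m ℕ.≤ n → fromℕ m ≤ fromℕ n
  fromℕ-mono h = fromℚ-mono (Q.fromℕ-mono h)

  0<fromℕ-suc : ∀ n → 0ℝ < fromℕ (suc n)
  0<fromℕ-suc n = <-≤-trans (fromℚ-pos 1ℚ) (fromℕ-mono {1} {suc n} (ℕ.s≤s ℕ.z≤n))

  fromℕ-+ : ∀ m n → fromℕ (m ℕ.+ n) ≈ fromℕ m + fromℕ n
  fromℕ-+ zero    n = ≈-sym (+-identityˡ (fromℕ n))
  fromℕ-+ (suc m) n = ≈-trans (fromℕ-suc (m ℕ.+ n)) (≈-trans (+-cong ≈-refl (fromℕ-+ m n))
    (≈-trans (≈-sym (+-assoc _ _ _)) (+-cong (≈-sym (fromℕ-suc m)) ≈-refl)))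

  fromℕ-* : ∀ m n → fromℕ (m ℕ.* n) ≈ fromℕ m * fromℕ n
  fromℕ-* zero    n = solve 1 (λ x → con 0ℚ := con 0ℚ :* x) ≈-refl (fromℕ n)
  fromℕ-* (suc m) n = ≈-trans (fromℕ-+ n (m ℕ.* n)) (≈-trans (+-cong ≈-refl (fromℕ-* m n))
    (≈-trans (solve 2 (λ m n → n :+ m :* n := (con 1ℚ :+ m) :* n) ≈-refl (fromℕ m) (fromℕ n))
      (*-congʳ _ (≈-sym (fromℕ-suc m)))))

  step-small : ∀ c ε → Positive ε → ∃[ N ] ∀ n → N ℕ.≤ n → c * step n ≤ fromℚ ε
  step-small c ε ε>0 = N , λ n N≤n → *-cancel-≤ (0<fromℕ-suc n) (begin
      fromℕ (suc n) * (c * step n) ≈⟨ solve 3 (λ m c s → m :* (c :* s) := (m :* s) :* c)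
        ≈-refl (fromℕ (suc n)) c (step n) ⟩
      fromℕ (suc n) * step n * c   ≈⟨ *-congʳ c (fromℕ-suc*step n) ⟩
      1ℝ * c                       ≈⟨ *-congʳ c εi ⟨
      fromℚ ε * i * c              ≈⟨ solve 3 (λ e i c → e :* i :* c := (i :* c) :* e)
        ≈-refl (fromℚ ε) i c ⟩
      i * c * fromℚ ε              ≤⟨ *-monoʳ-≤ (fromℚ-mono (Q.0≤pos ε {{ε>0}}))
        (≤-trans (proj₂ (ceiling (i * c))) (fromℕ-mono (ℕ.m≤n⇒m≤1+n N≤n))) ⟩
      fromℕ (suc n) * fromℚ ε      ∎)
    where
    open ≤-R
    i : ℝ
    i = fromℚ (Q.inv ε ε>0)
    εi : fromℚ ε * i ≈ 1ℝ
    εi = ≈-trans (≈-sym (fromℚ-* ε (Q.inv ε ε>0)))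
      (≡⇒≈ (cong fromℚ (trans (ℚ.*-comm ε (Q.inv ε ε>0)) (Q.inv-*ˡ ε ε>0))))
    N : ℕ
    N = proj₁ (ceiling (i * c))

  exp-neg*exp : ∀ x → exp (- x) * exp x ≈ 1ℝ
  exp-neg*exp x = ≈-trans (*-comm _ _) (exp-inverse x)

  exp-neg-≤ : ∀ y → exp (- y) * (1ℝ + y) ≤ 1ℝ
  exp-neg-≤ y = ≤-trans (*-monoˡ-≤ (<⇒≤ (0<exp _)) (1+x≤exp y)) (≈⇒≤ (exp-neg*exp y))

  exp-neg-fromℕ≤step : ∀ K → exp (- fromℕ K) ≤ step K
  exp-neg-fromℕ≤step K = *-cancel-≤ (0<fromℕ-suc K) (begin
    fromℕ (suc K) * exp (- fromℕ K)    ≈⟨ *-comm _ _ ⟩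
    exp (- fromℕ K) * fromℕ (suc K)    ≈⟨ *-congˡ _ (fromℕ-suc K) ⟩
    exp (- fromℕ K) * (1ℝ + fromℕ K)   ≤⟨ exp-neg-≤ (fromℕ K) ⟩
    1ℝ                                 ≈⟨ fromℕ-suc*step K ⟨
    fromℕ (suc K) * step K             ∎)
    where open ≤-R

  -- The constant of `exp-estimate` for arguments of absolute value at most 1.
  C₁ : ℝ
  C₁ = exp (fromℚ (1ℚ ℚ.+ 1ℚ))

  0≤C₁ : 0ℝ ≤ C₁
  0≤C₁ = <⇒≤ (0<exp _)

  exp-near-0 : ∀ y → ∣ y ∣ ≤ 1ℝ → ∣ (exp y - 1ℝ) - y ∣ ≤ C₁ * (y * y)
  exp-near-0 y h = ∣∣-resp
    (≈-trans (sub-cong (sub-cong ≈-refl exp-0) (*-congˡ _ exp-0))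
      (solve 2 (λ e y → (e :- con 1ℚ) :- (y :- con 0ℚ) :* con 1ℚ := (e :- con 1ℚ) :- y) ≈-refl
      (exp y) y))
    (≤-trans (exp-estimate 1ℚ _ 0ℝ y (≤-trans (≈⇒≤ (0≤⇒∣x∣≈x ≤-refl))
      (fromℚ-mono (ℚ.nonNegative⁻¹ 1ℚ))) h)
      (≈⇒≤ (solve 2 (λ c y → c :* ((y :- con 0ℚ) :* (y :- con 0ℚ)) := c :* (y :* y)) ≈-refl C₁ y)))

  step≤1 : ∀ n → step n ≤ 1ℝ
  step≤1 n = fromℚ-mono (Q./-mono 1 n 1 0 (ℕ.s≤s ℕ.z≤n))

  ∣step∣≤step : ∀ n → ∣ step n ∣ ≤ step n
  ∣step∣≤step n = ≈⇒≤ (0≤⇒∣x∣≈x (0≤step n))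

  -- The ratio of the width of a cell to its left end in t = exp s, the same for all cells.
  growth : ℕ → ℝ
  growth n = exp (step n) - 1ℝ

  growth-step : ∀ n → ∣ growth n - step n ∣ ≤ C₁ * (step n * step n)
  growth-step n = exp-near-0 (step n) (≤-trans (∣step∣≤step n) (step≤1 n))

  step≤growth : ∀ n → step n ≤ growth n
  step≤growth n = ≤-cert (exp (step n) - (1ℝ + step n)) (0≤- (1+x≤exp (step n)))
    (solve 2 (λ e h → e :- con 1ℚ := h :+ (e :- (con 1ℚ :+ h))) ≈-refl (exp (step n)) (step n))

  L₁ : ℝ
  L₁ = C₁ + 1ℝ

  0≤L₁ : 0ℝ ≤ L₁
  0≤L₁ = 0≤+ 0≤C₁ (fromℚ-mono (ℚ.nonNegative⁻¹ 1ℚ))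

  growth≤ : ∀ n → growth n ≤ L₁ * step n
  growth≤ n = begin
    growth n                          ≈⟨ solve 2 (λ g h → g := (g :- h) :+ h) ≈-refl (growth n)
      (step n) ⟩
    (growth n - step n) + step n      ≤⟨ +-mono-≤ (≤-trans (x≤∣x∣ _) (growth-step n)) ≤-refl ⟩
    C₁ * (step n * step n) + step n
      ≤⟨ +-mono-≤ (*-monoˡ-≤ 0≤C₁ (*-monoˡ-≤ (0≤step n) (step≤1 n))) ≤-refl ⟩
    C₁ * (step n * 1ℝ) + step n       ≈⟨ solve 2 (λ c h → c :* (h :* con 1ℚ) :+ h :=
      (c :+ con 1ℚ) :* h) ≈-refl C₁ (step n) ⟩
    L₁ * step n                       ∎
    where open ≤-R

  -- The grid of mesh 1/(n + 1) in s; it runs from -K at index 0 to K at index `gridSize K n`.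
  node : ℕ → ℕ → ℕ → ℝ
  node K n k = - fromℕ K + fromℕ k * step n

  gridSize : ℕ → ℕ → ℕ
  gridSize K n = (K ℕ.+ K) ℕ.* suc n

  node-zero : ∀ K n → node K n 0 ≈ - fromℕ K
  node-zero K n = solve 2 (λ k h → :- k :+ con 0ℚ :* h := :- k) ≈-refl (fromℕ K) (step n)

  node-suc : ∀ K n k → node K n (suc k) ≈ node K n k + step n
  node-suc K n k = ≈-trans (+-cong ≈-refl (*-congʳ _ (fromℕ-suc k)))
    (solve 3 (λ K k h → :- K :+ (con 1ℚ :+ k) :* h := (:- K :+ k :* h) :+ h) ≈-refl (fromℕ K)
      (fromℕ k) (step n))

  gridSize*step : ∀ K n → fromℕ (gridSize K n) * step n ≈ fromℕ K + fromℕ K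
  gridSize*step K n = begin-equality
    fromℕ (gridSize K n) * step n                     ≈⟨ *-congʳ _ (fromℕ-* (K ℕ.+ K) (suc n)) ⟩
    fromℕ (K ℕ.+ K) * fromℕ (suc n) * step n          ≈⟨ *-assoc _ _ _ ⟩
    fromℕ (K ℕ.+ K) * (fromℕ (suc n) * step n)        ≈⟨ *-cong (fromℕ-+ K K) (fromℕ-suc*step n) ⟩
    (fromℕ K + fromℕ K) * 1ℝ                          ≈⟨ solve 1 (λ k → (k :+ k) :* con 1ℚ :=
      k :+ k) ≈-refl (fromℕ K) ⟩
    fromℕ K + fromℕ K                                 ∎
    where open ≤-R

  node-last : ∀ K n → node K n (gridSize K n) ≈ fromℕ K
  node-last K n = ≈-trans (+-cong ≈-refl (gridSize*step K n))
    (solve 1 (λ k → :- k :+ (k :+ k) := k) ≈-refl (fromℕ K))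

  node≤ : ∀ K n k → k ℕ.≤ gridSize K n → node K n k ≤ fromℕ K
  node≤ K n k h = ≤-trans (+-mono-≤ ≤-refl (*-monoʳ-≤ (0≤step n) (fromℕ-mono h)))
    (≈⇒≤ (node-last K n))

  exp-node-width : ∀ K n k → exp (node K n (suc k)) - exp (node K n k) ≈ exp (node K n k) * growth n
  exp-node-width K n k = ≈-trans (sub-cong (≈-trans (exp-cong (node-suc K n k)) (exp-+ _ _)) ≈-refl)
    (solve 2 (λ s h → s :* h :- s := s :* (h :- con 1ℚ)) ≈-refl (exp (node K n k)) (exp (step n)))

  -- `D.IsIntegral` controls every fine tagged partition, so this one family suffices. Taking left
  -- ends as tags makes each summand an explicit function of a single node.
  grid : ∀ K n → D.TaggedPartition (exp⁺ (- fromℕ K)) (exp⁺ (fromℕ K))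
  grid K n = record
    { size  = gridSize K n
    ; point = λ k → exp⁺ (node K n k)
    ; tag   = λ k → exp⁺ (node K n k)
    ; first = ≈-out {exp (node K n 0)} {exp (- fromℕ K)} (exp-cong (node-zero K n))
    ; last  = ≈-out {exp (node K n (gridSize K n))} {exp (fromℕ K)} (exp-cong (node-last K n))
    ; lower = λ k _ → ≤-out {exp (node K n k)} {exp (node K n k)} ≤-refl
    ; upper = λ k _ → ≤-out {exp (node K n k)} {exp (node K n (suc k))}
      (exp-mono-≤ (≤-cert (step n) (0≤step n) (node-suc K n k)))
    }

  width≤ : ∀ K n k → k ℕ.< gridSize K n → exp (node K n (suc k)) - exp (node K n k) ≤ exp
    (fromℕ K) * L₁ * step n
  width≤ K n k h = begin
    exp (node K n (suc k)) - exp (node K n k)   ≈⟨ exp-node-width K n k ⟩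
    exp (node K n k) * growth n                 ≤⟨ *-mono-≤ (<⇒≤ (0<exp _)) (0≤* 0≤L₁ (0≤step n))
      (exp-mono-≤ (node≤ K n k (ℕ.<⇒≤ h))) (growth≤ n) ⟩
    exp (fromℕ K) * (L₁ * step n)               ≈⟨ *-assoc _ _ _ ⟨
    exp (fromℕ K) * L₁ * step n                 ∎
    where open ≤-R

  gridSum : (ℝ⁺ → ℝ) → ℕ → ℕ → ℝ
  gridSum f K n = ∑ (gridSize K n) λ k →
    f (exp⁺ (node K n k)) * (exp (node K n (suc k)) - exp (node K n k))

  gridSum-cong : ∀ (f g : ℝ⁺ → ℝ) K n → (∀ t → f t ≈ g t) → gridSum f K n ≈ gridSum g K n
  gridSum-cong f g K n h = ∑-cong (gridSize K n) λ k _ →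
    *-congʳ (exp (node K n (suc k)) - exp (node K n k)) (h (exp⁺ (node K n k)))

  -- Convergence of an iterated limit: first in n, then in K.
  Converges : (ℕ → ℕ → ℝ) → ℝ → Set
  Converges T I = ∀ ε → Positive ε → ∃[ K₀ ] ∀ K → K₀ ℕ.≤ K → ∃[ n₀ ] ∀ n → n₀ ℕ.≤ n →
    ∣ T K n - I ∣ ≤ fromℚ ε

  width-def : ∀ {a b} (P : D.TaggedPartition a b) k → D.width P k ≈ real (D.point P (suc k)) - real
    (D.point P k)
  width-def P k = sub-def (real (D.point P (suc k))) (real (D.point P k))

  riemannSum-def : ∀ {a b} f (P : D.TaggedPartition a b) →
    D.riemannSum f P ≈ ∑ (D.size P)
      (λ k → f (D.tag P k) * (real (D.point P (suc k)) - real (D.point P k)))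
  riemannSum-def f P = ∑-def (D.size P) {λ k → f (D.tag P k) D.* D.width P k} λ k →
    ≈-trans (≡⇒≈ (*-def (f (D.tag P k)) (D.width P k))) (*-congˡ (f (D.tag P k)) (width-def P k))

  meshBelow : ∀ {a b} δ (P : D.TaggedPartition a b) →
    (∀ k → k ℕ.< D.size P → real (D.point P (suc k)) - real (D.point P k) < real δ) →
      D.MeshBelow δ P
  meshBelow δ P h k k<N = <-out {D.width P k} {real δ} (<-resp (≈-sym (width-def P k))
    ≈-refl (h k k<N))

  dist-< : ∀ {x y c} → D.∣ x D.- y ∣ D.< c → ∣ x - y ∣ < c
  dist-< {x} {y} {c} h = <-resp (dist-def x y) (≈-refl {c}) (<-in {D.∣ x D.- y ∣} {c} h)

  integral-approx : ∀ {f a b I} → D.IsIntegral f a b I → (ε : ℝ⁺) →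
    Σ[ δ ∈ ℝ⁺ ] ((P : D.TaggedPartition a b) →
    (∀ k → k ℕ.< D.size P → real (D.point P (suc k)) - real (D.point P k) < real δ) →
    ∣ ∑ (D.size P) (λ k → f (D.tag P k) * (real (D.point P (suc k)) - real (D.point P k))) - I
      ∣ < real ε)
  integral-approx {f} {a} {b} {I} int ε = proj₁ (int ε) , λ P h →
    <-resp (∣∣-cong (sub-cong (riemannSum-def f P) (≈-refl {I}))) (≈-refl {real ε})
      (dist-< {D.riemannSum f P} {I} {real ε} (proj₂ (int ε) P (meshBelow (proj₁ (int ε)) P h)))

  improper-approx : ∀ {f I} → D.IsImproperIntegral f I → (ε : ℝ⁺) →
    Σ[ δ ∈ ℝ⁺ ] Σ[ M ∈ ℝ⁺ ] ((a b : ℝ⁺) →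
    real a < real δ → real M < real b → real a < real b → Σ[ J ∈ ℝ ] D.IsIntegral f a b J × ∣ J - I
      ∣ < real ε)
  improper-approx {f} {I} int ε = proj₁ (int ε) , proj₁ (proj₂ (int ε)) , λ a b p q r →
    let J = proj₂ (proj₂ (int ε)) a b (<-out {real a} {real (proj₁ (int ε))} p)
          (<-out {real (proj₁ (proj₂ (int ε)))} {real b} q) (<-out {real a} {real b} r)
    in proj₁ J , proj₁ (proj₂ J) , dist-< {proj₁ J} {I} {real ε} (proj₂ (proj₂ J))

  half-gap-< : ∀ {x} ε → Positive ε → fromℚ ε ≤ x → fromℚ (ε ℚ.* ½) < x
  half-gap-< ε ε>0 h = gap⇒< (ε ℚ.* ½) (half>0 ε {{ε>0}})
    (≤-trans (≈⇒≤ (≈-trans (≈-sym (fromℚ-+ (ε ℚ.* ½) (ε ℚ.* ½))) (≡⇒≈ (cong fromℚ (Q.halves ε)))))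
      h)

  step-small-< : ∀ c x → 0ℝ < x → ∃[ N ] ∀ n → N ℕ.≤ n → c * step n < x
  step-small-< c x 0<x = proj₁ ss , λ n N≤n → ≤-<-trans (proj₂ ss n N≤n)
    (half-gap-< (proj₁ ρ) (proj₁ (proj₂ ρ)) (proj₂ (proj₂ ρ)))
    where
    ρ : Σ[ ε ∈ ℚ ] Positive ε × fromℚ ε ≤ x
    ρ = 0<⇒rational 0<x
    ss : ∃[ N ] ∀ n → N ℕ.≤ n → c * step n ≤ fromℚ (proj₁ ρ ℚ.* ½)
    ss = step-small c (proj₁ ρ ℚ.* ½) (half>0 (proj₁ ρ) {{proj₁ (proj₂ ρ)}})

  grid-approx : ∀ f K J → D.IsIntegral f (exp⁺ (- fromℕ K)) (exp⁺ (fromℕ K)) J → ∀ η → Positive η →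
    ∃[ n₀ ] ∀ n → n₀ ℕ.≤ n → ∣ gridSum f K n - J ∣ ≤ fromℚ η
  grid-approx f K J int η η>0 = proj₁ sm , λ n n₀≤n → <⇒≤ (proj₂ mesh (grid K n) λ k k<N →
      ≤-<-trans (width≤ K n k k<N) (proj₂ sm n n₀≤n))
    where
    mesh : Σ[ δ′ ∈ ℝ⁺ ] ((P : D.TaggedPartition (exp⁺ (- fromℕ K)) (exp⁺ (fromℕ K))) →
      (∀ k → k ℕ.< D.size P → real (D.point P (suc k)) - real (D.point P k) < real δ′) →
      ∣ ∑ (D.size P) (λ k → f (D.tag P k) * (real (D.point P (suc k)) - real (D.point P k))) - J
        ∣ < fromℚ η)
    mesh = integral-approx {f} {exp⁺ (- fromℕ K)} {exp⁺ (fromℕ K)} {J} int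
      (real⁺ (fromℚ η) (fromℚ-pos η {{η>0}}))
    sm : ∃[ N ] ∀ n → N ℕ.≤ n → exp (fromℕ K) * L₁ * step n < real (proj₁ mesh)
    sm = step-small-< (exp (fromℕ K) * L₁) (real (proj₁ mesh)) (real⁺>0 (proj₁ mesh))

  fromℕ<exp : ∀ K → fromℕ K < exp (fromℕ K)
  fromℕ<exp K = gap⇒< 1ℚ _ (≤-trans (≈⇒≤ (+-comm (fromℕ K) 1ℝ)) (1+x≤exp (fromℕ K)))

  exp-interval : (δ M : ℝ⁺) → ∃[ K₀ ] ∀ K → K₀ ℕ.≤ K →
    exp (- fromℕ K) < real δ × real M < exp (fromℕ K) × exp (- fromℕ K) < exp (fromℕ K)
  -- The leading 1 forces K ≥ 1, and then exp (-K) ≤ 1/(K + 1) ≤ 1 ≤ K < exp K gives the third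
  -- inequality.
  exp-interval δ M = 1 ℕ.+ (proj₁ ss ℕ.+ proj₁ cl) , λ K K₀≤K →
    ≤-<-trans (≤-trans (exp-neg-fromℕ≤step K) (≈⇒≤ (≈-sym (*-identityˡ (step K)))))
      (proj₂ ss K (ℕ.≤-trans (ℕ.≤-trans (ℕ.m≤m+n (proj₁ ss) (proj₁ cl)) (ℕ.n≤1+n _)) K₀≤K)) ,
    ≤-<-trans (≤-trans (proj₂ cl)
      (fromℕ-mono (ℕ.≤-trans (ℕ.≤-trans (ℕ.m≤n+m (proj₁ cl) (proj₁ ss)) (ℕ.n≤1+n _)) K₀≤K)))
      (fromℕ<exp K) ,
    ≤-<-trans (≤-trans (exp-neg-fromℕ≤step K)
      (≤-trans (step≤1 K) (fromℕ-mono {1} {K} (ℕ.≤-trans (ℕ.s≤s ℕ.z≤n) K₀≤K)))) (fromℕ<exp K)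
    where
    ss : ∃[ N ] ∀ n → N ℕ.≤ n → 1ℝ * step n < real δ
    ss = step-small-< 1ℝ (real δ) (real⁺>0 δ)
    cl : ∃[ n ] real M ≤ fromℕ n
    cl = ceiling (real M)

  improper⇒converges : ∀ (f g : ℝ⁺ → ℝ) I → (∀ t → f t ≈ g t) → D.IsImproperIntegral f I →
    Converges (gridSum g) I
  improper⇒converges f g I f≈g int ε ε>0 = proj₁ ei , λ K K₀≤K →
    let a<δ , M<b , a<b = proj₂ ei K K₀≤K
        J , isJ , J-I   = proj₂ (proj₂ approx) (exp⁺ (- fromℕ K)) (exp⁺ (fromℕ K)) a<δ M<b a<b
        n₀ , h          = grid-approx f K J isJ η η>0 in
    n₀ , λ n n₀≤n → begin
      ∣ gridSum g K n - I ∣         ≈⟨ ∣∣-cong (sub-cong (gridSum-cong f g K n f≈g) ≈-refl) ⟨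
      ∣ gridSum f K n - I ∣         ≈⟨ ∣∣-cong (solve 3 (λ s j i → s :- i := (s :- j) :+ (j :- i))
        ≈-refl (gridSum f K n) J I) ⟩
      ∣ (gridSum f K n - J) + (J - I) ∣ ≤⟨ ∣∣-+ (h n n₀≤n) (<⇒≤ J-I) ⟩
      fromℚ η + fromℚ η             ≈⟨ fromℚ-+ η η ⟨
      fromℚ (η ℚ.+ η)               ≈⟨ ≡⇒≈ (cong fromℚ (Q.halves ε)) ⟩
      fromℚ ε                       ∎
    where
    open ≤-R
    η : ℚ
    η = ε ℚ.* ½
    η>0 : Positive η
    η>0 = half>0 ε {{ε>0}}
    approx : Σ[ δ ∈ ℝ⁺ ] Σ[ M ∈ ℝ⁺ ] ((a b : ℝ⁺) →
      real a < real δ → real M < real b → real a < real b → Σ[ J ∈ ℝ ] D.IsIntegral f a b J × ∣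
        J - I ∣ < fromℚ η)
    approx = improper-approx {f} {I} int (real⁺ (fromℚ η) (fromℚ-pos η {{η>0}}))
    ei : ∃[ K₀ ] ∀ K → K₀ ℕ.≤ K →
      exp (- fromℕ K) < real (proj₁ approx) × real (proj₁ (proj₂ approx)) < exp (fromℕ K) × exp
        (- fromℕ K) < exp (fromℕ K)
    ei = exp-interval (proj₁ approx) (proj₁ (proj₂ approx))

  -- The gamma function

  -- At t = exp s this is t^x e^(-t): the integrand of Γ times dt/ds = t.
  weight : ℝ → ℝ → ℝ
  weight x s = exp (x * s - exp s)

  -- After the substitution t = exp s, a grid sum for Γ(x).
  gammaSum : ℝ → ℕ → ℕ → ℝ
  gammaSum x K n = ∑ (gridSize K n) λ k → weight x (node K n k) * growth n

  opaque
    unfolding exp log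

    exp-def : ∀ x → D.exp x ≡ exp x
    exp-def x = refl

    log-def : ∀ t → D.log t ≡ log t
    log-def t = refl

  ^ʳ-def : ∀ t y → t D.^ʳ y ≡ D.exp (y D.* D.log t)
  ^ʳ-def t y = refl

  opaque
    unfolding _+_

    D1≈1 : D.1ℝ ≈ 1ℝ
    D1≈1 = ≈-refl

  ^ʳ≈ : ∀ t y → t D.^ʳ y ≈ exp (y * log t)
  ^ʳ≈ t y = ≈-trans (≡⇒≈ (trans (^ʳ-def t y) (exp-def (y D.* D.log t)))) (exp-cong
    (≈-trans (≡⇒≈ (*-def y (D.log t))) (*-congˡ y (≡⇒≈ (log-def t)))))

  exp-neg-def : ∀ x → D.exp (D.- x) ≈ exp (- x)
  exp-neg-def x = ≈-trans (≡⇒≈ (exp-def (D.- x))) (exp-cong (≡⇒≈ (neg-def x)))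

  sub1-def : ∀ x → x D.- D.1ℝ ≈ x - 1ℝ
  sub1-def x = ≈-trans (sub-def x D.1ℝ) (sub-cong ≈-refl D1≈1)

  integrand : ℝ⁺ → ℝ⁺ → ℝ
  integrand x t = exp ((real x - 1ℝ) * log t) * exp (- real t)

  integrand-def : ∀ x t → t D.^ʳ (real x D.- D.1ℝ) D.* D.exp (D.- real t) ≈ integrand x t
  integrand-def x t = ≈-trans (≡⇒≈ (*-def (t D.^ʳ (real x D.- D.1ℝ)) (D.exp (D.- real t)))) (*-cong
    (≈-trans (^ʳ≈ t (real x D.- D.1ℝ)) (exp-cong (*-congʳ (log t) (sub1-def (real x)))))
    (exp-neg-def (real t)))

  integrand-node : ∀ x K n k →
    integrand x (exp⁺ (node K n k)) * (exp (node K n (suc k)) - exp (node K n k)) ≈ weight (real x)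
      (node K n k) * growth n
  integrand-node x K n k = begin-equality
    integrand x (exp⁺ s) * (exp (node K n (suc k)) - exp s)
      ≈⟨ *-cong (*-congʳ (exp (- exp s)) (exp-cong (*-congˡ (real x - 1ℝ) (log-exp s))))
        (exp-node-width K n k) ⟩
    exp ((real x - 1ℝ) * s) * exp (- exp s) * (exp s * growth n)
      ≈⟨ solve 4 (λ a b c g → a :* b :* (c :* g) := (a :* c) :* b :* g)
        ≈-refl (exp ((real x - 1ℝ) * s)) (exp (- exp s)) (exp s) (growth n) ⟩
    exp ((real x - 1ℝ) * s) * exp s * exp (- exp s) * growth n
      ≈⟨ *-congʳ (growth n) (≈-trans
        (*-congʳ (exp (- exp s)) (≈-sym (exp-+ ((real x - 1ℝ) * s) s)))
        (≈-sym (exp-+ ((real x - 1ℝ) * s + s) (- exp s)))) ⟩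
    exp ((real x - 1ℝ) * s + s + - exp s) * growth n
      ≈⟨ *-congʳ (growth n) (exp-cong (solve 3 (λ x s e → (x :- con 1ℚ) :* s :+ s :+ :- e :=
        x :* s :- e) ≈-refl (real x) s (exp s))) ⟩
    weight (real x) s * growth n ∎
    where
    open ≤-R
    s : ℝ
    s = node K n k

  converges-cong : ∀ {T T′ I} → (∀ K n → T K n ≈ T′ K n) → Converges T I → Converges T′ I
  converges-cong h c ε ε>0 = proj₁ (c ε ε>0) , λ K K₀≤K → proj₁ (proj₂ (c ε ε>0) K K₀≤K) ,
    λ n n₀≤n →
    ∣∣-resp (sub-cong (h K n) ≈-refl) (proj₂ (proj₂ (c ε ε>0) K K₀≤K) n n₀≤n)

  converges₂ : ∀ {T T′ I I′} → Converges T I → Converges T′ I′ → ∀ η → Positive η →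
    ∃[ K₀ ] ∀ K → K₀ ℕ.≤ K → ∃[ n₀ ] ∀ n → n₀ ℕ.≤ n → ∣ T K n - I ∣ ≤ fromℚ η × ∣ T′ K n - I′
      ∣ ≤ fromℚ η
  converges₂ c c′ η η>0 = K₁ ℕ.⊔ K₂ , λ K p →
    ev-both (proj₂ (c η η>0) K (⊔-≤ˡ {K₁} {K₂} p)) (proj₂ (c′ η η>0) K (⊔-≤ʳ {K₁} {K₂} p))
    where
    K₁ K₂ : ℕ
    K₁ = proj₁ (c η η>0)
    K₂ = proj₁ (c′ η η>0)

  fromℚ-halves : ∀ ε → fromℚ (ε ℚ.* ½) + fromℚ (ε ℚ.* ½) ≈ fromℚ ε
  fromℚ-halves ε = ≈-trans (≈-sym (fromℚ-+ (ε ℚ.* ½) (ε ℚ.* ½))) (≡⇒≈ (cong fromℚ (Q.halves ε)))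

  converges-unique : ∀ {T I J} → Converges T I → Converges T J → I ≈ J
  converges-unique {T} {I} {J} c c′ = x-y≈0⇒x≈y (∣x∣≤0⇒x≈0 (≤-closed bound))
    where
    bound : ∀ ε .{{_ : Positive ε}} → ∣ I - J ∣ ≤ 0ℝ + fromℚ ε
    bound ε = let K₀ , f = converges₂ {T} {T} {I} {J} c c′ (ε ℚ.* ½) (half>0 ε)
                  n₀ , g = f K₀ ℕ.≤-refl
                  p , q  = g n₀ ℕ.≤-refl in
      ≤-trans (∣∣-resp (solve 3 (λ t i j → (t :- j) :- (t :- i) := i :- j) ≈-refl (T K₀ n₀) I J)
        (∣∣-sub q p))
        (≈⇒≤ (≈-trans (fromℚ-halves ε) (≈-sym (+-identityˡ (fromℚ ε)))))

  converges-scale-sub : ∀ {T T′ I I′} a → Converges T I → Converges T′ I′ →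
    Converges (λ K n → a * T K n - T′ K n) (a * I - I′)
  converges-scale-sub {T} {T′} {I} {I′} a c c′ ε ε>0 = proj₁ both , λ K p →
    proj₁ (proj₂ both K p) , λ n q → bound K n (proj₂ (proj₂ both K p) n q)
    where
    rb : Σ[ B ∈ ℚ ] Positive B × ∣ a ∣ ≤ fromℚ B
    rb = rational-bound a
    B : ℚ
    B = proj₁ rb
    B+1>0 : Positive (B ℚ.+ 1ℚ)
    B+1>0 = ℚ.pos+pos⇒pos B {{proj₁ (proj₂ rb)}} 1ℚ
    i η : ℚ
    i = Q.inv (B ℚ.+ 1ℚ) B+1>0
    η = i ℚ.* ε
    η>0 : Positive η
    η>0 = ℚ.pos*pos⇒pos i {{Q.inv-pos (B ℚ.+ 1ℚ) B+1>0}} ε {{ε>0}}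
    both : ∃[ K₀ ] ∀ K → K₀ ℕ.≤ K → ∃[ n₀ ] ∀ n → n₀ ℕ.≤ n → ∣ T K n - I ∣ ≤ fromℚ η × ∣ T′ K
      n - I′ ∣ ≤ fromℚ η
    both = converges₂ {T} {T′} {I} {I′} c c′ η η>0
    total : fromℚ B * fromℚ η + fromℚ η ≈ fromℚ ε
    total = begin-equality
      fromℚ B * fromℚ η + fromℚ η      ≈⟨ solve 2 (λ b e → b :* e :+ e := (b :+ con 1ℚ) :* e)
        ≈-refl (fromℚ B) (fromℚ η) ⟩
      (fromℚ B + 1ℝ) * fromℚ η         ≈⟨ *-congʳ (fromℚ η) (fromℚ-+ B 1ℚ) ⟨
      fromℚ (B ℚ.+ 1ℚ) * fromℚ η       ≈⟨ fromℚ-* (B ℚ.+ 1ℚ) η ⟨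
      fromℚ ((B ℚ.+ 1ℚ) ℚ.* η)         ≈⟨ ≡⇒≈ (cong fromℚ (trans (sym (ℚ.*-assoc (B ℚ.+ 1ℚ) i ε))
                                           (trans (cong (ℚ._* ε) (trans (ℚ.*-comm (B ℚ.+ 1ℚ) i)
                                             (Q.inv-*ˡ (B ℚ.+ 1ℚ) B+1>0))) (ℚ.*-identityˡ ε)))) ⟩
      fromℚ ε                          ∎
      where open ≤-R
    bound : ∀ K n → ∣ T K n - I ∣ ≤ fromℚ η × ∣ T′ K n - I′ ∣ ≤ fromℚ η →
      ∣ (a * T K n - T′ K n) - (a * I - I′) ∣ ≤ fromℚ ε
    bound K n (p , q) = ∣∣-resp
      (solve 5 (λ a t i t′ i′ → a :* (t :- i) :- (t′ :- i′) := (a :* t :- t′) :- (a :* i :- i′))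
        ≈-refl a (T K n) I (T′ K n) I′)
      (≤-trans (∣∣-sub (∣∣-* (proj₂ (proj₂ rb)) p) q) (≈⇒≤ total))

  converges-lower : ∀ {T I} a K₁ → (∀ K n → K₁ ℕ.≤ K → a ≤ T K n) → Converges T I → a ≤ I
  converges-lower {T} {I} a K₁ h c = ≤-closed bound
    where
    bound : ∀ ε .{{_ : Positive ε}} → a ≤ I + fromℚ ε
    bound ε = let K₀ , f = c ε (ℚ.positive (ℚ.positive⁻¹ ε))
                  K = K₁ ℕ.⊔ K₀
                  n₀ , g = f K (ℕ.m≤n⊔m K₁ K₀) in
      ≤-trans (h K n₀ (ℕ.m≤m⊔n K₁ K₀))
        (≤-trans (≈⇒≤ (solve 2 (λ t i → t := i :+ (t :- i)) ≈-refl (T K n₀) I))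
        (+-mono-≤ ≤-refl (≤-trans (x≤∣x∣ _) (g n₀ ℕ.≤-refl))))

  gamma-converges : ∀ Γ → D.IsGammaFunction Γ → ∀ x → Converges (gammaSum (real x)) (Γ x)
  gamma-converges Γ isΓ x = converges-cong (λ K n → ∑-cong (gridSize K n) λ k _ →
    integrand-node x K n k)
    (improper⇒converges (λ t → t D.^ʳ (real x D.- D.1ℝ) D.* D.exp (D.- real t)) (integrand x) (Γ x)
      (integrand-def x) (isΓ x))

  weight-cong : ∀ {x y s t} → x ≈ y → s ≈ t → weight x s ≈ weight y t
  weight-cong h k = exp-cong (sub-cong (*-cong h k) (exp-cong k))

  weight≤ : ∀ {x s κ} → 0ℝ ≤ x → s ≤ κ → weight x s ≤ exp (x * κ)
  weight≤ {x} {s} {κ} 0≤x h = exp-mono-≤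
    (≤-cert (x * (κ - s) + exp s) (0≤+ (0≤* 0≤x (0≤- h)) (<⇒≤ (0<exp s)))
    (solve 4 (λ x s k e → x :* k := (x :* s :- e) :+ (x :* (k :- s) :+ e)) ≈-refl x s κ (exp s)))

  module _ (x : ℝ) (0≤x : 0ℝ ≤ x) (K : ℕ) where
    private
      -- `Y` times the step bounds the change of the exponent x s - exp s from one node to the next.
      -- `R` collects the two second-order errors of a cell: `growth` against the step, and `exp`
      -- against its linear part.
      κ Y R : ℝ
      κ = fromℕ K
      Y = x + exp κ * L₁
      R = exp (x * κ) * (x * C₁ + C₁ * (Y * Y))

      summand : ℕ → ℕ → ℝ
      summand n k = x * (weight x (node K n k) * growth n) - weight (x + 1ℝ) (node K n k) * growth n

      increment : ℕ → ℕ → ℝ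
      increment n k = weight x (node K n (suc k)) - weight x (node K n k)

    -- With t = exp s, the function F = weight x satisfies F′ = (x - t) F, and the
    -- left side of the integration by parts has the integrand (x - t) F.
    summand≈increment : ∀ n k → Y * step n ≤ 1ℝ → k ℕ.< gridSize K n →
      ∣ summand n k - increment n k ∣ ≤ R * (step n * step n)
    summand≈increment n k Yh≤1 k<N = ∣∣-resp (≈-sym identity)
      (≤-trans (∣∣-* ∣W∣ (∣∣-sub (∣∣-* (≈⇒≤ (0≤⇒∣x∣≈x 0≤x)) (growth-step n))
          (≤-trans (exp-near-0 y (≤-trans ∣y∣ Yh≤1)) (*-monoˡ-≤ 0≤C₁ (∣∣-square ∣y∣)))))
        (≈⇒≤ (solve 5 (λ e x c y h → e :* (x :* (c :* (h :* h)) :+ c :* ((y :* h) :* (y :* h))) :=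
          e :* (x :* c :+ c :* (y :* y)) :* (h :* h)) ≈-refl (exp (x * κ)) x C₁ Y h)))
      where
      s t g h y W : ℝ
      s = node K n k
      t = exp s
      g = growth n
      h = step n
      y = x * h - t * g
      W = weight x s
      s≤κ : s ≤ κ
      s≤κ = node≤ K n k (ℕ.<⇒≤ k<N)
      ∣W∣ : ∣ W ∣ ≤ exp (x * κ)
      ∣W∣ = ≤-trans (≈⇒≤ (0≤⇒∣x∣≈x (<⇒≤ (0<exp _)))) (weight≤ 0≤x s≤κ)
      0≤g : 0ℝ ≤ g
      0≤g = ≤-trans (0≤step n) (step≤growth n)
      ∣y∣ : ∣ y ∣ ≤ Y * h
      ∣y∣ = ≤-trans (∣∣-sub (∣∣-* (≈⇒≤ (0≤⇒∣x∣≈x 0≤x)) (∣step∣≤step n))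
          (∣∣-* (≤-trans (≈⇒≤ (0≤⇒∣x∣≈x (<⇒≤ (0<exp s)))) (exp-mono-≤ s≤κ))
            (≤-trans (≈⇒≤ (0≤⇒∣x∣≈x 0≤g)) (growth≤ n))))
        (≈⇒≤ (solve 4 (λ x h e l → x :* h :+ e :* (l :* h) := (x :+ e :* l) :* h) ≈-refl x h
          (exp κ) L₁))
      W-suc : weight (x + 1ℝ) s ≈ W * t
      W-suc = ≈-trans (exp-cong (solve 3 (λ x s t → (x :+ con 1ℚ) :* s :- t := (x :* s :- t) :+ s)
        ≈-refl x s t)) (exp-+ (x * s - t) s)
      W-next : weight x (node K n (suc k)) ≈ W * exp y
      W-next = ≈-trans (exp-cong (≈-trans (sub-cong (*-congˡ x (node-suc K n k))
        (≈-trans (exp-cong (node-suc K n k)) (exp-+ s h)))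
          (solve 5 (λ x s h t e → x :* (s :+ h) :- t :* e :=
            (x :* s :- t) :+ (x :* h :- t :* (e :- con 1ℚ))) ≈-refl x s h t (exp h))))
        (exp-+ (x * s - t) y)
      -- Divided by `W`, the summand is x g - t g and the increment is exp y - 1 with y = x h - t g.
      -- The terms t g cancel, leaving only second-order quantities.
      identity : summand n k - increment n k ≈ W * (x * (g - h) - ((exp y - 1ℝ) - y))
      identity = ≈-trans (sub-cong (sub-cong ≈-refl (*-congʳ g W-suc)) (sub-cong W-next ≈-refl))
        (solve 6 (λ x W g t e h → (x :* (W :* g) :- W :* t :* g) :- (W :* e :- W) :=
          W :* (x :* (g :- h) :- ((e :- con 1ℚ) :- (x :* h :- t :* g)))) ≈-refl x W g t (exp y) h)

    -- The increments telescope to the boundary terms. There are 2K/h cells with error of order h²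
    -- each, so for fixed `K` the total error is of order h.
    gammaSum-by-parts : ∀ n → Y * step n ≤ 1ℝ →
      ∣ (x * gammaSum x K n - gammaSum (x + 1ℝ) K n) - (weight x κ - weight x (- κ))
        ∣ ≤ R * (κ + κ) * step n
    gammaSum-by-parts n Yh≤1 = ∣∣-resp
      (≈-trans (∑-sub N (summand n) (increment n)) (sub-cong
        (≈-trans (∑-sub N (λ k → x * (weight x (node K n k) * growth n))
          (λ k → weight (x + 1ℝ) (node K n k) * growth n))
          (sub-cong (∑-scale N x (λ k → weight x (node K n k) * growth n)) ≈-refl))
        (≈-trans (∑-telescope N (λ k → weight x (node K n k)))
          (sub-cong (weight-cong ≈-refl (node-last K n)) (weight-cong ≈-refl (node-zero K n))))))
      (≤-trans (∑-∣∣-≤ N (λ k k<N → summand≈increment n k Yh≤1 k<N))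
        (≈⇒≤ (≈-trans (solve 3 (λ m r h → m :* (r :* (h :* h)) := r :* (m :* h) :* h)
          ≈-refl (fromℕ N) R (step n))
          (*-congʳ (step n) (*-congˡ R (gridSize*step K n))))))
      where
      N : ℕ
      N = gridSize K n

    by-parts-eventually : ∀ η → Positive η → ∃[ n₀ ] ∀ n → n₀ ℕ.≤ n →
      ∣ (x * gammaSum x K n - gammaSum (x + 1ℝ) K n) - (weight x κ - weight x (- κ)) ∣ ≤ fromℚ η
    by-parts-eventually η η>0 = ev-map₂ (λ n p q → ≤-trans (gammaSum-by-parts n p) q)
      (step-small Y 1ℚ _) (step-small (R * (κ + κ)) η η>0)

  -- From exp κ ≥ (1 + κ/2)² ≥ κ²/4 ≥ (x + 1) κ once κ ≥ 4 (x + 1), the exponent x κ - exp κ is at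
  -- most -κ.
  weight-right : ∀ x → 0ℝ ≤ x → ∃[ K₀ ] ∀ K → K₀ ℕ.≤ K → weight x (fromℕ K) ≤ step K
  weight-right x 0≤x = proj₁ cl , λ K p → ≤-trans (exp-mono-≤ (exponent K p)) (exp-neg-fromℕ≤step K)
    where
    4q : ℚ
    4q = + 4 ℚ./ 1
    cl : ∃[ m ] fromℚ 4q * (x + 1ℝ) ≤ fromℕ m
    cl = ceiling (fromℚ 4q * (x + 1ℝ))
    exponent : ∀ K → proj₁ cl ℕ.≤ K → x * fromℕ K - exp (fromℕ K) ≤ - fromℕ K
    exponent K p = ≤-cert ((exp κ - (1ℝ + κ * ½ℝ) * (1ℝ + κ * ½ℝ)) + ((1ℝ + κ) + fromℚ
      (½ ℚ.* ½) * (κ * (κ - fromℚ 4q * (x + 1ℝ)))))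
      (0≤+ (0≤- sq) (0≤+ (0≤+ (fromℚ-mono (ℚ.nonNegative⁻¹ 1ℚ)) 0≤κ)
        (0≤* (fromℚ-mono (ℚ.nonNegative⁻¹ (½ ℚ.* ½)))
        (0≤* 0≤κ (0≤- (≤-trans (proj₂ cl) (fromℕ-mono p)))))))
      (solve 3 (λ x k e → :- k := (x :* k :- e) :+
        ((e :- (con 1ℚ :+ k :* con ½) :* (con 1ℚ :+ k :* con ½)) :+ ((con 1ℚ :+ k) :+ con
        (½ ℚ.* ½) :* (k :* (k :- con 4q :* (x :+ con 1ℚ)))))) ≈-refl x κ (exp κ))
      where
      κ : ℝ
      κ = fromℕ K
      0≤κ : 0ℝ ≤ κ
      0≤κ = 0≤fromℕ K
      0≤1+½κ : 0ℝ ≤ 1ℝ + κ * ½ℝ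
      0≤1+½κ = 0≤+ (fromℚ-mono (ℚ.nonNegative⁻¹ 1ℚ)) (0≤* 0≤κ 0≤½ℝ)
      sq : (1ℝ + κ * ½ℝ) * (1ℝ + κ * ½ℝ) ≤ exp κ
      sq = ≤-trans (*-mono-≤ 0≤1+½κ (<⇒≤ (0<exp _)) (1+x≤exp (κ * ½ℝ)) (1+x≤exp (κ * ½ℝ)))
        (≈⇒≤ (≈-sym (exp-halves κ)))

  -- Here the weight is at most exp (-xκ) ≤ 1/(1 + xκ), and (1 + 1/x)(1 + xκ) ≥ 1 + κ. Positivity of
  -- `x` is essential: it makes the integral converge at 0.
  weight-left : ∀ x → 0ℝ < x → ∃[ c ] ∀ K → weight x (- fromℕ K) ≤ c * step K
  weight-left x 0<x = c , λ K → ≤-trans (exp-mono-≤ (exponent K))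
    (*-cancel-≤ (0<fromℕ-suc K) (bound K))
    where
    open ≤-R
    r : ∃[ i ] 0ℝ < i × x * i ≈ 1ℝ
    r = recip x 0<x
    i c : ℝ
    i = proj₁ r
    c = 1ℝ + i
    0≤i : 0ℝ ≤ i
    0≤i = <⇒≤ (proj₁ (proj₂ r))
    exponent : ∀ K → x * (- fromℕ K) - exp (- fromℕ K) ≤ - (x * fromℕ K)
    exponent K = ≤-cert (exp (- fromℕ K)) (<⇒≤ (0<exp _))
      (solve 3 (λ x k e → :- (x :* k) := (x :* (:- k) :- e) :+ e) ≈-refl x (fromℕ K)
        (exp (- fromℕ K)))
    bound : ∀ K → fromℕ (suc K) * exp (- (x * fromℕ K)) ≤ fromℕ (suc K) * (c * step K)
    bound K = begin
      fromℕ (suc K) * e          ≈⟨ *-congʳ e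
        (≈-trans (fromℕ-suc K) (+-cong ≈-refl (≈-trans (≈-sym (*-identityˡ κ))
        (*-congʳ κ (≈-sym (proj₂ (proj₂ r))))))) ⟩
      (1ℝ + x * i * κ) * e       ≤⟨ ≤-cert (e * (x * κ + i))
        (0≤* (<⇒≤ (0<exp _)) (0≤+ (0≤* (<⇒≤ 0<x) (0≤fromℕ K)) 0≤i))
                                      (solve 4 (λ x i k e → (con 1ℚ :+ i) :*
                                        (e :* (con 1ℚ :+ x :* k)) :=
                                        (con 1ℚ :+ x :* i :* k) :* e :+ e :* (x :* k :+ i)) ≈-refl
                                        x i κ e) ⟩
      c * (e * (1ℝ + x * κ))     ≤⟨ *-monoˡ-≤ (0≤+ (fromℚ-mono (ℚ.nonNegative⁻¹ 1ℚ)) 0≤i)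
        (exp-neg-≤ (x * κ)) ⟩
      c * 1ℝ                     ≈⟨ *-congˡ c (fromℕ-suc*step K) ⟨
      c * (fromℕ (suc K) * step K) ≈⟨ solve 3 (λ c m h → c :* (m :* h) := m :* (c :* h))
        ≈-refl c (fromℕ (suc K)) (step K) ⟩
      fromℕ (suc K) * (c * step K) ∎
      where
      κ e : ℝ
      κ = fromℕ K
      e = exp (- (x * κ))

  boundary-vanishes : ∀ x → 0ℝ < x → ∀ η → Positive η → ∃[ K₀ ] ∀ K → K₀ ℕ.≤ K →
    ∣ weight x (fromℕ K) - weight x (- fromℕ K) ∣ ≤ fromℚ η
  boundary-vanishes x 0<x η η>0 = ev-map₂ (λ K p q → ≤-trans
        (∣∣-sub (≤-trans (≈⇒≤ (0≤⇒∣x∣≈x (<⇒≤ (0<exp _)))) p)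
                (≤-trans (≈⇒≤ (0≤⇒∣x∣≈x (<⇒≤ (0<exp _)))) (proj₂ wl K)))
        (≤-trans (≈⇒≤ (solve 2 (λ h c → h :+ c :* h := (con 1ℚ :+ c) :* h) ≈-refl (step K)
          (proj₁ wl))) q))
      (weight-right x (<⇒≤ 0<x)) (step-small (1ℝ + proj₁ wl) η η>0)
    where
    wl : ∃[ c ] ∀ K → weight x (- fromℕ K) ≤ c * step K
    wl = weight-left x 0<x

  -- The error of the integration by parts vanishes in n for fixed `K`, while the boundary terms
  -- depend on `K` alone and vanish with it; this is the order of limits in `Converges`.
  by-parts-converges : ∀ x → 0ℝ < x → Converges (λ K n → x * gammaSum x K n - gammaSum (x + 1ℝ) K
    n) 0ℝ
  by-parts-converges x 0<x ε ε>0 = proj₁ bv , λ K p →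
    let n₀ , f = by-parts-eventually x (<⇒≤ 0<x) K (ε ℚ.* ½) (half>0 ε {{ε>0}}) in
    n₀ , λ n q → ∣∣-resp (solve 2 (λ a b → (a :- b) :+ b := a :- con 0ℚ)
      ≈-refl (x * gammaSum x K n - gammaSum (x + 1ℝ) K n)
      (weight x (fromℕ K) - weight x (- fromℕ K)))
      (≤-trans (∣∣-+ (f n q) (proj₂ bv K p)) (≈⇒≤ (fromℚ-halves ε)))
    where
    bv : ∃[ K₀ ] ∀ K → K₀ ℕ.≤ K → ∣ weight x (fromℕ K) - weight x (- fromℕ K) ∣ ≤ fromℚ (ε ℚ.* ½)
    bv = boundary-vanishes x 0<x (ε ℚ.* ½) (half>0 ε {{ε>0}})

  -- The nodes in [0, 1] already contribute a fixed positive amount.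
  gammaSum-lower : ∀ x → 0ℝ ≤ x → ∀ K n → 1 ℕ.≤ K → exp (- exp 1ℝ) ≤ gammaSum x K n
  gammaSum-lower x 0≤x (suc K′) n _ = begin
      c                                              ≈⟨ solve 1 (λ c → c := con 1ℚ :* c) ≈-refl c ⟩
      1ℝ * c                                         ≈⟨ *-congʳ c (fromℕ-suc*step n) ⟨
      fromℕ (suc n) * step n * c
        ≈⟨ solve 3 (λ m h c → m :* h :* c := m :* (c :* h)) ≈-refl (fromℕ (suc n)) (step n) c ⟩
      fromℕ (suc n) * (c * step n)                   ≈⟨ ∑-const (suc n) (c * step n) ⟨
      ∑ (suc n) (λ _ → c * step n)
        ≤⟨ ∑-mono-≤ (suc n) (λ k k<n →
        *-mono-≤ (<⇒≤ (0<exp _)) (≤-trans (0≤step n) (step≤growth n)) (weight-middle k k<n)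
        (step≤growth n)) ⟩
      ∑ (suc n) (λ k → u (k ℕ.+ P))
        ≤⟨ ≤-cert (∑ (K′ ℕ.* suc n) (λ k → u (k ℕ.+ suc n ℕ.+ P)))
        (0≤∑ (K′ ℕ.* suc n) (λ k _ → 0≤u (k ℕ.+ suc n ℕ.+ P)))
        (∑-split (K′ ℕ.* suc n) (suc n) (λ k → u (k ℕ.+ P))) ⟩
      ∑ (K′ ℕ.* suc n ℕ.+ suc n) (λ k → u (k ℕ.+ P))
        ≈⟨ ≡⇒≈ (cong (λ m → ∑ m (λ k → u (k ℕ.+ P))) (ℕ.+-comm (K′ ℕ.* suc n) (suc n))) ⟩
      ∑ P (λ k → u (k ℕ.+ P))                        ≤⟨ ≤-cert (∑ P u) (0≤∑ P (λ k _ → 0≤u k))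
        (≈-trans (∑-split P P u) (+-comm (∑ P u) _)) ⟩
      ∑ (P ℕ.+ P) u
        ≈⟨ ≡⇒≈ (cong (λ m → ∑ m u) (sym (ℕ.*-distribʳ-+ (suc n) (suc K′) (suc K′)))) ⟩
      gammaSum x (suc K′) n                          ∎
    where
    open ≤-R
    c : ℝ
    c = exp (- exp 1ℝ)
    -- The index of the node s = 0. The n + 1 nodes from there on lie between 0 and 1, where x s -
    -- exp s ≥ -exp 1.
    P : ℕ
    P = suc K′ ℕ.* suc n
    u : ℕ → ℝ
    u k = weight x (node (suc K′) n k) * growth n
    0≤u : ∀ k → 0ℝ ≤ u k
    0≤u k = 0≤* (<⇒≤ (0<exp _)) (≤-trans (0≤step n) (step≤growth n))
    ∑-const : ∀ n c → ∑ n (λ _ → c) ≈ fromℕ n * c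
    ∑-const zero    c = solve 1 (λ c → con 0ℚ := con 0ℚ :* c) ≈-refl c
    ∑-const (suc n) c = ≈-trans (+-cong (∑-const n c) ≈-refl)
      (≈-trans (solve 2 (λ n c → n :* c :+ c := (con 1ℚ :+ n) :* c) ≈-refl (fromℕ n) c)
      (*-congʳ c (≈-sym (fromℕ-suc n))))
    node-middle : ∀ k → node (suc K′) n (k ℕ.+ P) ≈ fromℕ k * step n
    node-middle k = begin-equality
      - κ + fromℕ (k ℕ.+ P) * step n
        ≈⟨ +-cong ≈-refl (*-congʳ (step n)
        (≈-trans (fromℕ-+ k P) (+-cong ≈-refl (fromℕ-* (suc K′) (suc n))))) ⟩
      - κ + (fromℕ k + κ * fromℕ (suc n)) * step n
        ≈⟨ solve 4 (λ K k m h → :- K :+ (k :+ K :* m) :* h := k :* h :+ K :* (m :* h :- con 1ℚ))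
        ≈-refl κ (fromℕ k) (fromℕ (suc n)) (step n) ⟩
      fromℕ k * step n + κ * (fromℕ (suc n) * step n - 1ℝ)
        ≈⟨ +-cong ≈-refl (*-congˡ κ (sub-cong (fromℕ-suc*step n) ≈-refl)) ⟩
      fromℕ k * step n + κ * (1ℝ - 1ℝ)
        ≈⟨ solve 2 (λ a K → a :+ K :* (con 1ℚ :- con 1ℚ) := a) ≈-refl (fromℕ k * step n) κ ⟩
      fromℕ k * step n                                       ∎
      where
      κ : ℝ
      κ = fromℕ (suc K′)
    weight-middle : ∀ k → k ℕ.< suc n → c ≤ weight x (node (suc K′) n (k ℕ.+ P))
    weight-middle k k<n = ≤-trans
      (exp-mono-≤ (≤-cert (x * s + (exp 1ℝ - exp s)) (0≤+ (0≤* 0≤x 0≤s) (0≤- (exp-mono-≤ s≤1)))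
        (solve 3 (λ a e f → a :- f := :- e :+ (a :+ (e :- f))) ≈-refl (x * s) (exp 1ℝ) (exp s))))
      (≈⇒≤ (weight-cong ≈-refl (≈-sym (node-middle k))))
      where
      s : ℝ
      s = fromℕ k * step n
      0≤s : 0ℝ ≤ s
      0≤s = 0≤* (0≤fromℕ k) (0≤step n)
      s≤1 : s ≤ 1ℝ
      s≤1 = ≤-trans (*-monoʳ-≤ (0≤step n) (fromℕ-mono (ℕ.<⇒≤ k<n))) (≈⇒≤ (fromℕ-suc*step n))

  module Gamma (Γ : ℝ⁺ → ℝ) (isΓ : D.IsGammaFunction Γ) where
    Γ>0 : ∀ x → 0ℝ < Γ x
    Γ>0 x = <-≤-trans (0<exp (- exp 1ℝ)) (converges-lower {gammaSum (real x)} (exp (- exp 1ℝ)) 1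
      (gammaSum-lower (real x) (<⇒≤ (real⁺>0 x))) (gamma-converges Γ isΓ x))

    -- `Γ` is an arbitrary function on pairs of a real and a witness. That it respects `≈` follows
    -- because its value is the limit of sums depending on the real alone.
    Γ-cong : ∀ x y → real x ≈ real y → Γ x ≈ Γ y
    Γ-cong x y h = converges-unique {gammaSum (real x)} (gamma-converges Γ isΓ x)
      (converges-cong {gammaSum (real y)} {gammaSum (real x)} (λ K n → ∑-cong (gridSize K n) λ k
        _ → *-congʳ (growth n) (weight-cong (≈-sym h) ≈-refl))
        (gamma-converges Γ isΓ y))

    Γ-suc : ∀ x y → real y ≈ real x + 1ℝ → Γ y ≈ real x * Γ x
    Γ-suc x y h = ≈-sym (x-y≈0⇒x≈y
      (converges-unique {λ K n → real x * gammaSum (real x) K n - gammaSum (real x + 1ℝ) K n}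
      (converges-scale-sub {gammaSum (real x)} {gammaSum (real x + 1ℝ)} (real x)
        (gamma-converges Γ isΓ x)
        (converges-cong {gammaSum (real y)} {gammaSum (real x + 1ℝ)} (λ K n →
          ∑-cong (gridSize K n) λ k _ → *-congʳ (growth n) (weight-cong h ≈-refl))
          (gamma-converges Γ isΓ y)))
      (by-parts-converges (real x) (real⁺>0 x))))

  -- Determinants

  -- altSum t = t₀ - t₁ + t₂ - …
  altSum : ∀ {n} → (Fin n → ℝ) → ℝ
  altSum {zero}  t = 0ℝ
  altSum {suc n} t = t Fin.zero - altSum (t ∘ Fin.suc)

  SquareMatrix : ℕ → Set
  SquareMatrix n = Fin n → Fin n → ℝ

  minor : ∀ {n} → SquareMatrix (suc n) → Fin (suc n) → SquareMatrix n
  minor A j i k = A (Fin.suc i) (punchIn j k)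

  det : ∀ {n} → SquareMatrix n → ℝ
  det {zero}  A = 1ℝ
  det {suc n} A = altSum λ j → A Fin.zero j * det (minor A j)

  altSum-cong : ∀ {n} {t u : Fin n → ℝ} → (∀ j → t j ≈ u j) → altSum t ≈ altSum u
  altSum-cong {zero}  h = ≈-refl
  altSum-cong {suc n} h = sub-cong (h Fin.zero) (altSum-cong (λ j → h (Fin.suc j)))

  altSum-linear : ∀ {n} a b (t u : Fin n → ℝ) → altSum (λ j → a * t j + b * u j) ≈ a * altSum
    t + b * altSum u
  altSum-linear {zero}  a b t u = solve 2 (λ a b → con 0ℚ := a :* con 0ℚ :+ b :* con 0ℚ) ≈-refl a b
  altSum-linear {suc n} a b t u =
    ≈-trans (sub-cong ≈-refl (altSum-linear a b (t ∘ Fin.suc) (u ∘ Fin.suc)))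
    (solve 6 (λ a b t u x y → (a :* t :+ b :* u) :- (a :* x :+ b :* y) :=
      a :* (t :- x) :+ b :* (u :- y)) ≈-refl a b
      (t Fin.zero) (u Fin.zero) (altSum (t ∘ Fin.suc)) (altSum (u ∘ Fin.suc)))

  altSum-zero : ∀ {n} {t : Fin n → ℝ} → (∀ j → t j ≈ 0ℝ) → altSum t ≈ 0ℝ
  altSum-zero {zero}  h = ≈-refl
  altSum-zero {suc n} h = ≈-trans (sub-cong (h Fin.zero) (altSum-zero (λ j → h (Fin.suc j))))
    (solve 0 (con 0ℚ :- con 0ℚ := con 0ℚ) ≈-refl)

  altSum-scale : ∀ {n} a (t : Fin n → ℝ) → altSum (λ j → a * t j) ≈ a * altSum t
  altSum-scale a t = ≈-trans (altSum-cong (λ j → solve 2 (λ a t → a :* t := a :* t :+ con 0ℚ :* t)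
    ≈-refl a (t j)))
    (≈-trans (altSum-linear a 0ℝ t t) (solve 2 (λ a t → a :* t :+ con 0ℚ :* t := a :* t)
      ≈-refl a (altSum t)))

  -- Adjacent terms carry opposite signs, so the two that may be nonzero cancel.
  altSum-adjacent : ∀ {n} (q : Fin n) (t : Fin (suc n) → ℝ) → t (inject₁ q) ≈ t (Fin.suc q) →
    (∀ j → j ≢ inject₁ q → j ≢ Fin.suc q → t j ≈ 0ℝ) → altSum t ≈ 0ℝ
  altSum-adjacent Fin.zero t e h = ≈-trans
    (sub-cong e (sub-cong ≈-refl (altSum-zero (λ j → h (Fin.suc (Fin.suc j)) (λ ()) (λ ())))))
    (solve 1 (λ x → x :- (x :- con 0ℚ) := con 0ℚ) ≈-refl (t (Fin.suc Fin.zero)))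
  altSum-adjacent (Fin.suc q) t e h = ≈-trans
    (sub-cong (h Fin.zero (λ ()) (λ ())) (altSum-adjacent q (t ∘ Fin.suc) e λ j p r →
      h (Fin.suc j) (p ∘ Fin.suc-injective) (r ∘ Fin.suc-injective)))
    (solve 0 (con 0ℚ :- con 0ℚ := con 0ℚ) ≈-refl)

  det-cong : ∀ {n} {A B : SquareMatrix n} → (∀ i j → A i j ≈ B i j) → det A ≈ det B
  det-cong {zero}  h = ≈-refl
  det-cong {suc n} h = altSum-cong λ j → *-cong (h Fin.zero j) (det-cong λ i k →
    h (Fin.suc i) (punchIn j k))

  det-linear : ∀ {n} (p : Fin n) a b (A B C : SquareMatrix n) →
    (∀ i j → j ≢ p → A i j ≈ B i j) → (∀ i j → j ≢ p → A i j ≈ C i j) →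
      (∀ i → A i p ≈ a * B i p + b * C i p) →
    det A ≈ a * det B + b * det C
  det-linear {suc n} p a b A B C AB AC Ap = ≈-trans (altSum-cong term)
    (altSum-linear a b (λ j → B Fin.zero j * det (minor B j))
      (λ j → C Fin.zero j * det (minor C j)))
    where
    term : ∀ j → A Fin.zero j * det (minor A j) ≈ a * (B Fin.zero j * det (minor B j)) + b *
      (C Fin.zero j * det (minor C j))
    term j with j Fin.≟ p
    ... | yes refl = ≈-trans (*-congʳ (det (minor A j)) (Ap Fin.zero))
      (≈-trans (solve 5 (λ a x b y d → (a :* x :+ b :* y) :* d := a :* (x :* d) :+ b :* (y :* d))
        ≈-refl a (B Fin.zero j) b (C Fin.zero j) (det (minor A j)))
        (+-cong (*-congˡ a (*-congˡ (B Fin.zero j) (det-cong λ i k → AB (Fin.suc i) (punchIn j k)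
          (Fin.punchInᵢ≢i j k))))
                (*-congˡ b (*-congˡ (C Fin.zero j) (det-cong λ i k → AC (Fin.suc i) (punchIn j k)
                  (Fin.punchInᵢ≢i j k))))))
    ... | no j≢p = ≈-trans (*-congˡ (A Fin.zero j) (det-linear (punchOut j≢p) a b (minor A j)
        (minor B j) (minor C j)
          (λ i k k≢ → AB (Fin.suc i) (punchIn j k) (avoid k k≢)) (λ i k k≢ →
            AC (Fin.suc i) (punchIn j k) (avoid k k≢))
          (λ i → subst (λ q → A (Fin.suc i) q ≈ a * B (Fin.suc i) q + b * C (Fin.suc i) q)
            (sym (Fin.punchIn-punchOut j≢p)) (Ap (Fin.suc i)))))
        (≈-trans (solve 5 (λ x a d b e → x :* (a :* d :+ b :* e) := a :* (x :* d) :+ b :* (x :* e))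
          ≈-refl (A Fin.zero j) a (det (minor B j)) b (det (minor C j)))
          (+-cong (*-congˡ a (*-congʳ (det (minor B j)) (AB Fin.zero j j≢p)))
            (*-congˡ b (*-congʳ (det (minor C j)) (AC Fin.zero j j≢p)))))
      where
      avoid : ∀ k → k ≢ punchOut j≢p → punchIn j k ≢ p
      avoid k k≢ e = k≢ (Fin.punchIn-injective j k (punchOut j≢p)
        (trans e (sym (Fin.punchIn-punchOut j≢p))))

  -- Deleting one of two neighbouring columns leaves the other in the same position, whichever is
  -- deleted.
  punchIn-adjacent : ∀ {n} (q : Fin n) k →
    (punchIn (inject₁ q) k ≡ punchIn (Fin.suc q) k) ⊎ (punchIn (inject₁ q) k ≡ Fin.suc q × punchIn
      (Fin.suc q) k ≡ inject₁ q)
  punchIn-adjacent Fin.zero Fin.zero = inj₂ (refl , refl)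
  punchIn-adjacent Fin.zero (Fin.suc k) = inj₁ refl
  punchIn-adjacent (Fin.suc q) Fin.zero = inj₁ refl
  punchIn-adjacent (Fin.suc q) (Fin.suc k) with punchIn-adjacent q k
  ... | inj₁ e = inj₁ (cong Fin.suc e)
  ... | inj₂ (e , f) = inj₂ (cong Fin.suc e , cong Fin.suc f)

  punchIn-avoid-adjacent : ∀ {n} (q : Fin (suc n)) j → j ≢ inject₁ q → j ≢ Fin.suc q →
    ∃[ q′ ] punchIn j (inject₁ q′) ≡ inject₁ q × punchIn {suc n} j (Fin.suc q′) ≡ Fin.suc q
  punchIn-avoid-adjacent Fin.zero Fin.zero h g = ⊥-elim (h refl)
  punchIn-avoid-adjacent Fin.zero (Fin.suc Fin.zero) h g = ⊥-elim (g refl)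
  punchIn-avoid-adjacent {suc n} Fin.zero (Fin.suc (Fin.suc j)) h g = Fin.zero , refl , refl
  punchIn-avoid-adjacent {suc n} (Fin.suc q) Fin.zero h g = q , refl , refl
  punchIn-avoid-adjacent {suc n} (Fin.suc q) (Fin.suc j) h g =
    let q′ , e , f = punchIn-avoid-adjacent q j (h ∘ cong Fin.suc) (g ∘ cong Fin.suc) in
    Fin.suc q′ , cong Fin.suc e , cong Fin.suc f

  -- In the expansion along the first row the two equal columns have equal minors and cancel; every
  -- other minor still contains both columns, again adjacent. Adjacent columns suffice because each
  -- column is only ever reduced by its predecessor.
  det-adjacent : ∀ {n} (q : Fin n) (A : SquareMatrix (suc n)) →
    (∀ i → A i (inject₁ q) ≈ A i (Fin.suc q)) → det A ≈ 0ℝ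
  det-adjacent {suc n} q A h = altSum-adjacent q (λ j → A Fin.zero j * det (minor A j))
    (*-cong (h Fin.zero) (det-cong same)) λ j p r →
      ≈-trans (*-congˡ (A Fin.zero j) (zero-minor j p r))
      (solve 1 (λ x → x :* con 0ℚ := con 0ℚ) ≈-refl (A Fin.zero j))
    where
    same : ∀ i k → minor A (inject₁ q) i k ≈ minor A (Fin.suc q) i k
    same i k with punchIn-adjacent q k
    ... | inj₁ e = ≡⇒≈ (cong (A (Fin.suc i)) e)
    ... | inj₂ (e , f) = ≈-trans (≡⇒≈ (cong (A (Fin.suc i)) e)) (≈-trans (≈-sym (h (Fin.suc i)))
        (≡⇒≈ (cong (A (Fin.suc i)) (sym f))))
    zero-minor : ∀ j → j ≢ inject₁ q → j ≢ Fin.suc q → det (minor A j) ≈ 0ℝ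
    zero-minor j p r = let q′ , e , f = punchIn-avoid-adjacent q j p r in
      det-adjacent q′ (minor A j) λ i → ≈-trans (≡⇒≈ (cong (A (Fin.suc i)) e))
        (≈-trans (h (Fin.suc i)) (≡⇒≈ (cong (A (Fin.suc i)) (sym f))))

  ∏ : ∀ {n} → (Fin n → ℝ) → ℝ
  ∏ {zero}  r = 1ℝ
  ∏ {suc n} r = r Fin.zero * ∏ (r ∘ Fin.suc)

  det-scale-rows : ∀ {n} (r : Fin n → ℝ) (A : SquareMatrix n) → det (λ i j → r i * A i j) ≈ ∏
    r * det A
  det-scale-rows {zero}  r A = solve 0 (con 1ℚ := con 1ℚ :* con 1ℚ) ≈-refl
  det-scale-rows {suc n} r A = ≈-trans
    (altSum-cong λ j → ≈-trans (*-congˡ (r Fin.zero * A Fin.zero j)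
      (det-scale-rows (r ∘ Fin.suc) (minor A j)))
      (solve 4 (λ r a p d → (r :* a) :* (p :* d) := (r :* p) :* (a :* d)) ≈-refl (r Fin.zero)
        (A Fin.zero j) (∏ (r ∘ Fin.suc)) (det (minor A j))))
    (altSum-scale (∏ r) (λ j → A Fin.zero j * det (minor A j)))

  0<1 : 0ℝ < 1ℝ
  0<1 = fromℚ-pos 1ℚ

  0<∏ : ∀ {n} {r : Fin n → ℝ} → (∀ i → 0ℝ < r i) → 0ℝ < ∏ r
  0<∏ {zero}  h = 0<1
  0<∏ {suc n} h = 0<* (h Fin.zero) (0<∏ (λ i → h (Fin.suc i)))

  -- Multilinear alternating functions: column operations and positivity on cones

  Column : ℕ → Set
  Column n = Fin n → ℝ

  -- The inductions below fix the leading columns of a determinant. What remains is a function of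
  -- fewer than n columns and no longer a determinant, hence the abstraction with `k` independent of
  -- `n`.
  record MultilinearAlternating {n k} (F : (Fin k → Column n) → ℝ) : Set where
    field
      F-cong   : ∀ {c d} → (∀ j i → c j i ≈ d j i) → F c ≈ F d
      F-linear : ∀ p a b c d e → (∀ j → j ≢ p → ∀ i → c j i ≈ d j i) →
        (∀ j → j ≢ p → ∀ i → c j i ≈ e j i) →
                 (∀ i → c p i ≈ a * d p i + b * e p i) → F c ≈ a * F d + b * F e
      F-adjacent : ∀ c p q → toℕ q ≡ suc (toℕ p) → (∀ i → c p i ≈ c q i) → F c ≈ 0ℝ

  open MultilinearAlternating

  infixr 5 _∷_
  _∷_ : ∀ {n k} → Column n → (Fin k → Column n) → Fin (suc k) → Column n
  (v ∷ c) Fin.zero    = v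
  (v ∷ c) (Fin.suc j) = c j

  det-multilinearAlternating : ∀ {n} → MultilinearAlternating {n} {n} (λ c → det (λ i j → c j i))
  det-multilinearAlternating {n} = record
    { F-cong     = λ h → det-cong λ i j → h j i
    ; F-linear   = λ p a b c d e cd ce h → det-linear p a b _ _ _ (λ i j q → cd j q i) (λ i j q →
      ce j q i) h
    ; F-adjacent = λ c → adjacent c
    }
    where
    adjacent : ∀ {n} (c : Fin n → Column n) p q → toℕ q ≡ suc (toℕ p) → (∀ i → c p i ≈ c q i) →
      det (λ i j → c j i) ≈ 0ℝ
    adjacent {suc n} c p (Fin.suc q) e h = det-adjacent q (λ i j → c j i) λ i →
      subst (λ r → c r i ≈ c (Fin.suc q) i)
        (Fin.toℕ-injective (trans (sym (ℕ.suc-injective e)) (sym (Fin.toℕ-inject₁ q)))) (h i)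

  module _ {n k} {F : (Fin (suc k) → Column n) → ℝ} (ma : MultilinearAlternating F) where

    fix-first : ∀ v → MultilinearAlternating (λ c → F (v ∷ c))
    fix-first v = record
      { F-cong     = λ h → F-cong ma λ { Fin.zero i → ≈-refl ; (Fin.suc j) i → h j i }
      ; F-linear   = λ p a b c d e cd ce h → F-linear ma (Fin.suc p) a b (v ∷ c) (v ∷ d) (v ∷ e)
          (λ { Fin.zero _ i → ≈-refl ; (Fin.suc j) q i → cd j (q ∘ cong Fin.suc) i })
          (λ { Fin.zero _ i → ≈-refl ; (Fin.suc j) q i → ce j (q ∘ cong Fin.suc) i }) h
      ; F-adjacent = λ c p q e h → F-adjacent ma (v ∷ c) (Fin.suc p) (Fin.suc q) (cong suc e) h
      }

    head∷tail : ∀ c → F c ≈ F (c Fin.zero ∷ (c ∘ Fin.suc))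
    head∷tail c = F-cong ma λ { Fin.zero i → ≈-refl ; (Fin.suc j) i → ≈-refl }

  subtractPrevious : ∀ {n k} → (Fin k → ℝ) → (Fin (suc k) → Column n) → Fin (suc k) → Column n
  subtractPrevious ρ c Fin.zero      = c Fin.zero
  subtractPrevious ρ c (Fin.suc j) i = c (Fin.suc j) i - ρ j * c (inject₁ j) i

  -- Every subtraction uses the original predecessor. Splitting the second column by linearity gives
  -- a part in which it repeats the first and `F` vanishes, and a part in which it is unchanged;
  -- there the first column is fixed and induction applies.
  subtractPrevious-invariant : ∀ {n k} {F : (Fin (suc k) → Column n) → ℝ} →
    MultilinearAlternating F →
    ∀ ρ c → F (subtractPrevious ρ c) ≈ F c
  subtractPrevious-invariant {k = zero} ma ρ c = F-cong ma λ { Fin.zero i → ≈-refl }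
  subtractPrevious-invariant {n} {k = suc k} {F} ma ρ c = begin-equality
      F (subtractPrevious ρ c)        ≈⟨ F-linear ma (Fin.suc Fin.zero) 1ℝ (- ρ Fin.zero)
        (subtractPrevious ρ c) d e cd ce
                                           (λ i → solve 3 (λ x y r → x :- r :* y :=
                                             con 1ℚ :* x :+ :- r :* y) ≈-refl
                                             (c (Fin.suc Fin.zero) i) (c Fin.zero i) (ρ Fin.zero)) ⟩
      1ℝ * F d + - ρ Fin.zero * F e
        ≈⟨ +-cong (*-congˡ 1ℝ (≈-trans (subtractPrevious-invariant (fix-first ma (c Fin.zero))
        (ρ ∘ Fin.suc) (c ∘ Fin.suc)) (≈-sym (head∷tail ma c))))
                                           (*-congˡ (- ρ Fin.zero) (F-adjacent ma e Fin.zero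
                                             (Fin.suc Fin.zero) refl (λ i → ≈-refl))) ⟩
      1ℝ * F c + - ρ Fin.zero * 0ℝ    ≈⟨ solve 2 (λ x r → con 1ℚ :* x :+ :- r :* con 0ℚ := x)
        ≈-refl (F c) (ρ Fin.zero) ⟩
      F c                             ∎
    where
    open ≤-R
    d e : Fin (suc (suc k)) → Column n
    d = c Fin.zero ∷ subtractPrevious (ρ ∘ Fin.suc) (c ∘ Fin.suc)
    e Fin.zero                = c Fin.zero
    e (Fin.suc Fin.zero)      = c Fin.zero
    e (Fin.suc (Fin.suc j)) i = c (Fin.suc (Fin.suc j)) i - ρ (Fin.suc j) * c (Fin.suc (inject₁ j))
      i
    cd : ∀ j → j ≢ Fin.suc Fin.zero → ∀ i → subtractPrevious ρ c j i ≈ d j i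
    cd Fin.zero _ i = ≈-refl
    cd (Fin.suc Fin.zero) q i = ⊥-elim (q refl)
    cd (Fin.suc (Fin.suc j)) _ i = ≈-refl
    ce : ∀ j → j ≢ Fin.suc Fin.zero → ∀ i → subtractPrevious ρ c j i ≈ e j i
    ce Fin.zero _ i = ≈-refl
    ce (Fin.suc Fin.zero) q i = ⊥-elim (q refl)
    ce (Fin.suc (Fin.suc j)) _ i = ≈-refl

  -- Only nonempty combinations with strictly positive coefficients are formed, so that positivity
  -- on the generators carries over strictly.
  data Cone {n} (S : Column n → Set) : Column n → Set where
    ray : ∀ {v w} a → S v → 0ℝ < a → (∀ i → w i ≈ a * v i) → Cone S w
    sum : ∀ {u v w} → Cone S u → Cone S v → (∀ i → w i ≈ u i + v i) → Cone S w

  Cone-scale : ∀ {n} {S : Column n → Set} {w v} a → 0ℝ < a → (∀ i → v i ≈ a * w i) → Cone S w →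
    Cone S v
  Cone-scale a a>0 h (ray {v} b s b>0 g) = ray (a * b) s (0<* a>0 b>0) λ i →
    ≈-trans (h i) (≈-trans (*-congˡ a (g i)) (≈-sym (*-assoc a b (v i))))
  Cone-scale a a>0 h (sum {u} {v} p q g) =
    sum (Cone-scale {v = λ i → a * u i} a a>0 (λ i → ≈-refl) p)
    (Cone-scale {v = λ i → a * v i} a a>0 (λ i → ≈-refl) q) λ i →
      ≈-trans (h i) (≈-trans (*-congˡ a (g i)) (*-distribˡ-+ a (u i) (v i)))

  -- Multilinear expansion, column by column, writes `F c` as a positive combination of values on
  -- generators. The set `S j` varies with the column, so that it can confine each column to its own
  -- range of degrees.
  positive-on-cones : ∀ {n k} {F : (Fin k → Column n) → ℝ} → MultilinearAlternating F →
    (S : Fin k → Column n → Set) →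
    (∀ c → (∀ j → S j (c j)) → 0ℝ < F c) → ∀ c → (∀ j → Cone (S j) (c j)) → 0ℝ < F c
  positive-on-cones {k = zero} ma S h c cones = h c λ ()
  positive-on-cones {n} {k = suc k} {F} ma S h c cones =
    <-resp ≈-refl (≈-sym (head∷tail ma c)) (first (cones Fin.zero))
    where
    first : ∀ {w} → Cone (S Fin.zero) w → 0ℝ < F (w ∷ (c ∘ Fin.suc))
    first {w} (ray {v} a s a>0 g) = <-resp ≈-refl
      (≈-sym (≈-trans (F-linear ma Fin.zero a 0ℝ (w ∷ (c ∘ Fin.suc)) (v ∷ (c ∘ Fin.suc))
        (v ∷ (c ∘ Fin.suc))
          (λ { Fin.zero q i → ⊥-elim (q refl) ; (Fin.suc j) q i → ≈-refl })
            (λ { Fin.zero q i → ⊥-elim (q refl) ; (Fin.suc j) q i → ≈-refl })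
          (λ i → ≈-trans (g i) (solve 2 (λ a v → a :* v := a :* v :+ con 0ℚ :* v) ≈-refl a (v i))))
        (solve 2 (λ a f → a :* f :+ con 0ℚ :* f := a :* f) ≈-refl a (F (v ∷ (c ∘ Fin.suc))))))
      (0<* a>0 (positive-on-cones (fix-first ma v) (S ∘ Fin.suc)
        (λ d hd → h (v ∷ d) λ { Fin.zero → s ; (Fin.suc j) → hd j }) (c ∘ Fin.suc)
          (λ j → cones (Fin.suc j))))
    first {w} (sum {u} {v} p q g) = <-resp ≈-refl
      (≈-sym (≈-trans (F-linear ma Fin.zero 1ℝ 1ℝ (w ∷ (c ∘ Fin.suc)) (u ∷ (c ∘ Fin.suc))
        (v ∷ (c ∘ Fin.suc))
          (λ { Fin.zero q i → ⊥-elim (q refl) ; (Fin.suc j) q i → ≈-refl })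
            (λ { Fin.zero q i → ⊥-elim (q refl) ; (Fin.suc j) q i → ≈-refl })
          (λ i → ≈-trans (g i) (solve 2 (λ u v → u :+ v := con 1ℚ :* u :+ con 1ℚ :* v) ≈-refl (u i)
            (v i))))
        (solve 2 (λ f g → con 1ℚ :* f :+ con 1ℚ :* g := f :+ g) ≈-refl (F (u ∷ (c ∘ Fin.suc)))
          (F (v ∷ (c ∘ Fin.suc))))))
      (0<+ (first p) (<⇒≤ (first q)))

  -- Positivity of determinants of products of shifts

  module ShiftedPowers (c : ℕ → ℝ) where

    P : ℕ → ℝ → ℝ
    P zero    x = 1ℝ
    P (suc d) x = (x + c d) * P d x

    0<P : ∀ d {x} → (∀ l → 0ℝ < x + c l) → 0ℝ < P d x
    0<P zero    h = 0<1
    0<P (suc d) h = 0<* (h d) (0<P d h)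

    module _ (x₀ : ℝ) (x₀+c>0 : ∀ l → 0ℝ < x₀ + c l) where

      -- The quotient of `P (e + s) x₀` by `P s x₀`, written as a product: the multiplier that makes
      -- an entry in the row of `x₀` vanish.
      ratio : ℕ → ℕ → ℝ
      ratio s zero    = 1ℝ
      ratio s (suc e) = (x₀ + c (e ℕ.+ s)) * ratio s e

      -- (P (e + s) x - ratio s e * P s x) / (x - x₀)
      quotient : ℕ → ℕ → ℝ → ℝ
      quotient s zero    x = 0ℝ
      quotient s (suc e) x = P (e ℕ.+ s) x + (x₀ + c (e ℕ.+ s)) * quotient s e x

      -- The last factor x + c l is split as (x - x₀) + (x₀ + c l); the second part is covered by
      -- induction.
      division : ∀ s e x → P (e ℕ.+ s) x - ratio s e * P s x ≈ (x - x₀) * quotient s e x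
      division s zero    x = solve 3 (λ p x y → p :- con 1ℚ :* p := (x :- y) :* con 0ℚ)
        ≈-refl (P s x) x x₀
      division s (suc e) x = begin-equality
        (x + c l) * P l x - (x₀ + c l) * ratio s e * P s x
          ≈⟨ solve 6 (λ x y c p r q → (x :+ c) :* p :- (y :+ c) :* r :* q :=
            (x :- y) :* p :+ (y :+ c) :* (p :- r :* q)) ≈-refl x x₀ (c l) (P l x) (ratio s e)
            (P s x) ⟩
        (x - x₀) * P l x + (x₀ + c l) * (P l x - ratio s e * P s x)
          ≈⟨ +-cong ≈-refl (*-congˡ (x₀ + c l) (division s e x)) ⟩
        (x - x₀) * P l x + (x₀ + c l) * ((x - x₀) * quotient s e x)
          ≈⟨ solve 4 (λ d p a q → d :* p :+ a :* (d :* q) := d :* (p :+ a :* q)) ≈-refl (x - x₀)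
            (P l x) (x₀ + c l) (quotient s e x) ⟩
        (x - x₀) * (P l x + (x₀ + c l) * quotient s e x) ∎
        where
        open ≤-R
        l : ℕ
        l = e ℕ.+ s

      Between : ∀ {n} → (Fin n → ℝ) → ℕ → ℕ → Column n → Set
      Between x s t v = ∃[ l ] s ℕ.≤ l × l ℕ.< t × (∀ i → v i ≈ P l (x i))

      -- Unrolled, the quotient is the sum over s ≤ l ≤ e + s of `P l x` times the product of x₀ + c
      -- k over l < k ≤ e + s, and these coefficients are positive.
      quotient-cone : ∀ {n} (x : Fin n → ℝ) s e t → e ℕ.+ s ℕ.< t →
        Cone (Between x s t) (λ i → quotient s (suc e) (x i))
      quotient-cone x s zero    t h = ray {v = λ i → P s (x i)} 1ℝ (s , ℕ.≤-refl , h , λ i →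
        ≈-refl) 0<1 λ i →
        solve 2 (λ p a → p :+ a :* con 0ℚ := con 1ℚ :* p) ≈-refl (P s (x i)) (x₀ + c s)
      quotient-cone x s (suc e) t h = sum
        (ray {v = λ i → P (suc e ℕ.+ s) (x i)} {w = λ i → P (suc e ℕ.+ s) (x i)} 1ℝ (suc e ℕ.+ s ,
          ℕ.m≤n+m s (suc e) , h , λ i → ≈-refl) 0<1
          λ i → ≈-sym (*-identityˡ _))
        (Cone-scale {v = λ i → (x₀ + c (suc e ℕ.+ s)) * quotient s (suc e) (x i)}
          (x₀ + c (suc e ℕ.+ s)) (x₀+c>0 (suc e ℕ.+ s)) (λ i → ≈-refl)
          (quotient-cone x s e t (ℕ.<-trans (ℕ.n<1+n _) h)))
        λ i → ≈-refl

    StrictlyIncreasing : ∀ {n} → (Fin n → ℝ) → Set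
    StrictlyIncreasing x = ∀ {i j} → i Fin.< j → x i < x j

    -- Subtract from each column the multiple of the previous one that cancels
    -- its first entry.  In the remaining minor the row of xᵢ is divisible by
    -- xᵢ - x₀, and each quotient is a positive combination of P l with
    -- d j ≤ l < d (j + 1): expand and induct.
    0<det : ∀ {k} (x : Fin k → ℝ) (d : Fin k → ℕ) → StrictlyIncreasing x →
      (∀ i l → 0ℝ < x i + c l) →
      (∀ {i j} → i Fin.< j → d i ℕ.< d j) → 0ℝ < det (λ i j → P (d j) (x i))
    0<det {zero}  x d x-inc x+c d-inc = 0<1
    0<det {suc k} x d x-inc x+c d-inc = <-resp ≈-refl (≈-sym expansion)
      (0<* (0<P (d Fin.zero) (x+c Fin.zero))
        (0<* (0<∏ {r = rows} (λ i → 0<- (x-inc {Fin.zero} {Fin.suc i} (ℕ.s≤s ℕ.z≤n))))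
        (positive-on-cones det-multilinearAlternating S S-positive columns S-cones)))
      where
      x₀ : ℝ
      x₀ = x Fin.zero
      -- One less than the difference of the degrees, because `quotient-cone` needs at least one
      -- factor to divide and is stated for `suc e`.
      gap : Fin k → ℕ
      gap j = d (Fin.suc j) ℕ.∸ suc (d (inject₁ j))
      d-suc : ∀ j → d (inject₁ j) ℕ.< d (Fin.suc j)
      d-suc j = d-inc (ℕ.≤-reflexive (cong suc (Fin.toℕ-inject₁ j)))
      gap≡ : ∀ j → suc (gap j) ℕ.+ d (inject₁ j) ≡ d (Fin.suc j)
      gap≡ j = trans (sym (ℕ.+-suc (gap j) (d (inject₁ j)))) (ℕ.m∸n+n≡m (d-suc j))
      ρ : Fin k → ℝ
      ρ j = ratio x₀ (x+c Fin.zero) (d (inject₁ j)) (suc (gap j))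
      quot : Fin k → ℝ → ℝ
      quot j = quotient x₀ (x+c Fin.zero) (d (inject₁ j)) (suc (gap j))
      columns : Fin k → Column k
      columns j i = quot j (x (Fin.suc i))
      rows : Fin k → ℝ
      rows i = x (Fin.suc i) - x₀
      reduced : Fin (suc k) → Column (suc k)
      reduced = subtractPrevious ρ (λ j i → P (d j) (x i))
      reduced-suc : ∀ j i → reduced (Fin.suc j) i ≈ (x i - x₀) * quot j (x i)
      reduced-suc j i = ≈-trans (sub-cong (≡⇒≈ (cong (λ l → P l (x i)) (sym (gap≡ j)))) ≈-refl)
        (division x₀ (x+c Fin.zero) (d (inject₁ j)) (suc (gap j)) (x i))
      expansion : det (λ i j → P (d j) (x i)) ≈ P (d Fin.zero)
        x₀ * (∏ rows * det (λ i j → columns j i))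
      expansion = begin-equality
        det (λ i j → P (d j) (x i))
          ≈⟨ subtractPrevious-invariant det-multilinearAlternating ρ (λ j i → P (d j) (x i)) ⟨
        det (λ i j → reduced j i)
          ≈⟨ sub-cong ≈-refl (altSum-zero λ j →
            ≈-trans (*-congʳ (det (minor (λ i j → reduced j i) (Fin.suc j)))
            (reduced-suc j Fin.zero))
               (solve 3 (λ x q m → (x :- x) :* q :* m := con 0ℚ) ≈-refl x₀ (quot j x₀) _)) ⟩
        P (d Fin.zero) x₀ * det (λ i j → reduced (Fin.suc j) (Fin.suc i)) - 0ℝ
          ≈⟨ solve 1 (λ x → x :- con 0ℚ := x) ≈-refl _ ⟩
        P (d Fin.zero) x₀ * det (λ i j → reduced (Fin.suc j) (Fin.suc i))
          ≈⟨ *-congˡ (P (d Fin.zero) x₀) (≈-trans (det-cong λ i j → reduced-suc j (Fin.suc i))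
            (det-scale-rows rows (λ i j → columns j i))) ⟩
        P (d Fin.zero) x₀ * (∏ rows * det (λ i j → columns j i)) ∎
        where open ≤-R
      S : Fin k → Column k → Set
      S j = Between x₀ (x+c Fin.zero) (x ∘ Fin.suc) (d (inject₁ j)) (d (Fin.suc j))
      S-cones : ∀ j → Cone (S j) (columns j)
      S-cones j = quotient-cone x₀ (x+c Fin.zero) (x ∘ Fin.suc) (d (inject₁ j)) (gap j)
        (d (Fin.suc j)) (ℕ.≤-reflexive (gap≡ j))
      -- The half-open ranges of degrees of successive columns do not overlap. Hence any choice of
      -- one degree from each is strictly increasing, as the induction hypothesis requires.
      d-mono : ∀ {i j : Fin k} → i Fin.< j → d (Fin.suc i) ℕ.≤ d (inject₁ j)
      d-mono {i} {j} h with ℕ.m≤n⇒m<n∨m≡n h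
      ... | inj₁ l = ℕ.<⇒≤ (d-inc (subst (suc (toℕ i) ℕ.<_) (sym (Fin.toℕ-inject₁ j)) l))
      ... | inj₂ e = ℕ.≤-reflexive (cong d (Fin.toℕ-injective (trans e (sym (Fin.toℕ-inject₁ j)))))
      S-positive : ∀ v → (∀ j → S j (v j)) → 0ℝ < det (λ i j → v j i)
      S-positive v s = <-resp ≈-refl (det-cong λ i j → ≈-sym (proj₂ (proj₂ (proj₂ (s j))) i))
        (0<det (x ∘ Fin.suc) (λ j → proj₁ (s j)) (λ h → x-inc (ℕ.s≤s h)) (λ i → x+c (Fin.suc i))
          λ {i} {j} h → ℕ.<-≤-trans (proj₁ (proj₂ (proj₂ (s i))))
            (ℕ.≤-trans (d-mono h) (proj₁ (proj₂ (s j)))))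

  -- Gamma and beta matrices

  infixr 8 _^_
  _^_ : ℝ → ℕ → ℝ
  x ^ zero  = 1ℝ
  x ^ suc n = x * x ^ n

  ^-def : ∀ x n → x D.^ n ≈ x ^ n
  ^-def x zero    = D1≈1
  ^-def x (suc n) = ≈-trans (≡⇒≈ (*-def x (x D.^ n))) (*-congˡ x (^-def x n))

  sgn : ℕ → ℝ
  sgn zero    = 1ℝ
  sgn (suc k) = - sgn k

  sgn-power : ∀ {x} → x ≈ - 1ℝ → ∀ k → x D.^ k ≈ sgn k
  sgn-power {x} h k = ≈-trans (^-def x k) (go k)
    where
    go : ∀ k → x ^ k ≈ sgn k
    go zero    = ≈-refl
    go (suc k) = ≈-trans (*-cong h (go k)) (solve 1 (λ s → :- con 1ℚ :* s := :- s) ≈-refl (sgn k))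

  D-1≈-1 : D.- D.1ℝ ≈ - 1ℝ
  D-1≈-1 = ≈-trans (≡⇒≈ (neg-def D.1ℝ)) (-‿cong D1≈1)

  -- The operation is abstract because comparing sums formed with D._+_ unfolds
  -- the moduli of convergence.
  signed-sum : ∀ (_∙_ : ℝ → ℝ → ℝ) z → (∀ x y → x ∙ y ≈ x + y) → z ≈ 0ℝ →
    ∀ {n} a (u t : Fin n → ℝ) → (∀ j → u j ≈ a * (sgn (toℕ j) * t j)) →
      Vector.foldr _∙_ z u ≈ a * altSum t
  signed-sum _∙_ z ∙-def z≈0 {zero}  a u t h = ≈-trans z≈0 (solve 1 (λ a → con 0ℚ := a :* con 0ℚ)
    ≈-refl a)
  signed-sum _∙_ z ∙-def z≈0 {suc n} a u t h =
    ≈-trans (∙-def (u Fin.zero) (Vector.foldr _∙_ z (u ∘ Fin.suc)))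
    (≈-trans (+-cong (h Fin.zero) (signed-sum _∙_ z ∙-def z≈0 (- a) (u ∘ Fin.suc) (t ∘ Fin.suc)
      λ j → ≈-trans (h (Fin.suc j))
        (solve 3 (λ a s t → a :* (:- s :* t) := (:- a) :* (s :* t)) ≈-refl a (sgn (toℕ j))
          (t (Fin.suc j)))))
      (solve 3 (λ a t r → a :* (con 1ℚ :* t) :+ (:- a) :* r := a :* (t :- r)) ≈-refl a (t Fin.zero)
        (altSum (t ∘ Fin.suc))))

  det-expansion : ∀ {n} (A : D.Matrix (suc n) (suc n)) → D.det A ≡ Vector.foldr D._+_ D.0ℝ
    (λ j → (D.- D.1ℝ) D.^ toℕ j D.* (A Fin.zero j D.* D.det (λ i k → A (Fin.suc i) (punchIn j k))))
  det-expansion A = refl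

  *-*-def : ∀ s a d → s D.* (a D.* d) ≈ s * (a * d)
  *-*-def s a d = ≡⇒≈ (trans (*-def s (a D.* d)) (cong (λ y → s * y) (*-def a d)))

  det-def : ∀ {n} (A : D.Matrix n n) → D.det A ≈ det A
  det-def {zero}  A = D1≈1
  det-def {suc n} A = ≈-trans (≡⇒≈ (det-expansion A)) (≈-trans
    (signed-sum D._+_ D.0ℝ (λ x y → ≡⇒≈ (+-def x y)) D0≈0 1ℝ
      (λ j → (D.- D.1ℝ) D.^ toℕ j D.* (A Fin.zero j D.* D.det (λ i k →
      A (Fin.suc i) (punchIn j k))))
      (λ j → A Fin.zero j * det (minor A j))
      λ j → ≈-trans (*-*-def ((D.- D.1ℝ) D.^ toℕ j) (A Fin.zero j)
        (D.det (λ i k → A (Fin.suc i) (punchIn j k))))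
        (≈-trans (*-cong (sgn-power D-1≈-1 (toℕ j)) (*-congˡ (A Fin.zero j) (det-def (minor A j))))
          (≈-sym (*-identityˡ _))))
    (*-identityˡ (altSum λ j → A Fin.zero j * det (minor A j))))

  ^-cong : ∀ {x y} n → x ≈ y → x ^ n ≈ y ^ n
  ^-cong zero    h = ≈-refl
  ^-cong (suc n) h = *-cong h (^-cong n h)

  ^-* : ∀ x y n → (x * y) ^ n ≈ x ^ n * y ^ n
  ^-* x y zero    = solve 0 (con 1ℚ := con 1ℚ :* con 1ℚ) ≈-refl
  ^-* x y (suc n) = ≈-trans (*-congˡ (x * y) (^-* x y n))
    (solve 4 (λ x y a b → x :* y :* (a :* b) := x :* a :* (y :* b)) ≈-refl x y (x ^ n) (y ^ n))

  1^ : ∀ n → 1ℝ ^ n ≈ 1ℝ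
  1^ zero    = ≈-refl
  1^ (suc n) = ≈-trans (*-identityˡ (1ℝ ^ n)) (1^ n)

  0<^ : ∀ {x} n → 0ℝ < x → 0ℝ < x ^ n
  0<^ zero    h = 0<1
  0<^ (suc n) h = 0<* h (0<^ n h)

  real-*⁺ : ∀ x y → real (x D.*⁺ y) ≈ real x * real y
  real-*⁺ x y = ≡⇒≈ (*-def (real x) (real y))

  real-^⁺ : ∀ x n → real (x D.^⁺ n) ≈ real x ^ n
  real-^⁺ x zero    = D1≈1
  real-^⁺ x (suc n) = ≈-trans (real-*⁺ x (x D.^⁺ n)) (*-congˡ (real x) (real-^⁺ x n))

  inverse-unique : ∀ {p e w} → p * e ≈ 1ℝ → p * w ≈ 1ℝ → e ≈ w
  inverse-unique {p} {e} {w} h g = begin-equality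
    e             ≈⟨ solve 1 (λ e → e := e :* con 1ℚ) ≈-refl e ⟩
    e * 1ℝ        ≈⟨ *-congˡ e g ⟨
    e * (p * w)   ≈⟨ solve 3 (λ e p w → e :* (p :* w) := p :* e :* w) ≈-refl e p w ⟩
    p * e * w     ≈⟨ *-congʳ w h ⟩
    1ℝ * w        ≈⟨ *-identityˡ w ⟩
    w             ∎
    where open ≤-R

  β-def : ∀ (Γ⁺ : ℝ⁺ → ℝ⁺) x y → real (D.β Γ⁺ x y) ≈ real (Γ⁺ x) * real (Γ⁺ y) * real
    (Γ⁺ (x D.+⁺ y) D.⁻¹)
  β-def Γ⁺ x y = ≈-trans (real-*⁺ (Γ⁺ x D.*⁺ Γ⁺ y) (Γ⁺ (x D.+⁺ y) D.⁻¹))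
    (*-congʳ (real (Γ⁺ (x D.+⁺ y) D.⁻¹)) (real-*⁺ (Γ⁺ x) (Γ⁺ y)))

  -- Inverses are accessible only through `inverse`, so the right side is checked to be an inverse
  -- of the power. Its last two factors depend on the row alone and on the column alone.
  reciprocal-β-power : ∀ (Γ⁺ : ℝ⁺ → ℝ⁺) x y m → real ((D.β Γ⁺ x y D.^⁺ m) D.⁻¹) ≈
    real (Γ⁺ (x D.+⁺ y)) ^ m * (real (Γ⁺ x D.⁻¹) ^ m * real (Γ⁺ y D.⁻¹) ^ m)
  reciprocal-β-power Γ⁺ x y m = inverse-unique (inverse (D.β Γ⁺ x y D.^⁺ m)) (begin-equality
    real (D.β Γ⁺ x y D.^⁺ m) * (s ^ m * (p′ ^ m * q′ ^ m))
      ≈⟨ *-cong (≈-trans (real-^⁺ (D.β Γ⁺ x y) m) (^-cong m (β-def Γ⁺ x y)))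
           (≈-trans (*-congˡ (s ^ m) (≈-sym (^-* p′ q′ m))) (≈-sym (^-* s (p′ * q′) m))) ⟩
    (p * q * s′) ^ m * (s * (p′ * q′)) ^ m
      ≈⟨ ^-* (p * q * s′) (s * (p′ * q′)) m ⟨
    (p * q * s′ * (s * (p′ * q′))) ^ m
      ≈⟨ ^-cong m (solve 6 (λ p q s p′ q′ s′ → p :* q :* s′ :* (s :* (p′ :* q′)) :=
        (p :* p′) :* ((q :* q′) :* (s :* s′))) ≈-refl p q s p′ q′ s′) ⟩
    (p * p′ * (q * q′ * (s * s′))) ^ m
      ≈⟨ ^-cong m (*-cong (inverse (Γ⁺ x)) (*-cong (inverse (Γ⁺ y)) (inverse (Γ⁺ (x D.+⁺ y))))) ⟩
    (1ℝ * (1ℝ * 1ℝ)) ^ m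
      ≈⟨ ^-cong m (solve 0 (con 1ℚ :* (con 1ℚ :* con 1ℚ) := con 1ℚ) ≈-refl) ⟩
    1ℝ ^ m
      ≈⟨ 1^ m ⟩
    1ℝ ∎)
    where
    open ≤-R
    p q s p′ q′ s′ : ℝ
    p = real (Γ⁺ x)
    q = real (Γ⁺ y)
    s = real (Γ⁺ (x D.+⁺ y))
    p′ = real (Γ⁺ x D.⁻¹)
    q′ = real (Γ⁺ y D.⁻¹)
    s′ = real (Γ⁺ (x D.+⁺ y) D.⁻¹)

  -- Powers of Γ as products of shifts

  module _ (m : ℕ) .{{_ : NonZero m}} where

    -- Each factor of the rising factorial x (x + 1) ⋯ (x + d - 1) repeated m times.
    shift : ℕ → ℝ
    shift l = fromℕ (l / m)

    open ShiftedPowers shift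

    shift-block : ∀ d l → l ℕ.< m → shift (l ℕ.+ d ℕ.* m) ≡ fromℕ d
    shift-block d l h = cong fromℕ (trans (+-distrib-/-∣ʳ l (n∣m*n d))
      (cong₂ ℕ._+_ (m<n⇒m/n≡0 h) (m*n/n≡m d m)))

    -- The indices from d m to d m + m - 1 share the shift d, so a full block of `m` factors is (x +
    -- d)^m. Partial blocks `e ≤ m` are there for the induction.
    P-block : ∀ d x e → e ℕ.≤ m → P (e ℕ.+ d ℕ.* m) x ≈ (x + fromℕ d) ^ e * P (d ℕ.* m) x
    P-block d x zero    h = ≈-sym (*-identityˡ _)
    P-block d x (suc e) h = ≈-trans (*-cong (+-cong ≈-refl (≡⇒≈ (shift-block d e h)))
      (P-block d x e (ℕ.<⇒≤ h)))
      (≈-sym (*-assoc (x + fromℕ d) _ _))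

    0<shift : ∀ {x} → 0ℝ < x → ∀ l → 0ℝ < x + shift l
    0<shift h l = 0<+ h (0≤fromℕ (l / m))

    -- The common form of both matrices. It passes to submatrices, so one determinant estimate
    -- covers all minors.
    Separable : ∀ {p n} → D.Matrix p n → Set
    Separable {p} {n} A = Σ[ x ∈ (Fin p → ℝ) ] Σ[ d ∈ (Fin n → ℕ) ] Σ[ a ∈ (Fin p → ℝ) ] Σ[ b ∈
      (Fin n → ℝ) ]
      StrictlyIncreasing x × (∀ i → 0ℝ < x i) × (∀ {i j} → i Fin.< j → d i ℕ.< d j) ×
      (∀ i → 0ℝ < a i) × (∀ j → 0ℝ < b j) × (∀ i j → A i j ≈ a i * (b j * P (d j) (x i)))

    separable⇒totallyPositive : ∀ {p n} (A : D.Matrix p n) → Separable A → D.TotallyPositive A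
    separable⇒totallyPositive A (x , d , a , b , x-inc , x>0 , d-inc , a>0 , b>0 , A≈) k r c r-inc
      c-inc = positive⁺
      (<-resp ≈-refl (≈-sym (≈-trans (det-def (λ i j → A (r i) (c j)))
          (≈-trans (det-cong λ i j → A≈ (r i) (c j))
            (det-scale-rows (a ∘ r) (λ i j → b (c j) * P (d (c j)) (x (r i)))))))
        (0<* (0<∏ {r = a ∘ r} (λ i → a>0 (r i)))
          -- The row factors have been pulled out; a column factor is absorbed by regarding its
          -- column as a single ray.
          (positive-on-cones det-multilinearAlternating (λ j v → ∀ i → v i ≈ P (d (c j)) (x (r i)))
            (λ v h → <-resp ≈-refl (det-cong λ i j → ≈-sym (h j i))
              (0<det (x ∘ r) (d ∘ c) (λ h → x-inc (r-inc h)) (λ i → 0<shift (x>0 (r i)))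
                (λ h → d-inc (c-inc h))))
            (λ j i → b (c j) * P (d (c j)) (x (r i)))
            λ j → ray {v = λ i → P (d (c j)) (x (r i))} (b (c j)) (λ i → ≈-refl) (b>0 (c j)) (λ i →
              ≈-refl))))

    module _ (Γ : ℝ⁺ → ℝ) (isΓ : D.IsGammaFunction Γ) where
      open Gamma Γ isΓ

      -- Each application of Γ(w + 1) = w Γ(w) at w = y + d contributes, after taking m-th powers,
      -- one block of `P`.
      Γ-rising : ∀ d y z → real z ≈ real y + fromℕ d → Γ z ^ m ≈ Γ y ^ m * P (d ℕ.* m) (real y)
      Γ-rising zero    y z h = ≈-trans
        (^-cong m (Γ-cong z y (≈-trans h (solve 1 (λ y → y :+ con 0ℚ := y) ≈-refl (real y)))))
        (solve 1 (λ g → g := g :* con 1ℚ) ≈-refl (Γ y ^ m))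
      Γ-rising (suc d) y z h = begin-equality
        Γ z ^ m
          ≈⟨ ^-cong m (Γ-suc w z (≈-trans h (≈-trans (+-cong ≈-refl (fromℕ-suc d))
                                                                          (solve 2 (λ y d → y :+ (con 1ℚ :+ d) := y :+ d :+ con 1ℚ) ≈-refl (real y) (fromℕ d))))) ⟩
        ((real y + fromℕ d) * Γ w) ^ m
          ≈⟨ ^-* (real y + fromℕ d) (Γ w) m ⟩
        (real y + fromℕ d) ^ m * Γ w ^ m
          ≈⟨ *-congˡ ((real y + fromℕ d) ^ m) (Γ-rising d y w ≈-refl) ⟩
        (real y + fromℕ d) ^ m * (Γ y ^ m * P (d ℕ.* m) (real y))
          ≈⟨ solve 3 (λ a g p → a :* (g :* p) := g :* (a :* p)) ≈-refl ((real y + fromℕ d) ^ m)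
          (Γ y ^ m) (P (d ℕ.* m) (real y)) ⟩
        Γ y ^ m * ((real y + fromℕ d) ^ m * P (d ℕ.* m) (real y))
          ≈⟨ *-congˡ (Γ y ^ m) (P-block d (real y) m ℕ.≤-refl) ⟨
        Γ y ^ m * P (suc d ℕ.* m) (real y)                           ∎
        where
        open ≤-R
        w : ℝ⁺
        w = real⁺ (real y + fromℕ d) (0<+ (real⁺>0 y) (0≤fromℕ d))

  -- Integer offsets of the column parameters and the two matrices

  Steps : ∀ {n} → (Fin n → ℝ) → Set
  Steps mu = ∀ i j → toℕ j ≡ suc (toℕ i) → ∃[ d ] 0 ℕ.< d × mu j ≈ mu i + fromℕ d

  tail-steps : ∀ {n} (mu : Fin (suc n) → ℝ) → Steps mu → Steps (mu ∘ Fin.suc)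
  tail-steps mu s i j e = s (Fin.suc i) (Fin.suc j) (cong suc e)

  first-step : ∀ {n} (mu : Fin (suc (suc n)) → ℝ) → Steps mu →
    ∃[ d ] 0 ℕ.< d × mu (Fin.suc Fin.zero) ≈ mu Fin.zero + fromℕ d
  first-step mu s = s Fin.zero (Fin.suc Fin.zero) refl

  offset : ∀ {n} (mu : Fin (suc n) → ℝ) → Steps mu → Fin (suc n) → ℕ
  offset mu s Fin.zero = 0
  offset {suc n} mu s (Fin.suc j) = offset (mu ∘ Fin.suc) (tail-steps mu s) j ℕ.+ proj₁
    (first-step mu s)

  offset-correct : ∀ {n} (mu : Fin (suc n) → ℝ) s j → mu j ≈ mu Fin.zero + fromℕ (offset mu s j)
  offset-correct mu s Fin.zero = solve 1 (λ x → x := x :+ con 0ℚ) ≈-refl (mu Fin.zero)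
  offset-correct {suc n} mu s (Fin.suc j) = begin-equality
    mu (Fin.suc j)                            ≈⟨ offset-correct (mu ∘ Fin.suc) (tail-steps mu s) j ⟩
    mu (Fin.suc Fin.zero) + fromℕ e           ≈⟨ +-cong (proj₂ (proj₂ (first-step mu s))) ≈-refl ⟩
    mu Fin.zero + fromℕ d + fromℕ e           ≈⟨ solve 3 (λ x d e → x :+ d :+ e := x :+ (e :+ d))
      ≈-refl (mu Fin.zero) (fromℕ d) (fromℕ e) ⟩
    mu Fin.zero + (fromℕ e + fromℕ d)         ≈⟨ +-cong ≈-refl (fromℕ-+ e d) ⟨
    mu Fin.zero + fromℕ (e ℕ.+ d)             ∎
    where
    open ≤-R
    d e : ℕ
    d = proj₁ (first-step mu s)
    e = offset (mu ∘ Fin.suc) (tail-steps mu s) j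

  offset-increasing : ∀ {n} (mu : Fin (suc n) → ℝ) s {i j} → i Fin.< j →
    offset mu s i ℕ.< offset mu s j
  offset-increasing {suc n} mu s {Fin.zero} {Fin.suc j} h =
    ℕ.<-≤-trans (proj₁ (proj₂ (first-step mu s))) (ℕ.m≤n+m (proj₁ (first-step mu s))
      (offset (mu ∘ Fin.suc) (tail-steps mu s) j))
  offset-increasing {suc n} mu s {Fin.suc i} {Fin.suc j} (ℕ.s≤s h) =
    ℕ.+-monoˡ-< (proj₁ (first-step mu s)) (offset-increasing (mu ∘ Fin.suc) (tail-steps mu s) h)

  opaque
    unfolding _+_

    fromℕ-def : ∀ d → D.fromℕ d ≈ fromℕ d
    fromℕ-def d = ≈-refl

  integer-steps : ∀ {n} (mu : Fin n → ℝ⁺) →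
    (∀ i j → toℕ j ≡ suc (toℕ i) → ∃[ d ] NonZero d × (real (mu j) D.- real (mu i) D.≈ D.fromℕ d))
      → Steps (real ∘ mu)
  integer-steps mu h i j e = let d , d>0 , g = h i j e in
    d , ℕ.>-nonZero⁻¹ d {{d>0}} ,
      ≈-trans (solve 2 (λ x y → y := x :+ (y :- x)) ≈-refl (real (mu i)) (real (mu j)))
      (+-cong ≈-refl (≈-trans (≈-sym (sub-def (real (mu j)) (real (mu i))))
        (≈-trans (≈-in {real (mu j) D.- real (mu i)} {D.fromℕ d} g) (fromℕ-def d))))

  module _ (Γ : ℝ⁺ → ℝ) (isΓ : D.IsGammaFunction Γ) {n : ℕ} (lam mu : Fin (suc n) → ℝ⁺)
           (lam-inc : ∀ i j → i Fin.< j → real (lam i) D.< real (lam j))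
           (mu-steps : ∀ i j → toℕ j ≡ suc (toℕ i) →
             ∃[ d ] NonZero d × (real (mu j) D.- real (mu i) D.≈ D.fromℕ d))
           (m : ℕ) .{{_ : NonZero m}} where
    open Gamma Γ isΓ
    open ShiftedPowers (shift m) using (P; StrictlyIncreasing)

    private
      steps : Steps (real ∘ mu)
      steps = integer-steps mu mu-steps

      base : Fin (suc n) → ℝ⁺
      base i = lam i D.+⁺ mu Fin.zero

      x : Fin (suc n) → ℝ
      x i = real (base i)

      -- A unit step of μ is one block of `m` factors of `P`.
      d : Fin (suc n) → ℕ
      d j = offset (real ∘ mu) steps j ℕ.* m

      real-+⁺≈ : ∀ p q → real (p D.+⁺ q) ≈ real p + real q
      real-+⁺≈ p q = ≡⇒≈ (real-+⁺ p q)

      x-inc : StrictlyIncreasing x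
      x-inc {i} {j} h = <-resp (≈-sym (real-+⁺≈ (lam i) (mu Fin.zero)))
        (≈-sym (real-+⁺≈ (lam j) (mu Fin.zero)))
        (+-monoˡ-< (<-in {real (lam i)} {real (lam j)} (lam-inc i j h)))
        where
        +-monoˡ-< : ∀ {p q r} → p < q → p + r < q + r
        +-monoˡ-< {p} {q} {r} h = let ε , ε>0 , g = <⇒gap h in
          gap⇒< ε ε>0 (≤-trans (≈⇒≤ (solve 3 (λ p r e → p :+ r :+ e := p :+ e :+ r) ≈-refl p r
            (fromℚ ε))) (+-mono-≤ g ≤-refl))

      d-inc : ∀ {i j} → i Fin.< j → d i ℕ.< d j
      d-inc h = ℕ.*-monoˡ-< m (offset-increasing (real ∘ mu) steps h)

      Γ-power : ∀ i j → Γ (lam i D.+⁺ mu j) ^ m ≈ Γ (base i) ^ m * P (d j) (x i)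
      Γ-power i j = Γ-rising m Γ isΓ (offset (real ∘ mu) steps j) (base i) (lam i D.+⁺ mu j)
        (≈-trans (real-+⁺≈ (lam i) (mu j))
          (≈-trans (+-cong ≈-refl (offset-correct (real ∘ mu) steps j))
          (≈-trans (≈-sym (+-assoc _ _ _)) (+-cong (≈-sym (real-+⁺≈ (lam i) (mu Fin.zero)))
            ≈-refl))))

    gamma-powers-totallyPositive : D.TotallyPositive (λ i j → Γ (lam i D.+⁺ mu j) D.^ m)
    gamma-powers-totallyPositive = separable⇒totallyPositive m (λ i j → Γ (lam i D.+⁺ mu j) D.^ m)
      (x , d , (λ i → Γ (base i) ^ m) , (λ j → 1ℝ) , x-inc , (λ i → real⁺>0 (base i)) , d-inc ,
       (λ i → 0<^ m (Γ>0 (base i))) , (λ j → 0<1) , λ i j → ≈-trans (^-def (Γ (lam i D.+⁺ mu j)) m)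
         (≈-trans (Γ-power i j) (*-congˡ _ (≈-sym (*-identityˡ _)))))

    reciprocal-beta-powers-totallyPositive : (Γ⁺ : ℝ⁺ → ℝ⁺) → (∀ y → real (Γ⁺ y) ≈ Γ y) →
      D.TotallyPositive (λ i j → real ((D.β Γ⁺ (lam i) (mu j) D.^⁺ m) D.⁻¹))
    reciprocal-beta-powers-totallyPositive Γ⁺ Γ⁺≈Γ = separable⇒totallyPositive m (λ i j →
      real ((D.β Γ⁺ (lam i) (mu j) D.^⁺ m) D.⁻¹))
      (x , d , (λ i → Γ (base i) ^ m * inv (lam i)) , (λ j → inv (mu j)) , x-inc ,
        (λ i → real⁺>0 (base i)) , d-inc ,
       (λ i → 0<* (0<^ m (Γ>0 (base i))) (inv>0 (lam i))) , (λ j → inv>0 (mu j)) , λ i j →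
         ≈-trans (reciprocal-β-power Γ⁺ (lam i) (mu j) m)
           (≈-trans (*-congʳ (inv (lam i) * inv (mu j))
             (≈-trans (^-cong m (Γ⁺≈Γ (lam i D.+⁺ mu j))) (Γ-power i j)))
             (solve 4 (λ g p a b → g :* p :* (a :* b) := g :* a :* (b :* p))
               ≈-refl (Γ (base i) ^ m) (P (d j) (x i)) (inv (lam i)) (inv (mu j)))))
      where
      inv : ℝ⁺ → ℝ
      inv y = real (Γ⁺ y D.⁻¹) ^ m
      inv>0 : ∀ y → 0ℝ < inv y
      inv>0 y = 0<^ m (real⁺>0 (Γ⁺ y D.⁻¹))

open import Defs
open import Data.Fin.Base using () renaming (_<_ to _<ᶠ_)

theorem3p4 : (Γ : ℝ⁺ → ℝ) → IsGammaFunction Γ →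
    (n : ℕ) .{{_ : NonZero n}} (lam mu : Fin n → ℝ⁺) →
    (∀ i j → i <ᶠ j → real (lam i) < real (lam j)) →
    (∀ i j → i <ᶠ j → real (mu i) < real (mu j)) →
    (∀ i j → toℕ j ≡ suc (toℕ i) →
    ∃[ d ] NonZero d × (real (mu j) - real (mu i) ≈ fromℕ d)) →
    (m : ℕ) .{{_ : NonZero m}} →
    Σ[ Γ>0 ∈ (∀ x → 0ℝ < Γ x) ]
    TotallyPositive (λ i j → Γ (lam i +⁺ mu j) ^ m)
    × TotallyPositive (λ i j → real ((β (λ x → Γ x , Γ>0 x) (lam i) (mu j) ^⁺ m) ⁻¹))
theorem3p4 Γ isΓ (suc n) lam mu lam-inc _ mu-steps m =
  (λ x → positive⁺ (Gamma.Γ>0 Γ isΓ x)) ,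
  gamma-powers-totallyPositive Γ isΓ lam mu lam-inc mu-steps m ,
  reciprocal-beta-powers-totallyPositive Γ isΓ lam mu lam-inc mu-steps m
    (λ x → Γ x , positive⁺ (Gamma.Γ>0 Γ isΓ x)) (λ _ → ≈-refl)
  where open Development using (module Gamma; positive⁺; ≈-refl; gamma-powers-totallyPositive; reciprocal-beta-powers-totallyPositive)
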